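{- Let $\alpha<\beta$ be real numbers and let $R_{\alpha,\beta}=M(\{\alpha\},\{\beta\},[\alpha,\beta])$ be the Minkowski ring generated by the closed interval $[\alpha,\beta]\subseteq\mathbb{R}$ and its endpoints. Then, as $\mathbb{C}$-algebras: (1) If $0=\alpha<\beta$ or $\alpha<\beta=0$, then $R_{\alpha,\beta}\cong \mathbb{C}[x,y]/((y-1)(y-x))$. (2) If $0\notin\{\alpha,\beta\}$ and $\alpha/\beta\notin\mathbb{Q}$, then $R_{\alpha,\beta}\cong \mathbb{C}[x,y,z]/((z-x)(z-y))$. (3) If $\alpha/\beta=m/n\in\mathbb{Q}$ where $m$ and $n$ are relatively prime natural numbers, then $R_{\alpha,\beta}\cong \mathbb{C}[x,y,z]/((z-x)(z-y),\,y^m-x^n)$. (4) If $\alpha/\beta=-m/n\in\mathbb{Q}$ where $m$ and $n$ are relatively prime natural numbers, then $R_{\alpha,\beta}\cong \mathbb{C}[x,y,z]/((z-x)(z-y),\,x^ny^m-1)$.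
   Context: Natural numbers are positive integers. For $S\subseteq W=\mathbb{R}^d$ (here $d=1$), $\mathbf{1}_S=[S]:W\to\mathbb{C}$ denotes its indicator function. Let $M(\mathcal{P}(W))$ be the complex vector space of functions on $W$ spanned by the indicator functions of closed convex polyhedra; it is a commutative $\mathbb{C}$-algebra with the well-defined bilinear product determined by $[A]\cdot[B]=[A+B]$ (Minkowski sum) for nonempty closed convex polyhedra $A,B$, with unit $[\{0\}]$. For polytopes $P_1,\dots,P_n$ in $W$, the Minkowski ring $M(P_1,\dots,P_n)$ is the unital $\mathbb{C}$-subalgebra of $M(\mathcal{P}(W))$ generated by $[P_1],\dots,[P_n]$. -}

module Defs where

open import Algebra.Bundles using (CommutativeMonoid; CommutativeRing)
open import Algebra.Morphism.Structures using (module RingMorphisms)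
import Algebra.Properties.AbelianGroup as AbelianGroupProperties
import Algebra.Properties.CommutativeSemigroup as CommutativeSemigroupProperties
import Algebra.Properties.Ring as RingProperties
import Algebra.Properties.Semiring.Exp as Exp
import Algebra.Properties.Semiring.Mult as Mult
import Algebra.Properties.Semiring.Sum as Sum
import Algebra.Solver.Ring.NaturalCoefficients.Default as SemiringSolver
open import Data.Empty using (⊥-elim)
open import Data.Fin.Base using (Fin)
open import Data.Fin.Patterns using (0F; 1F; 2F)
open import Data.Integer.Base as ℤ using (ℤ; -[1+_])
open import Data.List.Base as List using (List; []; _∷_; _++_; filter; length)
open import Data.List.Membership.Propositional using (_∈_)
open import Data.List.Membership.Propositional.Properties using (∈-filter⁺; ∈-filter⁻; ∈-++⁺ʳ)
import Data.List.Extrema as Extrema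
open import Data.List.Properties using (filter-notAll; ++-assoc; ++-identityʳ)
open import Data.List.Relation.Unary.All as All using (All; []; _∷_)
import Data.List.Relation.Unary.Any as Any
open import Data.List.Relation.Unary.Any using (here; there)
import Algebra.Construct.NaturalChoice.Max as NaturalMax
import Algebra.Construct.NaturalChoice.Min as NaturalMin
import Data.Maybe.Relation.Unary.All as MaybeAll
open import Data.Maybe.Relation.Unary.All using (just; nothing)
open import Data.Maybe.Base as Maybe using (Maybe; just; nothing)
open import Data.Nat.Base as ℕ using (ℕ; zero; suc)
import Data.Nat.Properties as ℕ
open import Data.Nat.Induction using (<-wellFounded)
open import Data.Product.Base as Product using (Σ-syntax; ∃; ∃-syntax; ∃₂; _×_; _,_; proj₁; proj₂)
open import Data.Rational.Base as ℚ using (ℚ; ↥_; ↧ₙ_)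
open import Data.Sum.Base using (_⊎_; inj₁; inj₂)
open import Data.Vec.Base as Vec using (Vec; []; _∷_; zipWith; replicate; _[_]≔_)
import Data.Vec.Properties as Vec
open import Data.Vec.Functional using (Vector)
open import Function.Base using (_∘_; id)
open import Function.Bundles using (_⇔_; mk⇔; module Equivalence)
open import Induction.WellFounded using (Acc; acc)
open import Level using (Level; _⊔_; 0ℓ) renaming (suc to lsuc)
open import Relation.Binary.Bundles using (DecTotalOrder)
open import Relation.Binary.Core using (Rel)
open import Relation.Binary.PropositionalEquality.Core as ≡ using (_≡_)
open import Relation.Binary.PropositionalEquality.Properties using (isEquivalence)
import Relation.Binary.Properties.DecTotalOrder as DecTotalOrderProperties
import Relation.Binary.Reasoning.Setoid as SetoidReasoning
open import Relation.Binary.Structures using (IsDecTotalOrder; IsEquivalence)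
open import Relation.Nullary.Decidable using (Dec; yes; no; _×-dec_; ¬?; map′)
open import Relation.Nullary.Negation using (¬_; contradiction)
open import Relation.Unary using (Pred; _⊆_; _≐_)

private variable
  a c c₁ c₂ ℓ ℓ₁ ℓ₂ i : Level

open RingMorphisms using (IsRingHomomorphism; IsRingIsomorphism)

record CommutativeAlgebra (K : CommutativeRing 0ℓ 0ℓ) c ℓ : Set (lsuc (c ⊔ ℓ)) where
  field
    commutativeRing : CommutativeRing c ℓ

  open CommutativeRing commutativeRing public

  field
    -- k ↦ k · 1, which determines the K-module structure.
    scalar : CommutativeRing.Carrier K → Carrier
    scalar-isRingHomomorphism :
      IsRingHomomorphism (CommutativeRing.rawRing K) rawRing scalar

module _ {K : CommutativeRing 0ℓ 0ℓ} where

  infix 4 _≅_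

  _≅_ : CommutativeAlgebra K c₁ ℓ₁ → CommutativeAlgebra K c₂ ℓ₂ → Set _
  A ≅ B = Σ[ φ ∈ (A.Carrier → B.Carrier) ]
          IsRingIsomorphism A.rawRing B.rawRing φ ×
          (∀ k → φ (A.scalar k) B.≈ B.scalar k)
    where
    module A = CommutativeAlgebra A
    module B = CommutativeAlgebra B

module Quotient {K : CommutativeRing 0ℓ 0ℓ} (A : CommutativeAlgebra K c ℓ)
                {n : ℕ} (g : Vector (CommutativeAlgebra.Carrier A) n) where

  open CommutativeAlgebra A
  open Sum semiring using (sum; sum-syntax; ∑-distrib-+; *-distribˡ-sum; sum-cong-≋)
  open RingProperties ring using (x[y-z]≈xy-xz; -1*x≈-x)
  open AbelianGroupProperties +-abelianGroup using (⁻¹-∙-comm; x≈y⇒x∙y⁻¹≈ε; ⁻¹-anti-homo‿-)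
  open CommutativeSemigroupProperties +-commutativeSemigroup using (interchange)
  open SetoidReasoning setoid

  InIdeal : Pred Carrier (c ⊔ ℓ)
  InIdeal p = Σ[ h ∈ Vector Carrier n ] p ≈ ∑[ i < n ] (h i * g i)

  infix 4 _∼_

  _∼_ : Rel Carrier (c ⊔ ℓ)
  p ∼ q = InIdeal (p - q)

  private
    resp : ∀ {p q} → p ≈ q → InIdeal p → InIdeal q
    resp p≈q (h , eq) = h , trans (sym p≈q) eq

    add : ∀ {p q} → InIdeal p → InIdeal q → InIdeal (p + q)
    add {p} {q} (h , eq) (k , eq′) = (λ i → h i + k i) , (begin
      p + q
        ≈⟨ +-cong eq eq′ ⟩
      sum (λ i → h i * g i) + sum (λ i → k i * g i)
        ≈⟨ ∑-distrib-+ (λ i → h i * g i) (λ i → k i * g i) ⟨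
      sum (λ i → h i * g i + k i * g i)
        ≈⟨ sum-cong-≋ (λ i → sym (distribʳ (g i) (h i) (k i))) ⟩
      sum (λ i → (h i + k i) * g i) ∎)

    mul : ∀ r {p} → InIdeal p → InIdeal (r * p)
    mul r {p} (h , eq) = (λ i → r * h i) , (begin
      r * p                          ≈⟨ *-congˡ eq ⟩
      r * sum (λ i → h i * g i)      ≈⟨ *-distribˡ-sum r (λ i → h i * g i) ⟩
      sum (λ i → r * (h i * g i))    ≈⟨ sum-cong-≋ (λ i → sym (*-assoc r (h i) (g i))) ⟩
      sum (λ i → (r * h i) * g i)    ∎)

    zer : InIdeal 0#
    zer = resp (zeroˡ _) (mul 0# {sum (λ i → 0# * g i)} ((λ _ → 0#) , refl))

    neg : ∀ {p} → InIdeal p → InIdeal (- p)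
    neg {p} = resp (-1*x≈-x p) ∘ mul (- 1#)

    ≈⇒∼ : ∀ {p q} → p ≈ q → p ∼ q
    ≈⇒∼ p≈q = resp (sym (x≈y⇒x∙y⁻¹≈ε p≈q)) zer

    ∼-isEquivalence : IsEquivalence _∼_
    ∼-isEquivalence = record
      { refl  = ≈⇒∼ refl
      ; sym   = λ {p} {q} → resp (⁻¹-anti-homo‿- p q) ∘ neg
      ; trans = λ {p} {q} {r} p∼q q∼r → resp (telescope p q r) (add p∼q q∼r)
      }
      where
      telescope : ∀ p q r → (p - q) + (q - r) ≈ p - r
      telescope p q r = begin
        (p - q) + (q - r)      ≈⟨ +-assoc p (- q) (q - r) ⟩
        p + (- q + (q - r))    ≈⟨ +-congˡ (+-assoc (- q) q (- r)) ⟨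
        p + ((- q + q) - r)    ≈⟨ +-congˡ (+-congʳ (-‿inverseˡ q)) ⟩
        p + (0# - r)           ≈⟨ +-congˡ (+-identityˡ (- r)) ⟩
        p - r                  ∎

    module ∼ = IsEquivalence ∼-isEquivalence

    +-cong-∼ : ∀ {p q r s} → p ∼ q → r ∼ s → p + r ∼ q + s
    +-cong-∼ {p} {q} {r} {s} p∼q r∼s = resp (begin
      (p - q) + (r - s)        ≈⟨ interchange p (- q) r (- s) ⟩
      (p + r) + (- q + - s)    ≈⟨ +-congˡ (⁻¹-∙-comm q s) ⟩
      (p + r) - (q + s)        ∎) (add p∼q r∼s)

    -‿cong-∼ : ∀ {p q} → p ∼ q → - p ∼ - q
    -‿cong-∼ {p} {q} p∼q = resp (sym (⁻¹-∙-comm p (- q))) (neg p∼q)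

    *-congˡ-∼ : ∀ {r p q} → p ∼ q → r * p ∼ r * q
    *-congˡ-∼ {r} {p} {q} p∼q = resp (x[y-z]≈xy-xz r p q) (mul r p∼q)

    *-cong-∼ : ∀ {p q r s} → p ∼ q → r ∼ s → p * r ∼ q * s
    *-cong-∼ {p} {q} {r} {s} p∼q r∼s =
      ∼.trans (*-congˡ-∼ r∼s)
      (∼.trans (≈⇒∼ (*-comm p s)) (∼.trans (*-congˡ-∼ p∼q) (≈⇒∼ (*-comm s q))))

  commutativeAlgebra : CommutativeAlgebra K c (c ⊔ ℓ)
  commutativeAlgebra = record
    { commutativeRing = record
      { Carrier = Carrier ; _≈_ = _∼_
      ; _+_ = _+_ ; _*_ = _*_ ; -_ = -_ ; 0# = 0# ; 1# = 1#
      ; isCommutativeRing = record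
        { isRing = record
          { +-isAbelianGroup = record
            { isGroup = record
              { isMonoid = record
                { isSemigroup = record
                  { isMagma = record { isEquivalence = ∼-isEquivalence ; ∙-cong = +-cong-∼ }
                  ; assoc   = λ p q r → ≈⇒∼ (+-assoc p q r)
                  }
                ; identity = ≈⇒∼ ∘ +-identityˡ , ≈⇒∼ ∘ +-identityʳ
                }
              ; inverse = ≈⇒∼ ∘ -‿inverseˡ , ≈⇒∼ ∘ -‿inverseʳ
              ; ⁻¹-cong = -‿cong-∼
              }
            ; comm = λ p q → ≈⇒∼ (+-comm p q)
            }
          ; *-cong     = *-cong-∼
          ; *-assoc    = λ p q r → ≈⇒∼ (*-assoc p q r)
          ; *-identity = ≈⇒∼ ∘ *-identityˡ , ≈⇒∼ ∘ *-identityʳ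
          ; distrib    = (λ p q r → ≈⇒∼ (distribˡ p q r)) , (λ p q r → ≈⇒∼ (distribʳ p q r))
          }
        ; *-comm = λ p q → ≈⇒∼ (*-comm p q)
        }
      }
    ; scalar = scalar
    ; scalar-isRingHomomorphism = record
      { isSemiringHomomorphism = record
        { isNearSemiringHomomorphism = record
          { +-isMonoidHomomorphism = record
            { isMagmaHomomorphism = record
              { isRelHomomorphism = record { cong = ≈⇒∼ ∘ ⟦⟧-cong }
              ; homo = λ x y → ≈⇒∼ (+-homo x y)
              }
            ; ε-homo = ≈⇒∼ 0#-homo
            }
          ; *-homo = λ x y → ≈⇒∼ (*-homo x y)
          }
        ; 1#-homo = ≈⇒∼ 1#-homo
        }
      ; -‿homo = ≈⇒∼ ∘ -‿homo
      }
    }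
    where open IsRingHomomorphism scalar-isRingHomomorphism

infixl 5 _/⟨_⟩

_/⟨_⟩ : {K : CommutativeRing 0ℓ 0ℓ} (A : CommutativeAlgebra K c ℓ) {n : ℕ} →
        Vector (CommutativeAlgebra.Carrier A) n → CommutativeAlgebra K c (c ⊔ ℓ)
A /⟨ g ⟩ = Quotient.commutativeAlgebra A g

module Generated {K : CommutativeRing 0ℓ 0ℓ} (A : CommutativeAlgebra K c ℓ)
                 {I : Set i} (g : I → CommutativeAlgebra.Carrier A) where

  open CommutativeAlgebra A
  open RingProperties ring using (-1*x≈-x)
  private
    module K = CommutativeRing K
    module S = IsRingHomomorphism scalar-isRingHomomorphism

  -- Membership in the smallest unital K-subalgebra containing all g j.
  data InSubalgebra : Pred Carrier (c ⊔ ℓ ⊔ i) where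
    generator : ∀ j → InSubalgebra (g j)
    constant  : ∀ k → InSubalgebra (scalar k)
    sum       : ∀ {p q} → InSubalgebra p → InSubalgebra q → InSubalgebra (p + q)
    product   : ∀ {p q} → InSubalgebra p → InSubalgebra q → InSubalgebra (p * q)
    respects  : ∀ {p q} → p ≈ q → InSubalgebra p → InSubalgebra q

  private
    negate : ∀ {p} → InSubalgebra p → InSubalgebra (- p)
    negate {p} p∈ = respects (trans (*-congʳ minus-one) (-1*x≈-x p)) (product (constant (K.- K.1#)) p∈)
      where
      minus-one : scalar (K.- K.1#) ≈ - 1#
      minus-one = trans (S.-‿homo K.1#) (-‿cong S.1#-homo)

  commutativeAlgebra : CommutativeAlgebra K (c ⊔ ℓ ⊔ i) ℓ
  commutativeAlgebra = record
    { commutativeRing = record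
      { Carrier = ∃ InSubalgebra
      ; _≈_ = λ (p , _) (q , _) → p ≈ q
      ; _+_ = λ (p , p∈) (q , q∈) → p + q , sum p∈ q∈
      ; _*_ = λ (p , p∈) (q , q∈) → p * q , product p∈ q∈
      ; -_  = λ (p , p∈) → - p , negate p∈
      ; 0#  = 0# , respects S.0#-homo (constant K.0#)
      ; 1#  = 1# , respects S.1#-homo (constant K.1#)
      ; isCommutativeRing = record
        { isRing = record
          { +-isAbelianGroup = record
            { isGroup = record
              { isMonoid = record
                { isSemigroup = record
                  { isMagma = record
                    { isEquivalence = record { refl = refl ; sym = sym ; trans = trans }
                    ; ∙-cong = +-cong
                    }
                  ; assoc = λ (p , _) (q , _) (r , _) → +-assoc p q r
                  }
                ; identity = +-identityˡ ∘ proj₁ , +-identityʳ ∘ proj₁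
                }
              ; inverse = -‿inverseˡ ∘ proj₁ , -‿inverseʳ ∘ proj₁
              ; ⁻¹-cong = -‿cong
              }
            ; comm = λ (p , _) (q , _) → +-comm p q
            }
          ; *-cong     = *-cong
          ; *-assoc    = λ (p , _) (q , _) (r , _) → *-assoc p q r
          ; *-identity = *-identityˡ ∘ proj₁ , *-identityʳ ∘ proj₁
          ; distrib    = (λ (p , _) (q , _) (r , _) → distribˡ p q r)
                       , (λ (p , _) (q , _) (r , _) → distribʳ p q r)
          }
        ; *-comm = λ (p , _) (q , _) → *-comm p q
        }
      }
    ; scalar = λ k → scalar k , constant k
    ; scalar-isRingHomomorphism = record
      { isSemiringHomomorphism = record
        { isNearSemiringHomomorphism = record
          { +-isMonoidHomomorphism = record
            { isMagmaHomomorphism = record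
              { isRelHomomorphism = record { cong = S.⟦⟧-cong }
              ; homo = S.+-homo
              }
            ; ε-homo = S.0#-homo
            }
          ; *-homo = S.*-homo
          }
        ; 1#-homo = S.1#-homo
        }
      ; -‿homo = S.-‿homo
      }
    }

-- Given functions ⟦ x ⟧ : T → K indexed by the elements x of a commutative
-- monoid X, the elements of the algebra are formal K-linear combinations
-- of the x, two of them being equal when they define the same function on
-- T.  So the underlying module is the span of the functions ⟦ x ⟧, and the
-- product is the bilinear one with ⟦ x ⟧ · ⟦ y ⟧ = ⟦ x ∙ y ⟧; the hypothesis
-- `shift` says that it is well defined.

module Combinations (K : CommutativeRing 0ℓ 0ℓ) (X : CommutativeMonoid c ℓ) where

  private
    module K = CommutativeRing K
    module X = CommutativeMonoid X
  open RingProperties K.ring using (-‿distribˡ-*)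
  open AbelianGroupProperties K.+-abelianGroup using (⁻¹-∙-comm; ε⁻¹≈ε; x∙y⁻¹≈ε⇒x≈y; x≈y⇒x∙y⁻¹≈ε)
  open CommutativeSemigroupProperties K.+-commutativeSemigroup using (interchange)
  open CommutativeSemigroupProperties K.*-commutativeSemigroup using (x∙yz≈y∙xz)
  open SetoidReasoning K.setoid

  Combination : Set c
  Combination = List (K.Carrier × X.Carrier)

  extend : (X.Carrier → K.Carrier) → Combination → K.Carrier
  extend φ []            = K.0#
  extend φ ((k , x) ∷ p) = k K.* φ x K.+ extend φ p

  negated : Combination → Combination
  negated = List.map (λ (k , x) → K.- k , x)

  translate : K.Carrier → X.Carrier → Combination → Combination
  translate k x = List.map (Product.map (k K.*_) (x X.∙_))

  multiplied : Combination → Combination → Combination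
  multiplied []            q = []
  multiplied ((k , x) ∷ p) q = translate k x q ++ multiplied p q

  extend-cong-All : ∀ {φ ψ} {p : Combination} →
    All (λ (_ , x) → φ x K.≈ ψ x) p → extend φ p K.≈ extend ψ p
  extend-cong-All []         = K.refl
  extend-cong-All (eq ∷ eqs) = K.+-cong (K.*-congˡ eq) (extend-cong-All eqs)

  extend-cong : ∀ {φ ψ} → (∀ x → φ x K.≈ ψ x) → ∀ p → extend φ p K.≈ extend ψ p
  extend-cong eq []            = K.refl
  extend-cong eq ((k , x) ∷ p) = K.+-cong (K.*-congˡ (eq x)) (extend-cong eq p)

  extend-zero : ∀ p → extend (λ _ → K.0#) p K.≈ K.0#
  extend-zero []            = K.refl
  extend-zero ((k , x) ∷ p) = K.trans (K.+-cong (K.zeroʳ k) (extend-zero p)) (K.+-identityʳ K.0#)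

  extend-+ : ∀ φ ψ p → extend (λ x → φ x K.+ ψ x) p K.≈ extend φ p K.+ extend ψ p
  extend-+ φ ψ []            = K.sym (K.+-identityʳ K.0#)
  extend-+ φ ψ ((k , x) ∷ p) = begin
    k K.* (φ x K.+ ψ x) K.+ extend (λ x → φ x K.+ ψ x) p
      ≈⟨ K.+-cong (K.distribˡ k (φ x) (ψ x)) (extend-+ φ ψ p) ⟩
    (k K.* φ x K.+ k K.* ψ x) K.+ (extend φ p K.+ extend ψ p)
      ≈⟨ interchange _ _ _ _ ⟩
    (k K.* φ x K.+ extend φ p) K.+ (k K.* ψ x K.+ extend ψ p) ∎

  extend-* : ∀ φ k p → extend (λ x → k K.* φ x) p K.≈ k K.* extend φ p
  extend-* φ k []            = K.sym (K.zeroʳ k)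
  extend-* φ k ((l , x) ∷ p) = begin
    l K.* (k K.* φ x) K.+ extend (λ x → k K.* φ x) p
      ≈⟨ K.+-cong (x∙yz≈y∙xz l k (φ x)) (extend-* φ k p) ⟩
    k K.* (l K.* φ x) K.+ k K.* extend φ p
      ≈⟨ K.distribˡ k _ _ ⟨
    k K.* (l K.* φ x K.+ extend φ p) ∎

  extend-++ : ∀ φ p q → extend φ (p ++ q) K.≈ extend φ p K.+ extend φ q
  extend-++ φ []            q = K.sym (K.+-identityˡ _)
  extend-++ φ ((k , x) ∷ p) q = K.trans (K.+-congˡ (extend-++ φ p q)) (K.sym (K.+-assoc _ _ _))

  extend-negated : ∀ φ p → extend φ (negated p) K.≈ K.- extend φ p
  extend-negated φ []            = K.sym ε⁻¹≈ε
  extend-negated φ ((k , x) ∷ p) = K.trans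
    (K.+-cong (K.sym (-‿distribˡ-* k (φ x))) (extend-negated φ p))
    (⁻¹-∙-comm _ _)

  extend-translate : ∀ φ k x p →
    extend φ (translate k x p) K.≈ k K.* extend (λ y → φ (x X.∙ y)) p
  extend-translate φ k x []            = K.sym (K.zeroʳ k)
  extend-translate φ k x ((l , y) ∷ p) = begin
    (k K.* l) K.* φ (x X.∙ y) K.+ extend φ (translate k x p)
      ≈⟨ K.+-cong (K.*-assoc k l _) (extend-translate φ k x p) ⟩
    k K.* (l K.* φ (x X.∙ y)) K.+ k K.* extend (λ y → φ (x X.∙ y)) p
      ≈⟨ K.distribˡ k _ _ ⟨
    k K.* extend (λ y → φ (x X.∙ y)) ((l , y) ∷ p) ∎

  extend-multiplied : ∀ φ p q →
    extend φ (multiplied p q) K.≈ extend (λ x → extend (λ y → φ (x X.∙ y)) q) p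
  extend-multiplied φ []            q = K.refl
  extend-multiplied φ ((k , x) ∷ p) q = K.trans
    (extend-++ φ (translate k x q) (multiplied p q))
    (K.+-cong (extend-translate φ k x q) (extend-multiplied φ p q))

  extend-swap : ∀ (φ : X.Carrier → X.Carrier → K.Carrier) p q →
    extend (λ x → extend (λ y → φ x y) q) p K.≈ extend (λ y → extend (λ x → φ x y) p) q
  extend-swap φ []            q = K.sym (extend-zero q)
  extend-swap φ ((k , x) ∷ p) q = begin
    k K.* extend (φ x) q K.+ extend (λ x → extend (φ x) q) p
      ≈⟨ K.+-cong (K.sym (extend-* (φ x) k q)) (extend-swap φ p q) ⟩
    extend (λ y → k K.* φ x y) q K.+ extend (λ y → extend (λ x → φ x y) p) q
      ≈⟨ extend-+ _ _ q ⟨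
    extend (λ y → k K.* φ x y K.+ extend (λ x → φ x y) p) q ∎

  module Span (T : Set) (⟦_⟧ : X.Carrier → T → K.Carrier)
    (⟦⟧-cong : ∀ {x y} → x X.≈ y → ∀ t → ⟦ x ⟧ t K.≈ ⟦ y ⟧ t)
    (shift : ∀ p → (∀ t → extend (λ y → ⟦ y ⟧ t) p K.≈ K.0#) →
             ∀ x t → extend (λ y → ⟦ x X.∙ y ⟧ t) p K.≈ K.0#) where

    evaluate : Combination → T → K.Carrier
    evaluate p t = extend (λ x → ⟦ x ⟧ t) p

    infix 4 _≋_

    record _≋_ (p q : Combination) : Set where
      constructor pointwise
      field at : ∀ t → evaluate p t K.≈ evaluate q t

    open _≋_ public

    [_] : X.Carrier → Combination
    [ x ] = (K.1# , x) ∷ []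

    constant : K.Carrier → Combination
    constant k = (k , X.ε) ∷ []

    private
      multiplied-comm : ∀ p q → multiplied p q ≋ multiplied q p
      multiplied-comm p q = pointwise λ t → begin
        evaluate (multiplied p q) t
          ≈⟨ extend-multiplied _ p q ⟩
        extend (λ x → extend (λ y → ⟦ x X.∙ y ⟧ t) q) p
          ≈⟨ extend-swap _ p q ⟩
        extend (λ y → extend (λ x → ⟦ x X.∙ y ⟧ t) p) q
          ≈⟨ extend-cong (λ y → extend-cong (λ x → ⟦⟧-cong (X.comm x y) t) p) q ⟩
        extend (λ y → extend (λ x → ⟦ y X.∙ x ⟧ t) p) q
          ≈⟨ extend-multiplied _ q p ⟨
        evaluate (multiplied q p) t ∎

      multiplied-assoc : ∀ p q r → multiplied (multiplied p q) r ≋ multiplied p (multiplied q r)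
      multiplied-assoc p q r = pointwise λ t → begin
        evaluate (multiplied (multiplied p q) r) t
          ≈⟨ extend-multiplied _ (multiplied p q) r ⟩
        extend (λ w → extend (λ z → ⟦ w X.∙ z ⟧ t) r) (multiplied p q)
          ≈⟨ extend-multiplied _ p q ⟩
        extend (λ x → extend (λ y → extend (λ z → ⟦ (x X.∙ y) X.∙ z ⟧ t) r) q) p
          ≈⟨ extend-cong (λ x → extend-cong (λ y → extend-cong (λ z → ⟦⟧-cong (X.assoc x y z) t) r) q) p ⟩
        extend (λ x → extend (λ y → extend (λ z → ⟦ x X.∙ (y X.∙ z) ⟧ t) r) q) p
          ≈⟨ extend-cong (λ x → extend-multiplied (λ w → ⟦ x X.∙ w ⟧ t) q r) p ⟨
        extend (λ x → extend (λ w → ⟦ x X.∙ w ⟧ t) (multiplied q r)) p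
          ≈⟨ extend-multiplied _ p (multiplied q r) ⟨
        evaluate (multiplied p (multiplied q r)) t ∎

      multiplied-distribʳ : ∀ p q r → multiplied (q ++ r) p ≋ multiplied q p ++ multiplied r p
      multiplied-distribʳ p q r = pointwise λ t → begin
        evaluate (multiplied (q ++ r) p) t
          ≈⟨ extend-multiplied _ (q ++ r) p ⟩
        extend (λ x → extend (λ y → ⟦ x X.∙ y ⟧ t) p) (q ++ r)
          ≈⟨ extend-++ _ q r ⟩
        extend (λ x → extend (λ y → ⟦ x X.∙ y ⟧ t) p) q K.+ extend (λ x → extend (λ y → ⟦ x X.∙ y ⟧ t) p) r
          ≈⟨ K.+-cong (extend-multiplied _ q p) (extend-multiplied _ r p) ⟨
        evaluate (multiplied q p) t K.+ evaluate (multiplied r p) t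
          ≈⟨ extend-++ _ (multiplied q p) (multiplied r p) ⟨
        evaluate (multiplied q p ++ multiplied r p) t ∎

      multiplied-identityˡ : ∀ p → multiplied (constant K.1#) p ≋ p
      multiplied-identityˡ p = pointwise λ t → begin
        evaluate (multiplied (constant K.1#) p) t
          ≈⟨ extend-multiplied _ (constant K.1#) p ⟩
        K.1# K.* extend (λ y → ⟦ X.ε X.∙ y ⟧ t) p K.+ K.0#
          ≈⟨ K.+-identityʳ _ ⟩
        K.1# K.* extend (λ y → ⟦ X.ε X.∙ y ⟧ t) p
          ≈⟨ K.*-identityˡ _ ⟩
        extend (λ y → ⟦ X.ε X.∙ y ⟧ t) p
          ≈⟨ extend-cong (λ y → ⟦⟧-cong (X.identityˡ y) t) p ⟩
        evaluate p t ∎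

      multiplied-congˡ : ∀ p {q r} → q ≋ r → multiplied p q ≋ multiplied p r
      multiplied-congˡ p {q} {r} q≋r = pointwise λ t → begin
        evaluate (multiplied p q) t
          ≈⟨ extend-multiplied _ p q ⟩
        extend (λ x → extend (λ y → ⟦ x X.∙ y ⟧ t) q) p
          ≈⟨ extend-cong shifted p ⟩
        extend (λ x → extend (λ y → ⟦ x X.∙ y ⟧ t) r) p
          ≈⟨ extend-multiplied _ p r ⟨
        evaluate (multiplied p r) t ∎
        where
        subtract : ∀ φ → extend φ (q ++ negated r) K.≈ extend φ q K.- extend φ r
        subtract φ = K.trans (extend-++ φ q (negated r)) (K.+-congˡ (extend-negated φ r))

        shifted : ∀ {t} x → extend (λ y → ⟦ x X.∙ y ⟧ t) q K.≈ extend (λ y → ⟦ x X.∙ y ⟧ t) r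
        shifted {t} x = x∙y⁻¹≈ε⇒x≈y _ _ (K.trans (K.sym (subtract _))
          (shift (q ++ negated r) (λ s → K.trans (subtract _) (x≈y⇒x∙y⁻¹≈ε (at q≋r s))) x t))

    algebra : CommutativeAlgebra K c 0ℓ
    algebra = record
      { commutativeRing = record
        { Carrier = Combination
        ; _≈_ = _≋_
        ; _+_ = _++_
        ; _*_ = multiplied
        ; -_  = negated
        ; 0#  = []
        ; 1#  = [ X.ε ]
        ; isCommutativeRing = record
          { isRing = record
            { +-isAbelianGroup = record
              { isGroup = record
                { isMonoid = record
                  { isSemigroup = record
                    { isMagma = record
                      { isEquivalence = ≋-isEquivalence
                      ; ∙-cong = ++-cong
                      }
                    ; assoc = λ p q r → ≋-reflexive (++-assoc p q r)
                    }
                  ; identity = (λ _ → ≋.refl) , λ p → ≋-reflexive (++-identityʳ p)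
                  }
                ; inverse = (λ p → pointwise λ t → K.trans (extend-++ _ (negated p) p)
                                       (K.trans (K.+-congʳ (extend-negated _ p)) (K.-‿inverseˡ _)))
                          , (λ p → pointwise λ t → K.trans (extend-++ _ p (negated p))
                                       (K.trans (K.+-congˡ (extend-negated _ p)) (K.-‿inverseʳ _)))
                ; ⁻¹-cong = λ {p} {q} p≋q → pointwise λ t → K.trans (extend-negated _ p)
                              (K.trans (K.-‿cong (at p≋q t)) (K.sym (extend-negated _ q)))
                }
              ; comm = λ p q → pointwise λ t → sums p q q p (K.+-comm _ _)
              }
            ; *-cong     = multiplied-cong
            ; *-assoc    = multiplied-assoc
            ; *-identity = multiplied-identityˡ
                         , λ p → ≋.trans (multiplied-comm p (constant K.1#)) (multiplied-identityˡ p)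
            ; distrib    = multiplied-distribˡ , multiplied-distribʳ
            }
          ; *-comm = multiplied-comm
          }
        }
      ; scalar = constant
      ; scalar-isRingHomomorphism = record
        { isSemiringHomomorphism = record
          { isNearSemiringHomomorphism = record
            { +-isMonoidHomomorphism = record
              { isMagmaHomomorphism = record
                { isRelHomomorphism = record { cong = λ k≈l → pointwise λ t → K.+-congʳ (K.*-congʳ k≈l) }
                ; homo = λ k l → pointwise λ t → K.trans (K.+-congʳ (K.distribʳ _ k l)) (K.+-assoc _ _ _)
                }
              ; ε-homo = pointwise λ t → K.trans (K.+-identityʳ _) (K.zeroˡ _)
              }
            ; *-homo = λ k l → pointwise λ t → K.+-congʳ (K.*-congˡ (⟦⟧-cong (X.sym (X.identityˡ X.ε)) t))
            }
          ; 1#-homo = pointwise λ t → K.refl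
          }
        ; -‿homo = λ k → pointwise λ t → K.refl
        }
      }
      where
      ≋-isEquivalence : IsEquivalence _≋_
      ≋-isEquivalence = record
        { refl  = pointwise λ t → K.refl
        ; sym   = λ p≋q → pointwise λ t → K.sym (at p≋q t)
        ; trans = λ p≋q q≋r → pointwise λ t → K.trans (at p≋q t) (at q≋r t)
        }
      module ≋ = IsEquivalence ≋-isEquivalence

      ≋-reflexive : ∀ {p q} → p ≡ q → p ≋ q
      ≋-reflexive ≡.refl = ≋.refl

      sums : ∀ p q r s {t} → evaluate p t K.+ evaluate q t K.≈ evaluate r t K.+ evaluate s t →
             evaluate (p ++ q) t K.≈ evaluate (r ++ s) t
      sums p q r s eq = K.trans (extend-++ _ p q) (K.trans eq (K.sym (extend-++ _ r s)))

      ++-cong : ∀ {p q r s} → p ≋ q → r ≋ s → p ++ r ≋ q ++ s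
      ++-cong {p} {q} {r} {s} p≋q r≋s = pointwise λ t → sums p r q s (K.+-cong (at p≋q t) (at r≋s t))

      multiplied-cong : ∀ {p q r s} → p ≋ q → r ≋ s → multiplied p r ≋ multiplied q s
      multiplied-cong {p} {q} {r} {s} p≋q r≋s = ≋.trans (multiplied-congˡ p r≋s)
        (≋.trans (multiplied-comm p s) (≋.trans (multiplied-congˡ s p≋q) (multiplied-comm s q)))

      multiplied-distribˡ : ∀ p q r → multiplied p (q ++ r) ≋ multiplied p q ++ multiplied p r
      multiplied-distribˡ p q r = ≋.trans (multiplied-comm p (q ++ r)) (≋.trans
        (multiplied-distribʳ p q r) (++-cong (multiplied-comm q p) (multiplied-comm r p)))
module Indicator (K : CommutativeRing 0ℓ 0ℓ) where

  open CommutativeRing K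

  𝟙 : {P : Set a} → Dec P → Carrier
  𝟙 (yes _) = 1#
  𝟙 (no  _) = 0#

  𝟙-cong : {P : Set c} {Q : Set ℓ} → P ⇔ Q → (P? : Dec P) (Q? : Dec Q) → 𝟙 P? ≈ 𝟙 Q?
  𝟙-cong P⇔Q (yes _) (yes _) = refl
  𝟙-cong P⇔Q (yes p) (no ¬q) = contradiction (Equivalence.to P⇔Q p) ¬q
  𝟙-cong P⇔Q (no ¬p) (yes q) = contradiction (Equivalence.from P⇔Q q) ¬p
  𝟙-cong P⇔Q (no _)  (no _)  = refl

  𝟙-true : {P : Set c} → P → (P? : Dec P) → 𝟙 P? ≈ 1#
  𝟙-true p (yes _) = refl
  𝟙-true p (no ¬p) = contradiction p ¬p

  𝟙-false : {P : Set c} → ¬ P → (P? : Dec P) → 𝟙 P? ≈ 0#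
  𝟙-false ¬p (yes p) = contradiction p ¬p
  𝟙-false ¬p (no _)  = refl

-- K[x₁,…,xₙ]: the monoid is that of the exponent vectors in ℕⁿ, and the
-- function attached to a monomial is its coefficient vector, so that two
-- polynomials are equal when all of their coefficients are.

module Polynomials (K : CommutativeRing 0ℓ 0ℓ) (n : ℕ) where

  open Indicator K
  private module K = CommutativeRing K

  _⊞_ : Vec ℕ n → Vec ℕ n → Vec ℕ n
  _⊞_ = zipWith ℕ._+_

  monomials : CommutativeMonoid 0ℓ 0ℓ
  monomials = record
    { Carrier = Vec ℕ n
    ; _≈_ = _≡_
    ; _∙_ = _⊞_
    ; ε   = replicate n 0
    ; isCommutativeMonoid = record
      { isMonoid = record
        { isSemigroup = record
          { isMagma = record { isEquivalence = isEquivalence ; ∙-cong = ≡.cong₂ _⊞_ }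
          ; assoc   = Vec.zipWith-assoc ℕ.+-assoc
          }
        ; identity = Vec.zipWith-identityˡ ℕ.+-identityˡ , Vec.zipWith-identityʳ ℕ.+-identityʳ
        }
      ; comm = Vec.zipWith-comm ℕ.+-comm
      }
    }

  infix 4 _≟_

  _≟_ : (m m′ : Vec ℕ n) → Dec (m ≡ m′)
  _≟_ = Vec.≡-dec ℕ._≟_

  open Combinations K monomials public

  monomial-coefficient : Vec ℕ n → Vec ℕ n → K.Carrier
  monomial-coefficient m t = 𝟙 (m ≟ t)

  private
    monomial-coefficient-cong : ∀ {m m′} → m ≡ m′ → ∀ t →
      monomial-coefficient m t K.≈ monomial-coefficient m′ t
    monomial-coefficient-cong ≡.refl _ = K.refl

    cancel : ∀ {k} (m s t : Vec ℕ k) → zipWith ℕ._+_ m s ≡ zipWith ℕ._+_ m t → s ≡ t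
    cancel []      []      []      _  = ≡.refl
    cancel (i ∷ m) (j ∷ s) (k ∷ t) eq = ≡.cong₂ _∷_
      (ℕ.+-cancelˡ-≡ i j k (Vec.∷-injectiveˡ eq)) (cancel m s t (Vec.∷-injectiveʳ eq))

    divide : ∀ {k} (m t : Vec ℕ k) → Dec (∃[ s ] zipWith ℕ._+_ m s ≡ t)
    divide []      []      = yes ([] , ≡.refl)
    divide (i ∷ m) (k ∷ t) with i ℕ.≤? k | divide m t
    ... | no  i≰k | _            = no λ { (j ∷ s , eq) → i≰k (ℕ.m+n≤o⇒m≤o i (ℕ.≤-reflexive (Vec.∷-injectiveˡ eq))) }
    ... | yes _   | no  ¬s       = no λ { (j ∷ s , eq) → ¬s (s , Vec.∷-injectiveʳ eq) }
    ... | yes i≤k | yes (s , eq) = yes (k ℕ.∸ i ∷ s , ≡.cong₂ _∷_ (ℕ.m+[n∸m]≡n i≤k) eq)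

    shift : ∀ p → (∀ t → extend (λ m → 𝟙 (m ≟ t)) p K.≈ K.0#) →
            ∀ m t → extend (λ s → 𝟙 (m ⊞ s ≟ t)) p K.≈ K.0#
    shift p vanishes m t with divide m t
    ... | yes (s , ≡.refl) = K.trans
      (extend-cong (λ s′ → 𝟙-cong (mk⇔ (cancel m s′ s) (≡.cong (m ⊞_))) (m ⊞ s′ ≟ m ⊞ s) (s′ ≟ s)) p)
      (vanishes s)
    ... | no ¬s = K.trans
      (extend-cong (λ s′ → 𝟙-false (λ eq → ¬s (s′ , eq)) (m ⊞ s′ ≟ t)) p)
      (extend-zero p)

  open Span (Vec ℕ n) monomial-coefficient monomial-coefficient-cong shift public
    renaming (evaluate to coefficients)

  var : Fin n → Combination
  var i = [ replicate n 0 [ i ]≔ 1 ]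

-- The axioms characterising the real numbers up to isomorphism.  Classical
-- logic enters only through the decidability of the order and the supremum
-- axiom.

record CompleteOrderedField : Set₁ where
  field
    commutativeRing : CommutativeRing 0ℓ 0ℓ

  open CommutativeRing commutativeRing public

  infix 4 _≤_

  field
    _≤_             : Rel Carrier 0ℓ
    isDecTotalOrder : IsDecTotalOrder _≈_ _≤_
    +-monoˡ-≤       : ∀ z {x y} → x ≤ y → x + z ≤ y + z
    *-nonNegative   : ∀ {x y} → 0# ≤ x → 0# ≤ y → 0# ≤ x * y
    0≉1             : 0# ≉ 1#
    inverse         : ∀ {x} → x ≉ 0# → ∃[ y ] x * y ≈ 1#

  UpperBound : Pred Carrier 0ℓ → Pred Carrier 0ℓ
  UpperBound S b = ∀ x → S x → x ≤ b

  field
    supremum : ∀ S → ∃ S → ∃ (UpperBound S) →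
               ∃[ s ] UpperBound S s × (∀ b → UpperBound S b → s ≤ b)

  decTotalOrder : DecTotalOrder 0ℓ 0ℓ 0ℓ
  decTotalOrder = record { isDecTotalOrder = isDecTotalOrder }

  open DecTotalOrder decTotalOrder public
    using (_≟_; _≤?_; total; antisym; totalOrder; ≤-respˡ-≈; ≤-respʳ-≈)
    renaming (refl to ≤-refl; reflexive to ≤-reflexive; trans to ≤-trans)
  open DecTotalOrderProperties decTotalOrder public
    using (_<_; ≰⇒>)

module Reals (ℝ : CompleteOrderedField) where

  open CompleteOrderedField ℝ
  open SemiringSolver commutativeSemiring using (solve; _:+_; _:*_; con; _:=_)
  open Mult semiring public using () renaming (_×_ to _·_)
  open RingProperties ring using (-1*x≈-x)
  open AbelianGroupProperties +-abelianGroup using (⁻¹-involutive; //-rightDividesˡ; //-rightDividesʳ)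

  +-monoʳ-≤ : ∀ z {x y} → x ≤ y → z + x ≤ z + y
  +-monoʳ-≤ z x≤y = ≤-respˡ-≈ (+-comm _ z) (≤-respʳ-≈ (+-comm _ z) (+-monoˡ-≤ z x≤y))

  +-mono-≤ : ∀ {x y z w} → x ≤ y → z ≤ w → x + z ≤ y + w
  +-mono-≤ x≤y z≤w = ≤-trans (+-monoˡ-≤ _ x≤y) (+-monoʳ-≤ _ z≤w)

  0≤1 : 0# ≤ 1#
  0≤1 with total 0# 1#
  ... | inj₁ 0≤1 = 0≤1
  ... | inj₂ 1≤0 = ≤-respʳ-≈ (trans (-1*x≈-x (- 1#)) (⁻¹-involutive 1#)) (*-nonNegative 0≤-1 0≤-1)
    where
    0≤-1 : 0# ≤ - 1#
    0≤-1 = ≤-respˡ-≈ (-‿inverseʳ 1#) (≤-respʳ-≈ (+-identityˡ _) (+-monoˡ-≤ (- 1#) 1≤0))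

  0≤n·1 : ∀ n → 0# ≤ n · 1#
  0≤n·1 zero    = ≤-refl
  0≤n·1 (suc n) = ≤-respˡ-≈ (+-identityʳ 0#) (+-mono-≤ 0≤1 (0≤n·1 n))

  [1+n]·1≉0 : ∀ n → suc n · 1# ≉ 0#
  [1+n]·1≉0 n eq = 0≉1 (antisym 0≤1 (≤-respˡ-≈ (+-identityʳ 1#)
    (≤-respʳ-≈ eq (+-monoʳ-≤ 1# (0≤n·1 n)))))

  [x-y]+y≈x : ∀ x y → (x - y) + y ≈ x
  [x-y]+y≈x x y = //-rightDividesˡ y x

  x+[y-x]≈y : ∀ x y → x + (y - x) ≈ y
  x+[y-x]≈y x y = trans (+-comm x (y - x)) ([x-y]+y≈x y x)

  +-cancelʳ-≤ : ∀ z {x y} → x + z ≤ y + z → x ≤ y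
  +-cancelʳ-≤ z x+z≤y+z = ≤-respˡ-≈ (//-rightDividesʳ z _)
    (≤-respʳ-≈ (//-rightDividesʳ z _) (+-monoˡ-≤ (- z) x+z≤y+z))

  +-cancelˡ-≤ : ∀ z {x y} → z + x ≤ z + y → x ≤ y
  +-cancelˡ-≤ z z+x≤z+y = +-cancelʳ-≤ z (≤-respˡ-≈ (+-comm z _) (≤-respʳ-≈ (+-comm z _) z+x≤z+y))

  midpoint : ∀ s t → ∃[ m ] m + m ≈ s + t
  midpoint s t = (s + t) * ½ , trans (sym (distribˡ (s + t) ½ ½)) (trans
    (*-congˡ (trans (sym two*½) (proj₂ (inverse ([1+n]·1≉0 1))))) (*-identityʳ (s + t)))
    where
    ½ : Carrier
    ½ = proj₁ (inverse ([1+n]·1≉0 1))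
    two*½ : (2 · 1#) * ½ ≈ ½ + ½
    two*½ = solve 1 (λ x → (con 1 :+ (con 1 :+ con 0)) :* x := x :+ x) refl ½

  between : ∀ {s t} → ¬ t ≤ s → ∃[ m ] (¬ m ≤ s) × (¬ t ≤ m)
  between {s} {t} t≰s with midpoint s t
  ... | m , m+m≈s+t = m ,
    (λ m≤s → t≰s (+-cancelˡ-≤ s (≤-respˡ-≈ m+m≈s+t (+-mono-≤ m≤s m≤s)))) ,
    (λ t≤m → t≰s (+-cancelʳ-≤ t (≤-respʳ-≈ m+m≈s+t (+-mono-≤ t≤m t≤m))))

  infix 8 _/_[_]

  _/_[_] : ∀ x y → y ≉ 0# → Carrier
  x / y [ y≉0 ] = x * proj₁ (inverse y≉0)

  fromℤ : ℤ → Carrier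
  fromℤ (ℤ.+ n)  = n · 1#
  fromℤ -[1+ n ] = - (suc n · 1#)

  fromℚ : ℚ → Carrier
  fromℚ q = fromℤ (↥ q) / ↧ₙ q · 1# [ [1+n]·1≉0 (ℚ.denominator-1 q) ]

  ℂ : CommutativeRing 0ℓ 0ℓ
  ℂ = record
    { Carrier = Carrier × Carrier
    ; _≈_ = λ (a , b) (c , d) → a ≈ c × b ≈ d
    ; _+_ = λ (a , b) (c , d) → a + c , b + d
    ; _*_ = λ (a , b) (c , d) → a * c - b * d , a * d + b * c
    ; -_  = λ (a , b) → - a , - b
    ; 0#  = 0# , 0#
    ; 1#  = 1# , 0#
    ; isCommutativeRing = record
      { isRing = record
        { +-isAbelianGroup = record
          { isGroup = record
            { isMonoid = record
              { isSemigroup = record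
                { isMagma = record
                  { isEquivalence = record
                    { refl  = refl , refl
                    ; sym   = λ (p , q) → sym p , sym q
                    ; trans = λ (p , q) (r , s) → trans p r , trans q s
                    }
                  ; ∙-cong = λ (p , q) (r , s) → +-cong p r , +-cong q s
                  }
                ; assoc = λ (a , b) (c , d) (e , f) → +-assoc a c e , +-assoc b d f
                }
              ; identity = (λ (a , b) → +-identityˡ a , +-identityˡ b)
                         , (λ (a , b) → +-identityʳ a , +-identityʳ b)
              }
            ; inverse = (λ (a , b) → -‿inverseˡ a , -‿inverseˡ b)
                      , (λ (a , b) → -‿inverseʳ a , -‿inverseʳ b)
            ; ⁻¹-cong = λ (p , q) → -‿cong p , -‿cong q
            }
          ; comm = λ (a , b) (c , d) → +-comm a c , +-comm b d
          }
        ; *-cong = λ (p , q) (r , s) →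
            +-cong (*-cong p r) (-‿cong (*-cong q s)) , +-cong (*-cong p s) (*-cong q r)
        ; *-assoc    = *-associates
        ; *-identity = identityˡ′ , λ z → ≈-trans (*-commutes z (1# , 0#)) (identityˡ′ z)
        ; distrib    = distribˡ′ , λ z u v → ≈-trans (*-commutes (_ , _) z)
            (≈-trans (distribˡ′ z u v) (+-congruent (*-commutes z u) (*-commutes z v)))
        }
      ; *-comm = *-commutes
      }
    }
    where
    infix 4 _≈²_

    _≈²_ : Rel (Carrier × Carrier) 0ℓ
    (a , b) ≈² (c , d) = a ≈ c × b ≈ d

    _⊡_ : Carrier × Carrier → Carrier × Carrier → Carrier × Carrier
    (a , b) ⊡ (c , d) = a * c - b * d , a * d + b * c

    _⊞_ : Carrier × Carrier → Carrier × Carrier → Carrier × Carrier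
    (a , b) ⊞ (c , d) = a + c , b + d

    ≈-trans : ∀ {u v w} → u ≈² v → v ≈² w → u ≈² w
    ≈-trans (p , q) (r , s) = trans p r , trans q s

    +-congruent : ∀ {u v w z} → u ≈² v → w ≈² z → u ⊞ w ≈² v ⊞ z
    +-congruent (p , q) (r , s) = +-cong p r , +-cong q s

    *-commutes : ∀ u v → u ⊡ v ≈² v ⊡ u
    *-commutes (a , b) (c , d) =
      +-cong (*-comm a c) (-‿cong (*-comm b d)) ,
      trans (+-comm _ _) (+-cong (*-comm b c) (*-comm a d))

    -- Reduces ring identities to semiring identities in the extra variable ν = - 1#.
    ν : Carrier
    ν = - 1#

    minus : ∀ x y → x - y ≈ x + ν * y
    minus x y = +-congˡ (sym (-1*x≈-x y))

    identityˡ′ : ∀ u → (1# , 0#) ⊡ u ≈² u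
    identityˡ′ (a , b) =
      trans (minus _ _) (solve 3 (λ a b ν → con 1 :* a :+ ν :* (con 0 :* b) := a) refl a b ν) ,
      solve 2 (λ a b → con 1 :* b :+ con 0 :* a := b) refl a b

    distribˡ′ : ∀ u v w → u ⊡ (v ⊞ w) ≈² (u ⊡ v) ⊞ (u ⊡ w)
    distribˡ′ (a , b) (c , d) (e , f) =
      trans (minus _ _) (trans
        (solve 7 (λ a b c d e f ν →
          a :* (c :+ e) :+ ν :* (b :* (d :+ f)) :=
          (a :* c :+ ν :* (b :* d)) :+ (a :* e :+ ν :* (b :* f))) refl a b c d e f ν)
        (sym (+-cong (minus _ _) (minus _ _)))) ,
      solve 6 (λ a b c d e f →
        a :* (d :+ f) :+ b :* (c :+ e) :=
        (a :* d :+ b :* c) :+ (a :* f :+ b :* e)) refl a b c d e f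

    *-associates : ∀ u v w → (u ⊡ v) ⊡ w ≈² u ⊡ (v ⊡ w)
    *-associates (a , b) (c , d) (e , f) =
      trans (trans (minus _ _) (+-congʳ (*-congʳ (minus _ _)))) (trans
        (solve 7 (λ a b c d e f ν →
          (a :* c :+ ν :* (b :* d)) :* e :+ ν :* ((a :* d :+ b :* c) :* f) :=
          a :* (c :* e :+ ν :* (d :* f)) :+ ν :* (b :* (c :* f :+ d :* e))) refl a b c d e f ν)
        (sym (trans (minus _ _) (+-congʳ (*-congˡ (minus _ _)))))) ,
      trans (+-congʳ (*-congʳ (minus _ _))) (trans
        (solve 7 (λ a b c d e f ν →
          (a :* c :+ ν :* (b :* d)) :* f :+ (a :* d :+ b :* c) :* e :=
          a :* (c :* f :+ d :* e) :+ b :* (c :* e :+ ν :* (d :* f))) refl a b c d e f ν)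
        (sym (+-congˡ (*-congˡ (minus _ _)))))

module Polyhedra (ℝ : CompleteOrderedField) where

  open CompleteOrderedField ℝ
  open Reals ℝ
  open NaturalMax totalOrder using (⊔-lub; x⊔y≤z⇒x≤z; x⊔y≤z⇒y≤z) renaming (_⊔_ to _∨_)
  open NaturalMin totalOrder using (⊓-glb; x≤y⊓z⇒x≤y; x≤y⊓z⇒x≤z) renaming (_⊓_ to _∧_)
  open Extrema totalOrder using (max; argmax-sel; ⊥≤max; xs≤max)

  data HalfSpace : Set where
    [_,∞⟩  : Carrier → HalfSpace
    ⟨-∞,_] : Carrier → HalfSpace

  infix 4 _∈ʰ_ _∈ʰ?_

  _∈ʰ_ : Carrier → HalfSpace → Set
  x ∈ʰ [ a ,∞⟩  = a ≤ x
  x ∈ʰ ⟨-∞, b ] = x ≤ b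

  _∈ʰ?_ : ∀ x h → Dec (x ∈ʰ h)
  x ∈ʰ? [ a ,∞⟩  = a ≤? x
  x ∈ʰ? ⟨-∞, b ] = x ≤? b

  -- A nonempty finite intersection of closed half-spaces of ℝ, the latter being
  -- the closed rays.  The empty polyhedron has indicator function 0, so leaving
  -- it out does not change the span of the indicator functions.
  record Polyhedron : Set₁ where
    field
      points     : Pred Carrier 0ℓ
      halfSpaces : List HalfSpace
      points⇔    : ∀ x → points x ⇔ All (x ∈ʰ_) halfSpaces
      nonempty   : ∃ points

    _∋?_ : ∀ x → Dec (points x)
    _∋?_ x = map′ (Equivalence.from (points⇔ x)) (Equivalence.to (points⇔ x)) (All.all? (x ∈ʰ?_) halfSpaces)

  lower upper : List HalfSpace → Maybe Carrier
  lower []                = nothing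
  lower ([ a ,∞⟩  ∷ hs)   = just (Maybe.maybe (a ∨_) a (lower hs))
  lower (⟨-∞, b ] ∷ hs)   = lower hs
  upper []                = nothing
  upper ([ a ,∞⟩  ∷ hs)   = upper hs
  upper (⟨-∞, b ] ∷ hs)   = just (Maybe.maybe (b ∧_) b (upper hs))

  infix 4 _≥ˡ_ _≤ᵘ_ _≥ˡ?_ _≤ᵘ?_

  _≥ˡ_ _≤ᵘ_ : Carrier → Maybe Carrier → Set
  x ≥ˡ l = MaybeAll.All (_≤ x) l
  x ≤ᵘ u = MaybeAll.All (x ≤_) u

  _≥ˡ?_ : ∀ x l → Dec (x ≥ˡ l)
  x ≥ˡ? l = MaybeAll.dec (_≤? x) l

  _≤ᵘ?_ : ∀ x u → Dec (x ≤ᵘ u)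
  x ≤ᵘ? u = MaybeAll.dec (x ≤?_) u

  private
    ⊔-split : ∀ {x} a l → x ≥ˡ just (Maybe.maybe (a ∨_) a l) → a ≤ x × x ≥ˡ l
    ⊔-split a nothing   (just p) = p , nothing
    ⊔-split a (just a′) (just p) = x⊔y≤z⇒x≤z a a′ p , just (x⊔y≤z⇒y≤z a a′ p)

    ⊔-join : ∀ {x} a {l} → a ≤ x → x ≥ˡ l → x ≥ˡ just (Maybe.maybe (a ∨_) a l)
    ⊔-join a p nothing  = just p
    ⊔-join a p (just q) = just (⊔-lub p q)

    ⊓-split : ∀ {x} b u → x ≤ᵘ just (Maybe.maybe (b ∧_) b u) → x ≤ b × x ≤ᵘ u
    ⊓-split b nothing   (just p) = p , nothing
    ⊓-split b (just b′) (just p) = x≤y⊓z⇒x≤y b b′ p , just (x≤y⊓z⇒x≤z b b′ p)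

    ⊓-join : ∀ {x} b {u} → x ≤ b → x ≤ᵘ u → x ≤ᵘ just (Maybe.maybe (b ∧_) b u)
    ⊓-join b p nothing  = just p
    ⊓-join b p (just q) = just (⊓-glb p q)

    bounds⇒ : ∀ {x} hs → All (x ∈ʰ_) hs → x ≥ˡ lower hs × x ≤ᵘ upper hs
    bounds⇒ []               []       = nothing , nothing
    bounds⇒ ([ a ,∞⟩  ∷ hs) (p ∷ ps) = Product.map₁ (⊔-join a p) (bounds⇒ hs ps)
    bounds⇒ (⟨-∞, b ] ∷ hs) (p ∷ ps) = Product.map₂ (⊓-join b p) (bounds⇒ hs ps)

    bounds⇐ : ∀ {x} hs → x ≥ˡ lower hs → x ≤ᵘ upper hs → All (x ∈ʰ_) hs
    bounds⇐ []               _ _ = []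
    bounds⇐ ([ a ,∞⟩  ∷ hs) l u = let p , l′ = ⊔-split a (lower hs) l in p ∷ bounds⇐ hs l′ u
    bounds⇐ (⟨-∞, b ] ∷ hs) l u = let p , u′ = ⊓-split b (upper hs) u in p ∷ bounds⇐ hs l u′

    fromBounds : Maybe Carrier → Maybe Carrier → List HalfSpace
    fromBounds l u = List.map [_,∞⟩ (List.fromMaybe l) ++ List.map ⟨-∞,_] (List.fromMaybe u)

    fromBounds⇒ : ∀ {x} l u → All (x ∈ʰ_) (fromBounds l u) → x ≥ˡ l × x ≤ᵘ u
    fromBounds⇒ nothing  nothing  []           = nothing , nothing
    fromBounds⇒ nothing  (just b) (q ∷ [])     = nothing , just q
    fromBounds⇒ (just a) nothing  (p ∷ [])     = just p , nothing
    fromBounds⇒ (just a) (just b) (p ∷ q ∷ []) = just p , just q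

    fromBounds⇐ : ∀ {x l u} → x ≥ˡ l × x ≤ᵘ u → All (x ∈ʰ_) (fromBounds l u)
    fromBounds⇐ (nothing , nothing) = []
    fromBounds⇐ (nothing , just q)  = q ∷ []
    fromBounds⇐ (just p  , nothing) = p ∷ []
    fromBounds⇐ (just p  , just q)  = p ∷ q ∷ []

  module Bounds (P : Polyhedron) where

    open Polyhedron P public

    lo hi : Maybe Carrier
    lo = lower halfSpaces
    hi = upper halfSpaces

    ≥lo : ∀ {x} → points x → x ≥ˡ lo
    ≥lo {x} x∈P = proj₁ (bounds⇒ halfSpaces (Equivalence.to (points⇔ x) x∈P))

    ≤hi : ∀ {x} → points x → x ≤ᵘ hi
    ≤hi {x} x∈P = proj₂ (bounds⇒ halfSpaces (Equivalence.to (points⇔ x) x∈P))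

    within : ∀ {x} → x ≥ˡ lo → x ≤ᵘ hi → points x
    within {x} l u = Equivalence.from (points⇔ x) (bounds⇐ halfSpaces l u)

    resp : ∀ {x y} → x ≈ y → points x → points y
    resp x≈y x∈P = within (MaybeAll.map (≤-respʳ-≈ x≈y) (≥lo x∈P)) (MaybeAll.map (≤-respˡ-≈ x≈y) (≤hi x∈P))

    raise : ∀ {x y} → points x → x ≤ y → y ≤ᵘ hi → points y
    raise x∈P x≤y = within (MaybeAll.map (λ a≤x → ≤-trans a≤x x≤y) (≥lo x∈P))

    lowers : ∀ {x y} → points x → y ≤ x → y ≥ˡ lo → points y
    lowers x∈P y≤x y≥lo = within y≥lo (MaybeAll.map (≤-trans y≤x) (≤hi x∈P))

    lo≤hi : ∀ {t} → ¬ (t ≤ᵘ hi) → t ≥ˡ lo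
    lo≤hi {t} t≰hi with t ≥ˡ? lo
    ... | yes t≥lo = t≥lo
    ... | no  t≱lo = ⊥-elim (t≰hi (MaybeAll.map (≤-trans t≤x) (≤hi (proj₂ nonempty))))
      where
      above : ∀ {x l} → x ≥ˡ l → ¬ (t ≥ˡ l) → t ≤ x
      above nothing    t≱l = ⊥-elim (t≱l nothing)
      above (just a≤x) t≱l = ≤-trans (proj₁ (≰⇒> (t≱l ∘ just))) a≤x
      t≤x : t ≤ proj₁ nonempty
      t≤x = above (≥lo (proj₂ nonempty)) t≱lo

  infixl 6 _+̂_

  _+̂_ : Maybe Carrier → Maybe Carrier → Maybe Carrier
  _+̂_ = Maybe.zipWith _+_

  module _ (A B : Polyhedron) where

    private
      module A = Bounds A
      module B = Bounds B

    MinkowskiSum : Pred Carrier 0ℓ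
    MinkowskiSum x = ∃₂ λ a b → A.points a × B.points b × x ≈ a + b

    sum⇒bounds : ∀ {x} → MinkowskiSum x → x ≥ˡ A.lo +̂ B.lo × x ≤ᵘ A.hi +̂ B.hi
    sum⇒bounds {x} (a , b , a∈A , b∈B , x≈a+b) =
      bound-lo (A.≥lo a∈A) (B.≥lo b∈B) , bound-hi (A.≤hi a∈A) (B.≤hi b∈B)
      where
      bound-lo : ∀ {l m} → a ≥ˡ l → b ≥ˡ m → x ≥ˡ l +̂ m
      bound-lo nothing  _              = nothing
      bound-lo (just _) nothing  = nothing
      bound-lo (just p) (just q) = just (≤-respʳ-≈ (sym x≈a+b) (+-mono-≤ p q))
      bound-hi : ∀ {l m} → a ≤ᵘ l → b ≤ᵘ m → x ≤ᵘ l +̂ m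
      bound-hi nothing  _              = nothing
      bound-hi (just _) nothing  = nothing
      bound-hi (just p) (just q) = just (≤-respˡ-≈ (sym x≈a+b) (+-mono-≤ p q))

    bounds⇒sum : ∀ {x} → x ≥ˡ A.lo +̂ B.lo → x ≤ᵘ A.hi +̂ B.hi → MinkowskiSum x
    bounds⇒sum {x} x≥ x≤ = go (total (a₀ + b₀) x)
      where
      a₀ b₀ : Carrier
      a₀ = proj₁ A.nonempty
      b₀ = proj₁ B.nonempty
      a₀∈A : A.points a₀
      a₀∈A = proj₂ A.nonempty
      b₀∈B : B.points b₀
      b₀∈B = proj₂ B.nonempty

      move-a : A.points (x - b₀) → MinkowskiSum x
      move-a a∈A = x - b₀ , b₀ , a∈A , b₀∈B , sym ([x-y]+y≈x x b₀)

      move-b : ∀ {a} → A.points a → B.points (x - a) → MinkowskiSum x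
      move-b {a} a∈A b∈B = a , x - a , a∈A , b∈B , sym (x+[y-x]≈y a x)

      right : ∀ {y} b → x ≤ y + b → x - b ≤ y
      right b x≤y+b = +-cancelʳ-≤ b (≤-respˡ-≈ (sym ([x-y]+y≈x x b)) x≤y+b)

      left : ∀ {y} b → y + b ≤ x → y ≤ x - b
      left b y+b≤x = +-cancelʳ-≤ b (≤-respʳ-≈ (sym ([x-y]+y≈x x b)) y+b≤x)

      up : a₀ + b₀ ≤ x → ∀ u → A.hi ≡ u → MinkowskiSum x
      up a₀+b₀≤x nothing  eq = move-a (A.raise a₀∈A (left b₀ a₀+b₀≤x)
        (≡.subst (x - b₀ ≤ᵘ_) (≡.sym eq) nothing))
      up a₀+b₀≤x (just u) eq with total x (u + b₀)
      ... | inj₁ x≤u+b₀ = move-a (A.raise a₀∈A (left b₀ a₀+b₀≤x)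
        (≡.subst (x - b₀ ≤ᵘ_) (≡.sym eq) (just (right b₀ x≤u+b₀))))
      ... | inj₂ u+b₀≤x = move-b
        (A.raise a₀∈A (MaybeAll.drop-just (≡.subst (a₀ ≤ᵘ_) eq (A.≤hi a₀∈A))) (≡.subst (u ≤ᵘ_) (≡.sym eq) (just ≤-refl)))
        (B.raise b₀∈B (left u (≤-respˡ-≈ (+-comm u b₀) u+b₀≤x))
          (rest B.hi (≡.subst (λ h → x ≤ᵘ h +̂ B.hi) eq x≤)))
        where
        rest : ∀ h → x ≤ᵘ just u +̂ h → x - u ≤ᵘ h
        rest nothing  _              = nothing
        rest (just v) (just p) = just (right u (≤-respʳ-≈ (+-comm u v) p))

      down : x ≤ a₀ + b₀ → ∀ l → A.lo ≡ l → MinkowskiSum x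
      down x≤a₀+b₀ nothing  eq = move-a (A.lowers a₀∈A (right b₀ x≤a₀+b₀)
        (≡.subst (x - b₀ ≥ˡ_) (≡.sym eq) nothing))
      down x≤a₀+b₀ (just l) eq with total (l + b₀) x
      ... | inj₁ l+b₀≤x = move-a (A.lowers a₀∈A (right b₀ x≤a₀+b₀)
        (≡.subst (x - b₀ ≥ˡ_) (≡.sym eq) (just (left b₀ l+b₀≤x))))
      ... | inj₂ x≤l+b₀ = move-b
        (A.lowers a₀∈A (MaybeAll.drop-just (≡.subst (a₀ ≥ˡ_) eq (A.≥lo a₀∈A))) (≡.subst (l ≥ˡ_) (≡.sym eq) (just ≤-refl)))
        (B.lowers b₀∈B (right l (≤-respʳ-≈ (+-comm l b₀) x≤l+b₀))
          (rest B.lo (≡.subst (λ h → x ≥ˡ h +̂ B.lo) eq x≥)))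
        where
        rest : ∀ h → x ≥ˡ just l +̂ h → x - l ≥ˡ h
        rest nothing  _              = nothing
        rest (just v) (just p) = just (left l (≤-respˡ-≈ (+-comm l v) p))

      go : a₀ + b₀ ≤ x ⊎ x ≤ a₀ + b₀ → MinkowskiSum x
      go (inj₁ a₀+b₀≤x) = up a₀+b₀≤x A.hi ≡.refl
      go (inj₂ x≤a₀+b₀) = down x≤a₀+b₀ A.lo ≡.refl

  infixl 6 _⊕_

  _⊕_ : Polyhedron → Polyhedron → Polyhedron
  A ⊕ B = record
    { points     = MinkowskiSum A B
    ; halfSpaces = fromBounds (A.lo +̂ B.lo) (A.hi +̂ B.hi)
    ; points⇔    = λ x → mk⇔ (fromBounds⇐ ∘ sum⇒bounds A B)
                     (λ all → let l , u = fromBounds⇒ (A.lo +̂ B.lo) (A.hi +̂ B.hi) all in bounds⇒sum A B l u)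
    ; nonempty   = _ , _ , _ , proj₂ A.nonempty , proj₂ B.nonempty , refl
    }
    where
    module A = Bounds A
    module B = Bounds B

  interval : ∀ α β → α ≤ β → Polyhedron
  interval α β α≤β = record
    { points     = λ x → α ≤ x × x ≤ β
    ; halfSpaces = [ α ,∞⟩ ∷ ⟨-∞, β ] ∷ []
    ; points⇔    = λ x → mk⇔ (λ (α≤x , x≤β) → α≤x ∷ x≤β ∷ []) (λ { (α≤x ∷ x≤β ∷ []) → α≤x , x≤β })
    ; nonempty   = α , ≤-refl , α≤β
    }

  singleton : Carrier → Polyhedron
  singleton α = record
    { points     = _≈ α
    ; halfSpaces = [ α ,∞⟩ ∷ ⟨-∞, α ] ∷ []
    ; points⇔    = λ x → mk⇔ (λ x≈α → ≤-reflexive (sym x≈α) ∷ ≤-reflexive x≈α ∷ [])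
                             (λ { (α≤x ∷ x≤α ∷ []) → antisym x≤α α≤x })
    ; nonempty   = α , refl
    }

  polyhedra : CommutativeMonoid (lsuc 0ℓ) 0ℓ
  polyhedra = record
    { Carrier = Polyhedron
    ; _≈_ = λ A B → Polyhedron.points A ≐ Polyhedron.points B
    ; _∙_ = _⊕_
    ; ε   = singleton 0#
    ; isCommutativeMonoid = record
      { isMonoid = record
        { isSemigroup = record
          { isMagma = record
            { isEquivalence = record
              { refl  = id , id
              ; sym   = λ (f , g) → g , f
              ; trans = λ (f , g) (h , k) → h ∘ f , g ∘ k
              }
            ; ∙-cong = λ (f , g) (h , k) →
                (λ (a , b , a∈ , b∈ , eq) → a , b , f a∈ , h b∈ , eq) ,
                (λ (a , b , a∈ , b∈ , eq) → a , b , g a∈ , k b∈ , eq)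
            }
          ; assoc = λ A B C →
              (λ (_ , c , (a , b , a∈ , b∈ , eq) , c∈ , eq′) →
                a , b + c , a∈ , (b , c , b∈ , c∈ , refl) ,
                trans eq′ (trans (+-congʳ eq) (+-assoc a b c))) ,
              (λ (a , _ , a∈ , (b , c , b∈ , c∈ , eq) , eq′) →
                a + b , c , (a , b , a∈ , b∈ , refl) , c∈ ,
                trans eq′ (trans (+-congˡ eq) (sym (+-assoc a b c))))
          }
        ; identity = identityˡ , λ A →
            (λ x∈ → proj₁ (identityˡ A) (swap A (singleton 0#) x∈)) ,
            (λ x∈ → swap (singleton 0#) A (proj₂ (identityˡ A) x∈))
        }
      ; comm = λ A B → swap A B , swap B A
      }
    }
    where
    swap : ∀ A B → Polyhedron.points (A ⊕ B) ⊆ Polyhedron.points (B ⊕ A)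
    swap A B (a , b , a∈ , b∈ , eq) = b , a , b∈ , a∈ , trans eq (+-comm a b)

    identityˡ : ∀ A → Polyhedron.points (singleton 0# ⊕ A) ≐ Polyhedron.points A
    identityˡ A =
      (λ (z , a , z≈0 , a∈ , eq) → Bounds.resp A (sym (trans eq (trans (+-congʳ z≈0) (+-identityˡ a)))) a∈) ,
      (λ {a} a∈ → 0# , a , refl , a∈ , sym (+-identityˡ a))

  open Indicator ℂ using (𝟙; 𝟙-cong; 𝟙-true)
  open Combinations ℂ polyhedra
  private module ℂ = CommutativeRing ℂ

  infix 4 _∈?_

  _∈?_ : ∀ x P → Dec (Polyhedron.points P x)
  x ∈? P = Polyhedron._∋?_ P x

  indicator : Polyhedron → Carrier → ℂ.Carrier
  indicator P x = 𝟙 (x ∈? P)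

  private
    open Bounds using (lo; hi; lo≤hi; ≥lo; ≤hi; within)

    inclusion-exclusion : {C H : Polyhedron → Set}
      (C? : ∀ P → Dec (C P)) (H? : ∀ P → Dec (H P)) → (∀ {P} → ¬ H P → C P) → ∀ p →
      extend (λ P → 𝟙 (C? P ×-dec H? P)) p ℂ.+ extend (λ P → 𝟙 (¬? (H? P))) p ℂ.≈
      extend (λ P → 𝟙 (C? P)) p
    inclusion-exclusion C? H? ¬H⇒C p =
      ℂ.trans (ℂ.sym (extend-+ _ _ p)) (extend-cong (λ P → split (C? P) (H? P) ¬H⇒C) p)
      where
      split : {C H : Set} (C? : Dec C) (H? : Dec H) → (¬ H → C) →
              𝟙 (C? ×-dec H?) ℂ.+ 𝟙 (¬? H?) ℂ.≈ 𝟙 C?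
      split (yes _) (yes _) _    = ℂ.+-identityʳ ℂ.1#
      split (yes _) (no  _) _    = ℂ.+-identityˡ ℂ.1#
      split (no  _) (yes _) _    = ℂ.+-identityʳ ℂ.0#
      split (no ¬c) (no ¬h) ¬h⇒c = contradiction (¬h⇒c ¬h) ¬c

    cancelʳ : ∀ {u v w} → u ℂ.+ v ℂ.≈ w → v ℂ.≈ ℂ.0# → w ℂ.≈ ℂ.0# → u ℂ.≈ ℂ.0#
    cancelʳ {u} u+v≈w v≈0 w≈0 = ℂ.trans (ℂ.sym (ℂ.+-identityʳ u))
      (ℂ.trans (ℂ.+-congˡ {u} (ℂ.sym v≈0)) (ℂ.trans u+v≈w w≈0))

    -- Every endpoint of P that is smaller than t belongs to E.
    ListedBelow : Carrier → List Carrier → Polyhedron → Set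
    ListedBelow t E P = MaybeAll.All (λ a → ¬ t ≤ a → a ∈ E) (lo P) ×
                        MaybeAll.All (λ b → ¬ t ≤ b → b ∈ E) (hi P)

    endpoints : Combination → List Carrier
    endpoints []            = []
    endpoints ((_ , P) ∷ p) = List.fromMaybe (lo P) ++ List.fromMaybe (hi P) ++ endpoints p

    Listed : List Carrier → Polyhedron → Set
    Listed E P = MaybeAll.All (_∈ E) (lo P) × MaybeAll.All (_∈ E) (hi P)

    endpoints-listed : ∀ p → All (Listed (endpoints p) ∘ proj₂) p
    endpoints-listed []            = []
    endpoints-listed ((_ , P) ∷ p) =
      (here-lo (lo P) , MaybeAll.map (∈-++⁺ʳ (List.fromMaybe (lo P))) (here-lo (hi P))) ∷
      All.map (Product.map (MaybeAll.map later) (MaybeAll.map later)) (endpoints-listed p)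
      where
      here-lo : ∀ m {xs} → MaybeAll.All (_∈ List.fromMaybe m ++ xs) m
      here-lo nothing  = nothing
      here-lo (just a) = just (here ≡.refl)
      later : ∀ {a} → a ∈ endpoints p → a ∈ endpoints ((ℂ.0# , P) ∷ p)
      later a∈ = ∈-++⁺ʳ (List.fromMaybe (lo P)) (∈-++⁺ʳ (List.fromMaybe (hi P)) a∈)

    module Relation (p : Combination)
      (vanishes : ∀ t → extend (λ P → 𝟙 (t ∈? P)) p ℂ.≈ ℂ.0#) where

      Lo Up : Carrier → ℂ.Carrier
      Lo t = extend (λ P → 𝟙 (t ≥ˡ? lo P)) p
      Up t = extend (λ P → 𝟙 (¬? (t ≤ᵘ? hi P))) p

      Up≈Lo : ∀ t → Up t ℂ.≈ Lo t
      Up≈Lo t = ℂ.trans (ℂ.sym (ℂ.+-identityˡ (Up t))) (ℂ.trans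
        (ℂ.+-congʳ {Up t} (ℂ.trans (ℂ.sym (vanishes t)) (extend-cong (λ P →
          𝟙-cong (mk⇔ (λ t∈P → ≥lo P t∈P , ≤hi P t∈P) (λ (l , u) → within P l u))
            (t ∈? P) (t ≥ˡ? lo P ×-dec t ≤ᵘ? hi P)) p)))
        (inclusion-exclusion (λ P → t ≥ˡ? lo P) (λ P → t ≤ᵘ? hi P) (λ {P} → lo≤hi P) p))

      -- Lo is constant between consecutive endpoints, so descend to the next
      -- smaller endpoint until there is none left, where Up t is an empty sum.
      Lo-vanishes : ∀ E → Acc ℕ._<_ (length E) → ∀ t → All (ListedBelow t E ∘ proj₂) p → Lo t ℂ.≈ ℂ.0#
      Lo-vanishes E (acc rec) t listed = go F ≡.refl
        where
        below? : ∀ t a → Dec (¬ t ≤ a)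
        below? t a = ¬? (t ≤? a)

        F : List Carrier
        F = filter (below? t) E

        go : ∀ F′ → F ≡ F′ → Lo t ℂ.≈ ℂ.0#
        go [] F≡[] = ℂ.trans (ℂ.sym (Up≈Lo t)) (ℂ.trans
          (extend-cong-All (All.map (λ {(_ , P)} (_ , h) → none (hi P) h) listed)) (extend-zero p))
          where
          none : ∀ u → MaybeAll.All (λ b → ¬ t ≤ b → b ∈ E) u → 𝟙 (¬? (t ≤ᵘ? u)) ℂ.≈ ℂ.0#
          none u h with t ≤ᵘ? u
          ... | yes _ = ℂ.refl
          ... | no ¬q = contradiction (MaybeAll.map t≤ h) ¬q
            where
            t≤ : ∀ {b} → (¬ t ≤ b → b ∈ E) → t ≤ b
            t≤ {b} b∈ with t ≤? b
            ... | yes t≤b = t≤b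
            ... | no  t≰b with ≡.subst (b ∈_) F≡[] (∈-filter⁺ (below? t) (b∈ t≰b) t≰b)
            ...   | ()
        go (e ∷ es) F≡ = ℂ.trans Lo-t≈Lo-s
          (Lo-vanishes (filter (below? s) E) (rec shorter) s (All.map (λ {kP} → relist {kP}) listed))
          where
          s : Carrier
          s = max e es

          s∈F : s ∈ F
          s∈F with argmax-sel id e es
          ... | inj₁ s≡e  = ≡.subst (s ∈_) (≡.sym F≡) (here s≡e)
          ... | inj₂ s∈es = ≡.subst (s ∈_) (≡.sym F≡) (there s∈es)

          F≤s : ∀ {a} → a ∈ F → a ≤ s
          F≤s {a} a∈F with ≡.subst (a ∈_) F≡ a∈F
          ... | here ≡.refl = ⊥≤max e es
          ... | there a∈es  = All.lookup (xs≤max e es) a∈es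

          t≰s : ¬ t ≤ s
          t≰s = proj₂ (∈-filter⁻ (below? t) {xs = E} s∈F)

          m : Carrier
          m = proj₁ (between t≰s)

          m≰s : ¬ m ≤ s
          m≰s = proj₁ (proj₂ (between t≰s))

          t≰m : ¬ t ≤ m
          t≰m = proj₂ (proj₂ (between t≰s))

          ≰⇒≤ : ∀ {x y} → ¬ x ≤ y → y ≤ x
          ≰⇒≤ x≰y = proj₁ (≰⇒> x≰y)

          small : ∀ {a} → (¬ t ≤ a → a ∈ E) → ¬ t ≤ a → a ≤ s
          small a∈ t≰a = F≤s (∈-filter⁺ (below? t) (a∈ t≰a) t≰a)

          lo-equiv : ∀ {l} → MaybeAll.All (λ a → ¬ t ≤ a → a ∈ E) l → m ≥ˡ l ⇔ s ≥ˡ l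
          lo-equiv nothing   = mk⇔ (λ _ → nothing) (λ _ → nothing)
          lo-equiv (just a∈) = mk⇔
            (λ { (just a≤m) → just (small a∈ (λ t≤a → t≰m (≤-trans t≤a a≤m))) })
            (λ { (just a≤s) → just (≤-trans a≤s (≰⇒≤ m≰s)) })

          up-equiv : ∀ {u} → MaybeAll.All (λ b → ¬ t ≤ b → b ∈ E) u → (¬ t ≤ᵘ u) ⇔ (¬ m ≤ᵘ u)
          up-equiv nothing   = mk⇔ (λ ¬q _ → ¬q nothing) (λ ¬q _ → ¬q nothing)
          up-equiv (just b∈) = mk⇔
            (λ { t≰b (just m≤b) → m≰s (≤-trans m≤b (small b∈ (t≰b ∘ just))) })
            (λ { m≰b (just t≤b) → m≰b (just (≤-trans (≰⇒≤ t≰m) t≤b)) })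

          Lo-t≈Lo-s : Lo t ℂ.≈ Lo s
          Lo-t≈Lo-s = ℂ.trans (ℂ.sym (Up≈Lo t)) (ℂ.trans
            (extend-cong-All (All.map (λ {(_ , P)} (_ , h) →
              𝟙-cong (up-equiv h) (¬? (t ≤ᵘ? hi P)) (¬? (m ≤ᵘ? hi P))) listed))
            (ℂ.trans (Up≈Lo m) (extend-cong-All (All.map (λ {(_ , P)} (h , _) →
              𝟙-cong (lo-equiv h) (m ≥ˡ? lo P) (s ≥ˡ? lo P)) listed))))

          shorter : length (filter (below? s) E) ℕ.< length E
          shorter = filter-notAll (below? s) E
            (Any.map (λ s≡a s≰a → s≰a (≤-reflexive (reflexive s≡a)))
              (proj₁ (∈-filter⁻ (below? t) {xs = E} s∈F)))

          relist : ∀ {kP} → ListedBelow t E (proj₂ kP) → ListedBelow s (filter (below? s) E) (proj₂ kP)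
          relist = Product.map (MaybeAll.map keep) (MaybeAll.map keep)
            where
            keep : ∀ {a} → (¬ t ≤ a → a ∈ E) → ¬ s ≤ a → a ∈ filter (below? s) E
            keep a∈ s≰a = ∈-filter⁺ (below? s)
              (a∈ (λ t≤a → s≰a (≤-trans (≰⇒≤ t≰s) t≤a))) s≰a

      Lo≈0 : ∀ t → Lo t ℂ.≈ ℂ.0#
      Lo≈0 t = Lo-vanishes (endpoints p) (<-wellFounded _) t
        (All.map (Product.map (MaybeAll.map (λ a∈ _ → a∈)) (MaybeAll.map (λ b∈ _ → b∈))) (endpoints-listed p))

      total≈0 : extend (λ _ → ℂ.1#) p ℂ.≈ ℂ.0#
      total≈0 = ℂ.trans (ℂ.sym (extend-cong-All (All.map (λ {(_ , P)} (h , _) →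
        𝟙-true (MaybeAll.map (λ a∈ → All.lookup (xs≤max 0# E) a∈) h) (max 0# E ≥ˡ? lo P))
        (endpoints-listed p)))) (Lo≈0 (max 0# E))
        where
        E : List Carrier
        E = endpoints p

      module Shift (B : Polyhedron) (x : Carrier) where

        lower-sum : ∀ l → extend (λ P → 𝟙 (x ≥ˡ? l +̂ lo P)) p ℂ.≈ ℂ.0#
        lower-sum nothing  = ℂ.trans (extend-cong (λ P → 𝟙-true nothing (x ≥ˡ? nothing +̂ lo P)) p) total≈0
        lower-sum (just b) = ℂ.trans (extend-cong (λ P → 𝟙-cong (mk⇔ (to (lo P)) from)
          (x ≥ˡ? just b +̂ lo P) (x - b ≥ˡ? lo P)) p) (Lo≈0 (x - b))
          where
          to : ∀ l → x ≥ˡ just b +̂ l → x - b ≥ˡ l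
          to nothing  _        = nothing
          to (just a) (just h) = just (+-cancelˡ-≤ b (≤-respʳ-≈ (sym (x+[y-x]≈y b x)) h))
          from : ∀ {l} → x - b ≥ˡ l → x ≥ˡ just b +̂ l
          from nothing  = nothing
          from (just h) = just (≤-respʳ-≈ (x+[y-x]≈y b x) (+-monoʳ-≤ b h))

        upper-sum : ∀ u → extend (λ P → 𝟙 (¬? (x ≤ᵘ? u +̂ hi P))) p ℂ.≈ ℂ.0#
        upper-sum nothing  = extend-zero p
        upper-sum (just b) = ℂ.trans (extend-cong (λ P → 𝟙-cong
          (mk⇔ (λ ¬q q → ¬q (from q)) (λ ¬q q → ¬q (to (hi P) q)))
          (¬? (x ≤ᵘ? just b +̂ hi P)) (¬? (x - b ≤ᵘ? hi P))) p)
          (ℂ.trans (Up≈Lo (x - b)) (Lo≈0 (x - b)))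
          where
          to : ∀ u → x ≤ᵘ just b +̂ u → x - b ≤ᵘ u
          to nothing  _        = nothing
          to (just a) (just h) = just (+-cancelˡ-≤ b (≤-respˡ-≈ (sym (x+[y-x]≈y b x)) h))
          from : ∀ {u} → x - b ≤ᵘ u → x ≤ᵘ just b +̂ u
          from nothing  = nothing
          from (just h) = just (≤-respˡ-≈ (x+[y-x]≈y b x) (+-monoʳ-≤ b h))

        lower-if-not-upper : ∀ P → ¬ (x ≤ᵘ hi B +̂ hi P) → x ≥ˡ lo B +̂ lo P
        lower-if-not-upper P = case
          where
          open Bounds (B ⊕ P) using () renaming (nonempty to z)
          z≥ : proj₁ z ≥ˡ lo B +̂ lo P
          z≥ = proj₁ (sum⇒bounds B P (proj₂ z))
          z≤ : proj₁ z ≤ᵘ hi B +̂ hi P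
          z≤ = proj₂ (sum⇒bounds B P (proj₂ z))
          case : ¬ (x ≤ᵘ hi B +̂ hi P) → x ≥ˡ lo B +̂ lo P
          case x≰ with total x (proj₁ z)
          ... | inj₁ x≤z = contradiction (MaybeAll.map (≤-trans x≤z) z≤) x≰
          ... | inj₂ z≤x = MaybeAll.map (λ a≤z → ≤-trans a≤z z≤x) z≥

        shifted : extend (λ P → 𝟙 (x ∈? B ⊕ P)) p ℂ.≈ ℂ.0#
        shifted = ℂ.trans
          (extend-cong (λ P → 𝟙-cong (mk⇔ (sum⇒bounds B P) (λ (l , u) → bounds⇒sum B P l u))
            (x ∈? B ⊕ P) (x ≥ˡ? lo B +̂ lo P ×-dec x ≤ᵘ? hi B +̂ hi P)) p)
          (cancelʳ
            (inclusion-exclusion (λ P → x ≥ˡ? lo B +̂ lo P) (λ P → x ≤ᵘ? hi B +̂ hi P)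
              (λ {P} → lower-if-not-upper P) p)
            (upper-sum (hi B)) (lower-sum (lo B)))

    shift : ∀ p → (∀ t → extend (λ P → 𝟙 (t ∈? P)) p ℂ.≈ ℂ.0#) →
            ∀ B x → extend (λ P → 𝟙 (x ∈? B ⊕ P)) p ℂ.≈ ℂ.0#
    shift p vanishes B x = Relation.Shift.shifted p vanishes B x

    indicator-cong : ∀ {P Q} → Polyhedron.points P ≐ Polyhedron.points Q →
                     ∀ x → indicator P x ℂ.≈ indicator Q x
    indicator-cong {P} {Q} (P⊆Q , Q⊆P) x = 𝟙-cong (mk⇔ P⊆Q Q⊆P) (x ∈? P) (x ∈? Q)

  module PolyhedralFunctions = Span Carrier indicator
    (λ {P} {Q} → indicator-cong {P} {Q}) shift

  -- An element is a formal combination Σ cᵢ [Pᵢ], equality is equality of the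
  -- functions ℝ → ℂ they define, and the product is induced by Minkowski sum.
  M[𝓟] : CommutativeAlgebra ℂ (lsuc 0ℓ) 0ℓ
  M[𝓟] = PolyhedralFunctions.algebra

  minkowskiRing : ∀ {n} → (Fin n → Polyhedron) → CommutativeAlgebra ℂ (lsuc 0ℓ) 0ℓ
  minkowskiRing P = Generated.commutativeAlgebra M[𝓟] (λ i → PolyhedralFunctions.[ P i ])

module IntervalRing (ℝ : CompleteOrderedField) where

  open CompleteOrderedField ℝ public
    using (_≈_; _≉_; 0#; _<_)
    renaming (Carrier to Real)
  open Reals ℝ public using (_/_[_]; fromℚ; ℂ)
  open Polyhedra ℝ using (Polyhedron; singleton; interval; minkowskiRing)

  generators : ∀ α β → α < β → Fin 3 → Polyhedron
  generators α β _         0F = singleton α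
  generators α β _         1F = singleton β
  generators α β (α≤β , _) 2F = interval α β α≤β

  R : ∀ α β → α < β → CommutativeAlgebra ℂ (lsuc 0ℓ) 0ℓ
  R α β α<β = minkowskiRing (generators α β α<β)

  module ℂ[x,y] where
    open Polynomials ℂ 2 public using (algebra; var)
    open CommutativeAlgebra algebra public using (_+_; _-_; _*_; 1#)

    x y : CommutativeAlgebra.Carrier algebra
    x = var 0F
    y = var 1F

  module ℂ[x,y,z] where
    open Polynomials ℂ 3 public using (algebra; var)
    open CommutativeAlgebra algebra public using (_+_; _-_; _*_; 1#; semiring)
    open Exp semiring public using (_^_)

    x y z : CommutativeAlgebra.Carrier algebra
    x = var 0F
    y = var 1F
    z = var 2F

{-# OPTIONS --safe #-}

-- The Minkowski product of two intervals adds their endpoints, so modulo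
-- (z - x)(z - y) every element of a presented algebra Q is p₀ + p₁ z with p₀ and
-- p₁ linear combinations of monomials xᵏyˡ, and the map ψ from Q to the Minkowski
-- ring sends xᵏyˡ to the point kα + lβ and xᵏyˡz to the interval
-- [kα + lβ + α, kα + lβ + β].  If ψ(p₀ + p₁ z) = 0, let D(t) be the sum of the
-- coefficients of the monomials of p₁ with kα + lβ = t.  The difference of the
-- values of ψ(p₀ + p₁ z) just above and just below t is D(t - α) - D(t - β), so
-- D has period β - α; having finite support, it vanishes, and p₁ = 0 in Q as soon as
-- monomials with the same point are equal in Q.  Then p₀ = 0 for the same reason,
-- and ψ is injective.  In each of the four cases the remaining relation of the
-- presentation is exactly what identifies the monomials with the same point; in
-- case (1), where 0 is an endpoint, x or y is the unit of Q.

module Submission where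

open import Defs
open import Algebra.Bundles using (CommutativeRing)
open import Algebra.Morphism.Structures using (module RingMorphisms)
import Algebra.Properties.AbelianGroup as AbelianGroupProperties
import Algebra.Properties.CommutativeMonoid.Mult as CommutativeMonoidMult
import Algebra.Properties.CommutativeSemigroup as CommutativeSemigroupProperties
import Algebra.Properties.CommutativeSemiring.Exp as CommutativeSemiringExp
import Algebra.Properties.Ring as RingProperties
import Algebra.Properties.Semiring.Exp as Exp
import Algebra.Properties.Semiring.Mult as Mult
import Algebra.Properties.Semiring.Sum as Sum
import Algebra.Solver.Ring.NaturalCoefficients.Default as SemiringSolver
open import Data.Fin.Base using (Fin; zero; suc; inject₁)
open import Data.Fin.Patterns using (0F; 1F; 2F)
open import Data.List.Base as List using (List; _++_; filter; length)
open import Data.List.Membership.Propositional using (_∈_)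
open import Data.List.Membership.Propositional.Properties using (∈-filter⁺)
open import Data.List.Properties using (length-filter; filter-notAll)
open import Data.List.Relation.Unary.All as All using (All)
import Data.List.Relation.Unary.All.Properties as All
import Data.List.Relation.Unary.Any as Any
import Data.Maybe.Relation.Unary.All as MaybeAll
open import Data.Maybe.Relation.Unary.All using (just)
open import Data.Nat.Base as ℕ using (ℕ; zero; suc; s≤s; NonZero)
open import Data.Nat.Coprimality as Coprime using (Coprime; coprime-/gcd; coprime-divisor)
open import Data.Nat.Divisibility using (_∣_; divides; ∣m+n∣m⇒∣n; m∣m*n)
open import Data.Nat.DivMod using (_/_; m/n*n≡m)
open import Data.Nat.GCD using (gcd; gcd[m,n]∣m; gcd[m,n]∣n; gcd[m,n]≢0; n/gcd[m,n]≢0)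
open import Data.Nat.Induction using (<-wellFounded)
import Data.Nat.Properties as ℕ
open import Data.Product.Base using (Σ-syntax; ∃₂; ∃-syntax; _×_; _,_; proj₁; proj₂)
open import Data.Rational.Base as ℚ using (ℚ; mkℚ+; ↥_; ↧ₙ_)
open import Data.Sum.Base using (_⊎_; inj₁; inj₂)
open import Data.Vec.Base as Vec using (Vec; zipWith; replicate; _[_]≔_)
open import Data.Vec.Functional as Vector using (Vector)
import Data.Vec.Properties as Vec
open import Function.Base using (_∘_; id)
open import Function.Bundles using (_⇔_; mk⇔; module Equivalence)
open import Induction.WellFounded using (Acc; acc)
open import Level using (Level; 0ℓ; _⊔_)
open import Relation.Binary.Definitions using (tri<; tri≈; tri>)
import Relation.Binary.Properties.DecTotalOrder as DecTotalOrderProperties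
open import Relation.Binary.PropositionalEquality.Core as ≡ using (_≡_; _≢_)
import Relation.Binary.Reasoning.Setoid as SetoidReasoning
open import Relation.Nullary.Decidable using (Dec; yes; no; ¬?; _×-dec_)
open import Relation.Nullary.Negation using (¬_; contradiction)
open import Relation.Unary using (_≐_)

open RingMorphisms using (IsRingHomomorphism)

-- An element of the Minkowski ring is known only through its values as a function, so a map out of
-- that ring is hard to define directly. The Minkowski ring and a presented algebra are therefore
-- compared inside the ring of polyhedral functions: two algebras embedded there with the same image
-- are isomorphic. Only the injectivity of the map from the presented algebra takes real work.
--
-- Coincidences kα + lβ = k′α + l′β reduce to those of the form kα + bβ = b′β, because a common
-- power of x can be split off before the relation is applied; no cancellation in the presented
-- algebra is needed. If α/β is irrational, such a coincidence forces k = 0 and b = b′. If α/β =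
-- ±m/n, multiplying by n and using that m and n are coprime shows k = jn, and b and b′ then differ
-- by jm: this is j applications of the relation.

private variable
  a c c₁ c₂ ℓ ℓ₁ ℓ₂ i : Level

-- Homomorphisms of commutative algebras.

module _ {K : CommutativeRing 0ℓ 0ℓ} where

  -- Zero and one are scalars and additive inverses are unique, so these four fields already imply
  -- that 0, 1 and negation are preserved.
  record IsAlgebraHomomorphism
    (A : CommutativeAlgebra K c₁ ℓ₁) (B : CommutativeAlgebra K c₂ ℓ₂)
    (f : CommutativeAlgebra.Carrier A → CommutativeAlgebra.Carrier B) : Set (c₁ ⊔ ℓ₁ ⊔ ℓ₂) where
    private
      module A = CommutativeAlgebra A
      module B = CommutativeAlgebra B
    field
      cong        : ∀ {x y} → x A.≈ y → f x B.≈ f y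
      +-homo      : ∀ x y → f (x A.+ y) B.≈ f x B.+ f y
      *-homo      : ∀ x y → f (x A.* y) B.≈ f x B.* f y
      scalar-homo : ∀ k → f (A.scalar k) B.≈ B.scalar k

    private
      module K = CommutativeRing K
      module SA = IsRingHomomorphism A.scalar-isRingHomomorphism
      module SB = IsRingHomomorphism B.scalar-isRingHomomorphism
      open AbelianGroupProperties B.+-abelianGroup using (inverseˡ-unique)

    0#-homo : f A.0# B.≈ B.0#
    0#-homo = B.trans (cong (A.sym SA.0#-homo)) (B.trans (scalar-homo K.0#) SB.0#-homo)

    1#-homo : f A.1# B.≈ B.1#
    1#-homo = B.trans (cong (A.sym SA.1#-homo)) (B.trans (scalar-homo K.1#) SB.1#-homo)

    -‿homo : ∀ x → f (A.- x) B.≈ B.- f x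
    -‿homo x = inverseˡ-unique (f (A.- x)) (f x)
      (B.trans (B.sym (+-homo (A.- x) x)) (B.trans (cong (A.-‿inverseˡ x)) 0#-homo))

    minus-homo : ∀ x y → f (x A.- y) B.≈ f x B.- f y
    minus-homo x y = B.trans (+-homo x (A.- y)) (B.+-congˡ (-‿homo y))

    ^-homo : ∀ x n → f (Exp._^_ A.semiring x n) B.≈ Exp._^_ B.semiring (f x) n
    ^-homo x zero    = 1#-homo
    ^-homo x (suc n) = B.trans (*-homo x _) (B.*-congˡ (^-homo x n))

    isRingHomomorphism : IsRingHomomorphism A.rawRing B.rawRing f
    isRingHomomorphism = record
      { isSemiringHomomorphism = record
        { isNearSemiringHomomorphism = record
          { +-isMonoidHomomorphism = record
            { isMagmaHomomorphism = record { isRelHomomorphism = record { cong = cong } ; homo = +-homo }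
            ; ε-homo = 0#-homo
            }
          ; *-homo = *-homo
          }
        ; 1#-homo = 1#-homo
        }
      ; -‿homo = -‿homo
      }

  -- With `K` as an algebra over itself, `K`-valued sums over a list are linear combinations like
  -- any other, and the same lemmas serve both.
  baseAlgebra : CommutativeAlgebra K 0ℓ 0ℓ
  baseAlgebra = record
    { commutativeRing = K
    ; scalar = id
    ; scalar-isRingHomomorphism = record
      { isSemiringHomomorphism = record
        { isNearSemiringHomomorphism = record
          { +-isMonoidHomomorphism = record
            { isMagmaHomomorphism = record { isRelHomomorphism = record { cong = id } ; homo = λ _ _ → K.refl }
            ; ε-homo = K.refl
            }
          ; *-homo = λ _ _ → K.refl
          }
        ; 1#-homo = K.refl
        }
      ; -‿homo = λ _ → K.refl
      }
    }
    where module K = CommutativeRing K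

-- Linear combinations in an algebra.

module LinearCombinations {K : CommutativeRing 0ℓ 0ℓ} (A : CommutativeAlgebra K c ℓ) where

  open import Data.List.Base using ([]; _∷_)
  open import Data.List.Relation.Unary.All using ([]; _∷_)
  open CommutativeAlgebra A
  open CommutativeSemigroupProperties +-commutativeSemigroup using (interchange)
  private module K = CommutativeRing K

  combine : {X : Set a} → (X → Carrier) → List (K.Carrier × X) → Carrier
  combine f []            = 0#
  combine f ((k , x) ∷ p) = scalar k * f x + combine f p

  combine-cong : {X : Set a} {f g : X → Carrier} → (∀ x → f x ≈ g x) → ∀ p → combine f p ≈ combine g p
  combine-cong f≈g []            = refl
  combine-cong f≈g ((k , x) ∷ p) = +-cong (*-congˡ (f≈g x)) (combine-cong f≈g p)

  combine-cong-All : {X : Set a} {f g : X → Carrier} {p : List (K.Carrier × X)} →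
    All (λ (_ , x) → f x ≈ g x) p → combine f p ≈ combine g p
  combine-cong-All []         = refl
  combine-cong-All (eq ∷ eqs) = +-cong (*-congˡ eq) (combine-cong-All eqs)

  combine-zero : {X : Set a} (p : List (K.Carrier × X)) → combine (λ _ → 0#) p ≈ 0#
  combine-zero []            = refl
  combine-zero ((k , x) ∷ p) = trans (+-cong (zeroʳ _) (combine-zero p)) (+-identityˡ 0#)

  combine-+ : {X : Set a} (f g : X → Carrier) → ∀ p →
    combine (λ x → f x + g x) p ≈ combine f p + combine g p
  combine-+ f g []            = sym (+-identityʳ 0#)
  combine-+ f g ((k , x) ∷ p) = trans (+-cong (distribˡ _ _ _) (combine-+ f g p)) (interchange _ _ _ _)

  combine-*ʳ : {X : Set a} (f : X → Carrier) (y : Carrier) → ∀ p →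
    combine (λ x → f x * y) p ≈ combine f p * y
  combine-*ʳ f y []            = sym (zeroˡ y)
  combine-*ʳ f y ((k , x) ∷ p) =
    trans (+-cong (sym (*-assoc _ _ _)) (combine-*ʳ f y p)) (sym (distribʳ _ _ _))

  combine-map : {X : Set a} {Y : Set i} (f : Y → Carrier) (h : X → Y) → ∀ p →
    combine f (List.map (λ (k , x) → k , h x) p) ≡ combine (f ∘ h) p
  combine-map f h []            = ≡.refl
  combine-map f h ((k , x) ∷ p) = ≡.cong (scalar k * f (h x) +_) (combine-map f h p)

  combine-++ : {X : Set a} (f : X → Carrier) → ∀ p q → combine f (p ++ q) ≈ combine f p + combine f q
  combine-++ f []            q = sym (+-identityˡ _)
  combine-++ f ((k , x) ∷ p) q = trans (+-congˡ (combine-++ f p q)) (sym (+-assoc _ _ _))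

  -- Two families merge into one over the disjoint union; in this form p₀ + p₁ z is a single sum
  -- over point monomials and interval monomials.
  combine-⊎ : {X : Set a} {Y : Set i} (f : X ⊎ Y → Carrier) → ∀ p q →
    combine f (List.map (λ (k , x) → k , inj₁ x) p ++ List.map (λ (k , y) → k , inj₂ y) q) ≈
    combine (f ∘ inj₁) p + combine (f ∘ inj₂) q
  combine-⊎ f p q = trans (combine-++ f (List.map (λ (k , x) → k , inj₁ x) p) _)
    (+-cong (reflexive (combine-map f inj₁ p)) (reflexive (combine-map f inj₂ q)))

-- Linear combinations grouped by an equivalence relation.

module Fibres {K : CommutativeRing 0ℓ 0ℓ} {X : Set} (_~_ : X → X → Set) (_~?_ : ∀ x y → Dec (x ~ y))
  (~-refl : ∀ {x} → x ~ x) (~-sym : ∀ {x y} → x ~ y → y ~ x) (~-trans : ∀ {x y z} → x ~ y → y ~ z → x ~ z) where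

  open import Data.List.Base using ([]; _∷_)
  private
    module K = CommutativeRing K
    open LinearCombinations (baseAlgebra {K}) using () renaming (combine to sumK)
  open Indicator K

  fibreSum : X → List (K.Carrier × X) → K.Carrier
  fibreSum y = sumK (λ x → 𝟙 (x ~? y))

  outside : X → List (K.Carrier × X) → List (K.Carrier × X)
  outside y = filter (λ (_ , x) → ¬? (x ~? y))

  module _ (A : CommutativeAlgebra K c ℓ) (f : X → CommutativeAlgebra.Carrier A)
    (f-cong : ∀ {x y} → x ~ y → CommutativeAlgebra._≈_ A (f x) (f y)) where

    open CommutativeAlgebra A
    open LinearCombinations A
    open CommutativeSemigroupProperties +-commutativeSemigroup using (x∙yz≈y∙xz)
    open SetoidReasoning setoid
    private module S = IsRingHomomorphism scalar-isRingHomomorphism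

    -- As `f` is constant on classes, the entries in the class of `y` merge into one term carrying
    -- their total coefficient. The algebra is arbitrary because the lemma is applied both to `A`
    -- and to `K` itself.
    combine-split : ∀ y p → combine f p ≈ scalar (fibreSum y p) * f y + combine f (outside y p)
    combine-split y []            =
      sym (trans (+-identityʳ _) (trans (*-congʳ S.0#-homo) (zeroˡ (f y))))
    combine-split y ((k , x) ∷ p) with x ~? y
    ... | yes x~y = begin
      scalar k * f x + combine f p
        ≈⟨ +-cong (*-cong (S.⟦⟧-cong (K.sym (K.*-identityʳ k))) (f-cong x~y)) (combine-split y p) ⟩
      scalar (k K.* K.1#) * f y + (scalar (fibreSum y p) * f y + combine f (outside y p))
        ≈⟨ +-assoc _ _ _ ⟨
      (scalar (k K.* K.1#) * f y + scalar (fibreSum y p) * f y) + combine f (outside y p)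
        ≈⟨ +-congʳ (distribʳ _ _ _) ⟨
      (scalar (k K.* K.1#) + scalar (fibreSum y p)) * f y + combine f (outside y p)
        ≈⟨ +-congʳ (*-congʳ (S.+-homo _ _)) ⟨
      scalar (k K.* K.1# K.+ fibreSum y p) * f y + combine f (outside y p) ∎
    ... | no x≁y = begin
      scalar k * f x + combine f p
        ≈⟨ +-congˡ (combine-split y p) ⟩
      scalar k * f x + (scalar (fibreSum y p) * f y + combine f (outside y p))
        ≈⟨ x∙yz≈y∙xz _ _ _ ⟩
      scalar (fibreSum y p) * f y + (scalar k * f x + combine f (outside y p))
        ≈⟨ +-congʳ (*-congʳ (S.⟦⟧-cong (K.trans (K.+-congʳ (K.zeroʳ k)) (K.+-identityˡ _)))) ⟨
      scalar (k K.* K.0# K.+ fibreSum y p) * f y + (scalar k * f x + combine f (outside y p)) ∎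

  module _ (A : CommutativeAlgebra K c ℓ) (f : X → CommutativeAlgebra.Carrier A)
    (f-cong : ∀ {x y} → x ~ y → CommutativeAlgebra._≈_ A (f x) (f y)) where

    open CommutativeAlgebra A
    open LinearCombinations A
    private module S = IsRingHomomorphism scalar-isRingHomomorphism

    private
      -- This is `combine-split` for the indicator of the class of `y`, with values in `K`: the
      -- class taken out contributes a multiple of its fibre sum, which is zero, so the remaining
      -- fibre sums do not change.
      outside-fibreSum : ∀ x p → (∀ y → fibreSum y p K.≈ K.0#) → ∀ y → fibreSum y (outside x p) K.≈ K.0#
      outside-fibreSum x p vanishes y = K.trans (K.sym (K.trans
        (combine-split baseAlgebra (λ z → 𝟙 (z ~? y))
          (λ {u} {v} u~v → 𝟙-cong (mk⇔ (~-trans (~-sym u~v)) (~-trans u~v)) (u ~? y) (v ~? y)) x p)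
        (K.trans (K.+-congʳ (K.trans (K.*-congʳ (vanishes x)) (K.zeroˡ _))) (K.+-identityˡ _))))
        (vanishes y)

      outside-length : ∀ k x p → length (outside x ((k , x) ∷ p)) ℕ.< length ((k , x) ∷ p)
      outside-length k x p with x ~? x
      ... | yes _  = s≤s (length-filter _ p)
      ... | no x≁x = contradiction ~-refl x≁x

      -- Taking out the class of the first entry removes a term with coefficient zero, and the list
      -- gets strictly shorter because `x ~ x`.
      vanish : ∀ p → Acc ℕ._<_ (length p) → (∀ y → fibreSum y p K.≈ K.0#) → combine f p ≈ 0#
      vanish []               _         vanishes = refl
      vanish p@((k , x) ∷ p′) (acc rec) vanishes = trans (combine-split A f f-cong x p) (trans
        (+-cong (trans (*-congʳ (trans (S.⟦⟧-cong (vanishes x)) S.0#-homo)) (zeroˡ (f x)))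
          (vanish (outside x p) (rec (outside-length k x p′)) (outside-fibreSum x p vanishes)))
        (+-identityˡ 0#))

    combine-vanishes : ∀ p → (∀ y → fibreSum y p K.≈ K.0#) → combine f p ≈ 0#
    combine-vanishes p = vanish p (<-wellFounded (length p))

-- Evaluation of polynomials in an algebra.

module Evaluation {K : CommutativeRing 0ℓ 0ℓ} (A : CommutativeAlgebra K c ℓ) where

  open import Data.List.Base using ([]; _∷_)
  open import Data.Vec.Base using ([]; _∷_)
  open CommutativeAlgebra A hiding (zero)
  open LinearCombinations A
  open Exp semiring using (_^_; ^-homo-*)
  open CommutativeSemigroupProperties *-commutativeSemigroup using (interchange)
  open RingProperties ring using (-‿distribˡ-*)
  open AbelianGroupProperties +-abelianGroup using (⁻¹-∙-comm; ε⁻¹≈ε; x∙y⁻¹≈ε⇒x≈y)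
  open SetoidReasoning setoid
  private
    module K = CommutativeRing K
    module S = IsRingHomomorphism scalar-isRingHomomorphism

  powerProduct : ∀ {n} → (Fin n → Carrier) → Vec ℕ n → Carrier
  powerProduct g []      = 1#
  powerProduct g (k ∷ m) = g zero ^ k * powerProduct (g ∘ suc) m

  powerProduct-homo : ∀ {n} (g : Fin n → Carrier) m m′ →
    powerProduct g (zipWith ℕ._+_ m m′) ≈ powerProduct g m * powerProduct g m′
  powerProduct-homo g []      []        = sym (*-identityˡ 1#)
  powerProduct-homo g (k ∷ m) (k′ ∷ m′) =
    trans (*-cong (^-homo-* (g zero) k k′) (powerProduct-homo (g ∘ suc) m m′)) (interchange _ _ _ _)

  powerProduct-ε : ∀ {n} (g : Fin n → Carrier) → powerProduct g (replicate n 0) ≈ 1#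
  powerProduct-ε {zero}  g = refl
  powerProduct-ε {suc n} g = trans (*-identityˡ _) (powerProduct-ε (g ∘ suc))

  powerProduct-var : ∀ {n} (g : Fin n → Carrier) j → powerProduct g (replicate n 0 [ j ]≔ 1) ≈ g j
  powerProduct-var g zero    = trans (*-cong (*-identityʳ (g zero)) (powerProduct-ε (g ∘ suc))) (*-identityʳ _)
  powerProduct-var g (suc j) = trans (*-identityˡ _) (powerProduct-var (g ∘ suc) j)

  module _ {n : ℕ} (g : Fin n → Carrier) where

    private
      module P = Polynomials K n
      module Poly = CommutativeAlgebra P.algebra
    open P using (Combination; negated; translate; multiplied; _⊞_; extend)

    eval : Combination → Carrier
    eval = combine (powerProduct g)

    private
      eval-negated : ∀ p → eval (negated p) ≈ - eval p
      eval-negated []            = sym ε⁻¹≈ε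
      eval-negated ((k , m) ∷ p) = trans
        (+-cong (trans (*-congʳ (S.-‿homo k)) (sym (-‿distribˡ-* _ _))) (eval-negated p))
        (⁻¹-∙-comm _ _)

      eval-translate : ∀ k m p → eval (translate k m p) ≈ (scalar k * powerProduct g m) * eval p
      eval-translate k m []             = sym (zeroʳ _)
      eval-translate k m ((k′ , m′) ∷ p) = begin
        scalar (k K.* k′) * powerProduct g (m ⊞ m′) + eval (translate k m p)
          ≈⟨ +-cong (trans (*-cong (S.*-homo k k′) (powerProduct-homo g m m′)) (interchange _ _ _ _))
               (eval-translate k m p) ⟩
        (scalar k * powerProduct g m) * (scalar k′ * powerProduct g m′) + (scalar k * powerProduct g m) * eval p
          ≈⟨ distribˡ _ _ _ ⟨
        (scalar k * powerProduct g m) * eval ((k′ , m′) ∷ p) ∎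

      eval-multiplied : ∀ p q → eval (multiplied p q) ≈ eval p * eval q
      eval-multiplied []            q = sym (zeroˡ _)
      eval-multiplied ((k , m) ∷ p) q = trans (combine-++ _ (translate k m q) (multiplied p q))
        (trans (+-cong (eval-translate k m q) (eval-multiplied p q)) (sym (distribʳ _ _ _)))

      -- Equality of polynomials is equality of coefficients, not of lists of terms. The coefficient
      -- at a monomial is the fibre sum for equality of exponent vectors, so zero coefficients make
      -- every evaluation zero.
      eval-vanishes : ∀ p → p P.≋ [] → eval p ≈ 0#
      eval-vanishes p p≋0 = Fibres.combine-vanishes {K = K} _≡_ P._≟_ ≡.refl ≡.sym ≡.trans
        A (powerProduct g) (λ { ≡.refl → refl }) p
        (λ t → K.trans (K.reflexive (≡.sym (extend≡ _ p))) (P.at p≋0 t))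
        where
        extend≡ : ∀ φ p → extend φ p ≡ LinearCombinations.combine (baseAlgebra {K}) φ p
        extend≡ φ []            = ≡.refl
        extend≡ φ ((k , x) ∷ p) = ≡.cong (k K.* φ x K.+_) (extend≡ φ p)

      eval-cong : ∀ {p q} → p P.≋ q → eval p ≈ eval q
      eval-cong {p} {q} p≋q = x∙y⁻¹≈ε⇒x≈y _ _ (trans
        (sym (trans (combine-++ _ p (negated q)) (+-congˡ (eval-negated q))))
        (eval-vanishes (p ++ negated q)
          (Poly.trans {p ++ negated q} (Poly.+-congʳ {negated q} p≋q) (Poly.-‿inverseʳ q))))

    eval-scalar : ∀ k → eval (Poly.scalar k) ≈ scalar k
    eval-scalar k = trans (+-identityʳ _) (trans (*-congˡ (powerProduct-ε g)) (*-identityʳ _))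

    eval-var : ∀ j → eval (P.var j) ≈ g j
    eval-var j = trans (+-identityʳ _) (trans (*-cong S.1#-homo (powerProduct-var g j)) (*-identityˡ _))

    eval-isHomomorphism : IsAlgebraHomomorphism P.algebra A eval
    eval-isHomomorphism = record
      { cong        = eval-cong
      ; +-homo      = combine-++ (powerProduct g)
      ; *-homo      = eval-multiplied
      ; scalar-homo = eval-scalar
      }

module _ {K : CommutativeRing 0ℓ 0ℓ} (A : CommutativeAlgebra K c₁ ℓ₁) (B : CommutativeAlgebra K c₂ ℓ₂)
  {f : CommutativeAlgebra.Carrier A → CommutativeAlgebra.Carrier B} (f-hom : IsAlgebraHomomorphism A B f) where

  open import Data.List.Base using ([]; _∷_)
  open import Data.Vec.Base using ([]; _∷_)
  private
    module A = CommutativeAlgebra A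
    module B = CommutativeAlgebra B
    module CA = LinearCombinations A
    module CB = LinearCombinations B
    module EA = Evaluation A
    module EB = Evaluation B
    module f = IsAlgebraHomomorphism f-hom
    open Exp B.semiring using (^-congˡ)

  image-combine : {X : Set a} (g : X → A.Carrier) → ∀ p → f (CA.combine g p) B.≈ CB.combine (f ∘ g) p
  image-combine g []            = f.0#-homo
  image-combine g ((k , x) ∷ p) = B.trans (f.+-homo _ _)
    (B.+-cong (B.trans (f.*-homo _ _) (B.*-congʳ (f.scalar-homo k))) (image-combine g p))

  image-powerProduct : ∀ {n} {g : Fin n → A.Carrier} {h : Fin n → B.Carrier} →
    (∀ j → f (g j) B.≈ h j) → ∀ m → f (EA.powerProduct g m) B.≈ EB.powerProduct h m
  image-powerProduct fg≈h []      = f.1#-homo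
  image-powerProduct fg≈h (k ∷ m) = B.trans (f.*-homo _ _) (B.*-cong
    (B.trans (f.^-homo _ k) (^-congˡ k (fg≈h zero))) (image-powerProduct (fg≈h ∘ suc) m))

-- The exponent vector is built up from its last entry to its first: the tail is treated under a
-- leading 0, then the head is raised one unit at a time.
multiIndex-induction : ∀ {n} (P : Vec ℕ n → Set a) → P (replicate n 0) →
  (∀ j {m} → P m → P (zipWith ℕ._+_ (replicate n 0 [ j ]≔ 1) m)) → ∀ m → P m
multiIndex-induction P P0 step Vec.[]        = P0
multiIndex-induction P P0 step (k Vec.∷ m) = go k
  where
  go : ∀ k → P (k Vec.∷ m)
  go zero    = multiIndex-induction (λ m → P (0 Vec.∷ m)) P0 (λ j → step (suc j)) m
  go (suc k) = ≡.subst (λ m′ → P (suc k Vec.∷ m′)) (Vec.zipWith-identityˡ ℕ.+-identityˡ m) (step zero (go k))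

-- Generated subalgebras, quotients and isomorphisms.

module _ {K : CommutativeRing 0ℓ 0ℓ} where

  open import Data.List.Base using ([]; _∷_)
  private module K = CommutativeRing K

  module _ (A : CommutativeAlgebra K c₁ ℓ₁) (B : CommutativeAlgebra K c₂ ℓ₂)
    {I : Set i} {g : I → CommutativeAlgebra.Carrier A} {h : I → CommutativeAlgebra.Carrier B}
    {f : CommutativeAlgebra.Carrier A → CommutativeAlgebra.Carrier B}
    (f-hom : IsAlgebraHomomorphism A B f) (f-generator : ∀ j → CommutativeAlgebra._≈_ B (f (g j)) (h j)) where

    private
      module A = CommutativeAlgebra A
      module B = CommutativeAlgebra B
      module GA = Generated A g
      module GB = Generated B h
      module f = IsAlgebraHomomorphism f-hom

    image-InSubalgebra : ∀ {p} → GA.InSubalgebra p → GB.InSubalgebra (f p)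
    image-InSubalgebra (GA.generator j)     = GB.respects (B.sym (f-generator j)) (GB.generator j)
    image-InSubalgebra (GA.constant k)      = GB.respects (B.sym (f.scalar-homo k)) (GB.constant k)
    image-InSubalgebra (GA.sum p∈ q∈)       =
      GB.respects (B.sym (f.+-homo _ _)) (GB.sum (image-InSubalgebra p∈) (image-InSubalgebra q∈))
    image-InSubalgebra (GA.product p∈ q∈)   =
      GB.respects (B.sym (f.*-homo _ _)) (GB.product (image-InSubalgebra p∈) (image-InSubalgebra q∈))
    image-InSubalgebra (GA.respects p≈q p∈) = GB.respects (f.cong p≈q) (image-InSubalgebra p∈)

    InSubalgebra-preimage : ∀ {q} → GB.InSubalgebra q → ∃[ p ] f p B.≈ q
    InSubalgebra-preimage (GB.generator j)     = g j , f-generator j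
    InSubalgebra-preimage (GB.constant k)      = A.scalar k , f.scalar-homo k
    InSubalgebra-preimage (GB.sum p∈ q∈)       =
      let p , fp≈ = InSubalgebra-preimage p∈ ; q , fq≈ = InSubalgebra-preimage q∈ in
      p A.+ q , B.trans (f.+-homo p q) (B.+-cong fp≈ fq≈)
    InSubalgebra-preimage (GB.product p∈ q∈)   =
      let p , fp≈ = InSubalgebra-preimage p∈ ; q , fq≈ = InSubalgebra-preimage q∈ in
      p A.* q , B.trans (f.*-homo p q) (B.*-cong fp≈ fq≈)
    InSubalgebra-preimage (GB.respects p≈q p∈) =
      let p , fp≈ = InSubalgebra-preimage p∈ in p , B.trans fp≈ p≈q

  module _ (A : CommutativeAlgebra K c₁ ℓ₁) (B : CommutativeAlgebra K c₂ ℓ₂) (C : CommutativeAlgebra K c ℓ) where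

    private
      module A = CommutativeAlgebra A
      module B = CommutativeAlgebra B
      module C = CommutativeAlgebra C

    -- The preimages in `to` may be chosen without any compatibility: every equation required of the
    -- map from `A` to `B` is checked after applying `g`, where it becomes the same equation for
    -- `f`.
    sameImage⇒≅ : {f : A.Carrier → C.Carrier} {g : B.Carrier → C.Carrier} →
      IsAlgebraHomomorphism A C f → (∀ {x y} → f x C.≈ f y → x A.≈ y) →
      IsAlgebraHomomorphism B C g → (∀ {x y} → g x C.≈ g y → x B.≈ y) →
      (∀ x → ∃[ y ] g y C.≈ f x) → (∀ y → ∃[ x ] f x C.≈ g y) → A ≅ B
    sameImage⇒≅ {f} {g} f-hom f-injective g-hom g-injective to from =
      φ , record
        { isRingMonomorphism = record
          { isRingHomomorphism = IsAlgebraHomomorphism.isRingHomomorphism φ-hom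
          ; injective = λ {x} {y} φx≈φy →
              f-injective (C.trans (C.sym (g∘φ x)) (C.trans (g.cong φx≈φy) (g∘φ y)))
          }
        ; surjective = λ y → let x , fx≈gy = from y in
            x , λ {z} z≈x → g-injective (C.trans (g∘φ z) (C.trans (f.cong z≈x) fx≈gy))
        } , IsAlgebraHomomorphism.scalar-homo φ-hom
      where
      module f = IsAlgebraHomomorphism f-hom
      module g = IsAlgebraHomomorphism g-hom

      φ : A.Carrier → B.Carrier
      φ x = proj₁ (to x)

      g∘φ : ∀ x → g (φ x) C.≈ f x
      g∘φ x = proj₂ (to x)

      φ-hom : IsAlgebraHomomorphism A B φ
      φ-hom = record
        { cong        = λ {x} {y} x≈y → g-injective (C.trans (g∘φ x) (C.trans (f.cong x≈y) (C.sym (g∘φ y))))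
        ; +-homo      = λ x y → g-injective (C.trans (g∘φ (x A.+ y)) (C.trans (f.+-homo x y)
                          (C.sym (C.trans (g.+-homo _ _) (C.+-cong (g∘φ x) (g∘φ y))))))
        ; *-homo      = λ x y → g-injective (C.trans (g∘φ (x A.* y)) (C.trans (f.*-homo x y)
                          (C.sym (C.trans (g.*-homo _ _) (C.*-cong (g∘φ x) (g∘φ y))))))
        ; scalar-homo = λ k → g-injective (C.trans (g∘φ (A.scalar k)) (C.trans (f.scalar-homo k)
                          (C.sym (g.scalar-homo k))))
        }

  module QuotientProperties (A : CommutativeAlgebra K c ℓ) {k : ℕ}
    (r : Vector (CommutativeAlgebra.Carrier A) k) where

    private
      module A = CommutativeAlgebra A
      module Q = CommutativeAlgebra (A /⟨ r ⟩)
    open Sum A.semiring using (sum)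

    private
      zero-sum : ∀ {k} (r : Vector A.Carrier k) → sum (λ j → A.0# A.* r j) A.≈ A.0#
      zero-sum {zero}  r = A.refl
      zero-sum {suc k} r = A.trans (A.+-cong (A.zeroˡ _) (zero-sum (r ∘ suc))) (A.+-identityˡ A.0#)

    ≈⇒∼ : ∀ {p q} → p A.≈ q → p Q.≈ q
    ≈⇒∼ p≈q = (λ _ → A.0#) , A.trans (x≈y⇒x∙y⁻¹≈ε p≈q) (A.sym (zero-sum r))
      where open AbelianGroupProperties A.+-abelianGroup using (x≈y⇒x∙y⁻¹≈ε)

    relation-vanishes : ∀ j → r j Q.≈ Q.0#
    relation-vanishes j = let h , eq = member r j in
      h , A.trans (A.trans (A.+-congˡ ε⁻¹≈ε) (A.+-identityʳ (r j))) eq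
      where
      open AbelianGroupProperties A.+-abelianGroup using (ε⁻¹≈ε)
      member : ∀ {k} (r : Vector A.Carrier k) j →
               Σ[ h ∈ Vector A.Carrier k ] r j A.≈ sum (λ j → h j A.* r j)
      member r zero    = (A.1# Vector.∷ λ _ → A.0#) , A.sym
        (A.trans (A.+-cong (A.*-identityˡ (r zero)) (zero-sum (r ∘ suc))) (A.+-identityʳ (r zero)))
      member r (suc j) = let h , eq = member (r ∘ suc) j in (A.0# Vector.∷ h) ,
        A.sym (A.trans (A.+-cong (A.zeroˡ _) (A.sym eq)) (A.+-identityˡ (r (suc j))))

    -- Both powers iterate the same multiplication on the same carrier and differ only in the
    -- semiring that packages it; for a variable exponent this takes an induction.
    ^-agrees : ∀ p m → Exp._^_ A.semiring p m ≡ Exp._^_ Q.semiring p m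
    ^-agrees p zero    = ≡.refl
    ^-agrees p (suc m) = ≡.cong (p A.*_) (^-agrees p m)

    module _ (B : CommutativeAlgebra K c₂ ℓ₂) {f : A.Carrier → CommutativeAlgebra.Carrier B}
      (f-hom : IsAlgebraHomomorphism A B f) where

      private
        module B = CommutativeAlgebra B
        module f = IsAlgebraHomomorphism f-hom
      open AbelianGroupProperties B.+-abelianGroup using (x∙y⁻¹≈ε⇒x≈y)

      -- A combination of the relations goes to a combination of their images, which are zero. The
      -- function on carriers stays the same, so only the congruence is new.
      factor : (∀ j → f (r j) B.≈ B.0#) → IsAlgebraHomomorphism (A /⟨ r ⟩) B f
      factor vanishes = record
        { cong        = λ {p} {q} (h , eq) → x∙y⁻¹≈ε⇒x≈y _ _
            (B.trans (B.sym (f.minus-homo p q)) (B.trans (f.cong eq) (ideal-vanishes r h vanishes)))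
        ; +-homo      = f.+-homo
        ; *-homo      = f.*-homo
        ; scalar-homo = f.scalar-homo
        }
        where
        ideal-vanishes : ∀ {k} (r h : Vector A.Carrier k) → (∀ j → f (r j) B.≈ B.0#) →
          f (sum (λ j → h j A.* r j)) B.≈ B.0#
        ideal-vanishes {zero}  r h vanishes = f.0#-homo
        ideal-vanishes {suc k} r h vanishes = B.trans (f.+-homo _ _) (B.trans
          (B.+-cong
            (B.trans (f.*-homo _ _) (B.trans (B.*-congˡ (vanishes zero)) (B.zeroʳ _)))
            (ideal-vanishes (r ∘ suc) (h ∘ suc) (vanishes ∘ suc)))
          (B.+-identityʳ B.0#))

  module PolynomialQuotient {n k : ℕ}
    (r : Vector (CommutativeAlgebra.Carrier (Polynomials.algebra K n)) k) where

    private
      module P = Polynomials K n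
      module Poly = CommutativeAlgebra P.algebra
      module Q = CommutativeAlgebra (P.algebra /⟨ r ⟩)
    open QuotientProperties P.algebra r

    module _ {I : Set i} (g : I → Q.Carrier) where

      open Generated (P.algebra /⟨ r ⟩) g

      generated-by-variables : (∀ j → InSubalgebra (P.var j)) → ∀ p → InSubalgebra p
      generated-by-variables var∈ []            = respects ≈0 (constant K.0#)
        where
        ≈0 : Q.scalar K.0# Q.≈ Q.0#
        ≈0 = IsRingHomomorphism.0#-homo Q.scalar-isRingHomomorphism
      generated-by-variables var∈ ((k , m) ∷ p) =
        sum (respects (≈⇒∼ eq) (product (constant k) (monomial∈ m))) (generated-by-variables var∈ p)
        where
        eq : P.constant k Poly.* P.[ m ] Poly.≈ (k , m) ∷ []
        eq = P.pointwise λ t → K.+-congʳ (K.*-cong (K.*-identityʳ k)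
          (K.reflexive (≡.cong (λ m → P.monomial-coefficient m t) (Vec.zipWith-identityˡ ℕ.+-identityˡ m))))

        monomial∈ : ∀ m → InSubalgebra P.[ m ]
        monomial∈ = multiIndex-induction (InSubalgebra ∘ P.[_])
          (respects (IsRingHomomorphism.1#-homo Q.scalar-isRingHomomorphism) (constant K.1#))
          λ j {m} m∈ → respects (≈⇒∼ {P.var j Poly.* P.[ m ]} {P.[ _ ]}
              (P.pointwise λ t → K.+-congʳ (K.*-congʳ (K.*-identityˡ K.1#))))
            (product (var∈ j) m∈)

  -- The quadratic relation and normal forms linear in z.

  module _ (A : CommutativeAlgebra K c ℓ) where

    open CommutativeAlgebra A hiding (zero)
    open AbelianGroupProperties +-abelianGroup using (//-rightDividesˡ)
    open SetoidReasoning setoid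
    open SemiringSolver commutativeSemiring using (solve; _:+_; _:*_; _:=_)

    -- Once z is written both as u + x and as v + y, with u = z - x and v = z - y, no subtraction
    -- remains and this is an identity of commutative semirings.
    quadratic-expansion : ∀ x y z → (z - x) * (z - y) + (x * z + y * z) ≈ z * z + x * y
    quadratic-expansion x y z = begin
      u * v + (x * z + y * z)
        ≈⟨ +-congˡ (+-cong (*-congˡ z≈v+y) (*-congˡ z≈u+x)) ⟩
      u * v + (x * (v + y) + y * (u + x))
        ≈⟨ solve 4 (λ u v x y → u :* v :+ (x :* (v :+ y) :+ y :* (u :+ x)) :=
             (u :+ x) :* (v :+ y) :+ x :* y) refl u v x y ⟩
      (u + x) * (v + y) + x * y
        ≈⟨ +-congʳ (*-cong z≈u+x z≈v+y) ⟨
      z * z + x * y ∎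
      where
      u v : Carrier
      u = z - x
      v = z - y
      z≈u+x : z ≈ u + x
      z≈u+x = sym (//-rightDividesˡ x z)
      z≈v+y : z ≈ v + y
      z≈v+y = sym (//-rightDividesˡ y z)

    quadratic-vanishes⇒ : ∀ x y z → (z - x) * (z - y) ≈ 0# → z * z + x * y ≈ x * z + y * z
    quadratic-vanishes⇒ x y z eq =
      trans (sym (quadratic-expansion x y z)) (trans (+-congʳ eq) (+-identityˡ _))

    -- This direction serves the Minkowski ring, where the subtraction-free form compares intervals
    -- with their unions and intersections; the converse serves the presented algebra, where it
    -- rewrites z².
    quadratic-vanishes⇐ : ∀ x y z → z * z + x * y ≈ x * z + y * z → (z - x) * (z - y) ≈ 0#
    quadratic-vanishes⇐ x y z eq = identityˡ-unique _ _ (trans (quadratic-expansion x y z) eq)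
      where open AbelianGroupProperties +-abelianGroup using (identityˡ-unique)

    module LinearNormalForm (g : Fin 3 → Carrier) where

      private
        x y z : Carrier
        x = g 0F
        y = g 1F
        z = g 2F
        module P = Polynomials K 2
        module Poly = CommutativeAlgebra P.algebra

      open Evaluation A
      private module e = IsAlgebraHomomorphism (eval-isHomomorphism (g ∘ inject₁))

      -- Products stay linear in z because z² = -xy + (x + y)z. The parts p₀ and p₁ are polynomials
      -- in two variables rather than mere elements of the algebra, since the injectivity argument
      -- sums over their lists of coefficients.
      normalForm : ((z - x) * (z - y) ≈ 0#) → ∀ {q} → Generated.InSubalgebra A g q →
                   ∃₂ λ p₀ p₁ → q ≈ eval (g ∘ inject₁) p₀ + eval (g ∘ inject₁) p₁ * z
      normalForm relation = reduce
        where
        open Generated A g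

        embed : ∀ p {q} → eval (g ∘ inject₁) p ≈ q → q ≈ eval (g ∘ inject₁) p + eval (g ∘ inject₁) [] * z
        embed p eq = sym (trans (+-cong eq (zeroˡ z)) (+-identityʳ _))

        w : Carrier
        w = - (x * y)

        z²≈ : z * z ≈ w + (x + y) * z
        z²≈ = begin
          z * z                    ≈⟨ //-rightDividesʳ (x * y) (z * z) ⟨
          (z * z + x * y) - x * y  ≈⟨ +-congʳ (quadratic-vanishes⇒ x y z relation) ⟩
          (x * z + y * z) - x * y  ≈⟨ +-comm _ _ ⟩
          w + (x * z + y * z)      ≈⟨ +-congˡ (distribʳ z x y) ⟨
          w + (x + y) * z ∎
          where open AbelianGroupProperties +-abelianGroup using (//-rightDividesʳ)

        X Y : Poly.Carrier
        X = P.var 0F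
        Y = P.var 1F

        reduce : ∀ {q} → InSubalgebra q → ∃₂ λ p₀ p₁ → q ≈ eval (g ∘ inject₁) p₀ + eval (g ∘ inject₁) p₁ * z
        reduce (generator 0F)     = X , [] , embed X (eval-var (g ∘ inject₁) 0F)
        reduce (generator 1F)     = Y , [] , embed Y (eval-var (g ∘ inject₁) 1F)
        reduce (generator 2F)     = [] , Poly.1# ,
          sym (trans (+-identityˡ _) (trans (*-congʳ e.1#-homo) (*-identityˡ z)))
        reduce (constant k)       = Poly.scalar k , [] , embed (Poly.scalar k) (e.scalar-homo k)
        reduce (respects p≈q p∈)  = let p₀ , p₁ , eq = reduce p∈ in p₀ , p₁ , trans (sym p≈q) eq
        reduce (sum p∈ q∈) with reduce p∈ | reduce q∈
        ... | p₀ , p₁ , p≈ | q₀ , q₁ , q≈ = p₀ Poly.+ q₀ , p₁ Poly.+ q₁ , (begin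
          _ ≈⟨ +-cong p≈ q≈ ⟩
          _ ≈⟨ solve 5 (λ a b c d z → (a :+ b :* z) :+ (c :+ d :* z) := (a :+ c) :+ (b :+ d) :* z)
                 refl _ _ _ _ z ⟩
          _ ≈⟨ +-cong (e.+-homo p₀ q₀) (*-congʳ (e.+-homo p₁ q₁)) ⟨
          _ ∎)
        reduce (product p∈ q∈) with reduce p∈ | reduce q∈
        ... | p₀ , p₁ , p≈ | q₀ , q₁ , q≈ = r₀ , r₁ , (begin
          _ ≈⟨ *-cong p≈ q≈ ⟩
          (a₀ + a₁ * z) * (b₀ + b₁ * z)
            ≈⟨ solve 5 (λ a₀ a₁ b₀ b₁ z → (a₀ :+ a₁ :* z) :* (b₀ :+ b₁ :* z) :=
                 (a₀ :* b₀ :+ (a₀ :* b₁ :+ a₁ :* b₀) :* z) :+ (a₁ :* b₁) :* (z :* z)) refl a₀ a₁ b₀ b₁ z ⟩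
          (a₀ * b₀ + (a₀ * b₁ + a₁ * b₀) * z) + (a₁ * b₁) * (z * z)
            ≈⟨ +-congˡ (*-congˡ z²≈) ⟩
          (a₀ * b₀ + (a₀ * b₁ + a₁ * b₀) * z) + (a₁ * b₁) * (w + (x + y) * z)
            ≈⟨ solve 7 (λ a₀ a₁ b₀ b₁ z w s → (a₀ :* b₀ :+ (a₀ :* b₁ :+ a₁ :* b₀) :* z) :+ (a₁ :* b₁) :* (w :+ s :* z) :=
                 (a₀ :* b₀ :+ (a₁ :* b₁) :* w) :+ ((a₀ :* b₁ :+ a₁ :* b₀) :+ (a₁ :* b₁) :* s) :* z)
                 refl a₀ a₁ b₀ b₁ z w (x + y) ⟩
          (a₀ * b₀ + (a₁ * b₁) * w) + ((a₀ * b₁ + a₁ * b₀) + (a₁ * b₁) * (x + y)) * z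
            ≈⟨ +-cong r₀≈ (*-congʳ r₁≈) ⟨
          eval (g ∘ inject₁) r₀ + eval (g ∘ inject₁) r₁ * z ∎)
          where
          a₀ a₁ b₀ b₁ : Carrier
          a₀ = eval (g ∘ inject₁) p₀
          a₁ = eval (g ∘ inject₁) p₁
          b₀ = eval (g ∘ inject₁) q₀
          b₁ = eval (g ∘ inject₁) q₁
          -- The coefficients of 1 and z in (p₀ + p₁ z)(q₀ + q₁ z) once z² has been replaced.
          r₀ r₁ : Poly.Carrier
          r₀ = p₀ Poly.* q₀ Poly.+ (p₁ Poly.* q₁) Poly.* (Poly.- (X Poly.* Y))
          r₁ = (p₀ Poly.* q₁ Poly.+ p₁ Poly.* q₀) Poly.+ (p₁ Poly.* q₁) Poly.* (X Poly.+ Y)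
          r₀≈ : eval (g ∘ inject₁) r₀ ≈ a₀ * b₀ + (a₁ * b₁) * w
          r₀≈ = trans (e.+-homo (p₀ Poly.* q₀) _) (+-cong (e.*-homo p₀ q₀)
            (trans (e.*-homo (p₁ Poly.* q₁) _) (*-cong (e.*-homo p₁ q₁)
              (trans (e.-‿homo (X Poly.* Y)) (-‿cong (trans (e.*-homo X Y)
                (*-cong (eval-var (g ∘ inject₁) 0F) (eval-var (g ∘ inject₁) 1F))))))))
          r₁≈ : eval (g ∘ inject₁) r₁ ≈ (a₀ * b₁ + a₁ * b₀) + (a₁ * b₁) * (x + y)
          r₁≈ = trans (e.+-homo (p₀ Poly.* q₁ Poly.+ p₁ Poly.* q₀) _) (+-cong
            (trans (e.+-homo (p₀ Poly.* q₁) _) (+-cong (e.*-homo p₀ q₁) (e.*-homo p₁ q₀)))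
            (trans (e.*-homo (p₁ Poly.* q₁) _) (*-cong (e.*-homo p₁ q₁)
              (trans (e.+-homo X Y) (+-cong (eval-var (g ∘ inject₁) 0F) (eval-var (g ∘ inject₁) 1F))))))

-- Finite sums of indicators of intervals.

module IntervalSums (ℝ : CompleteOrderedField) where

  open import Data.List.Base using ([]; _∷_)
  open import Data.List.Relation.Unary.All using ([]; _∷_)
  open CompleteOrderedField ℝ hiding (zero)
  open Reals ℝ
  open DecTotalOrderProperties decTotalOrder using (<-compare; <⇒≱; ≰⇒≥)
  open Indicator ℂ
  open LinearCombinations (baseAlgebra {ℂ}) public using () renaming (combine to sumℂ)
  open LinearCombinations (baseAlgebra {ℂ}) using (combine-+; combine-cong-All; combine-zero)
  private module ℂ = CommutativeRing ℂ

  -- An endpoint `e` lies in the window from `s` to `u` only if it equals `t`. For s < t < u, the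
  -- indicator of an interval with two such endpoints takes at `s` and `u` its one-sided limits at
  -- `t`.
  data Separated (s t u e : Carrier) : Set where
    below : ¬ s ≤ e → Separated s t u e
    equal : e ≈ t   → Separated s t u e
    above : ¬ e ≤ u → Separated s t u e

  narrow : ∀ {s s′ t u u′ e} → s ≤ s′ → u′ ≤ u → Separated s t u e → Separated s′ t u′ e
  narrow s≤s′ u′≤u (below s≰e) = below (λ s′≤e → s≰e (≤-trans s≤s′ s′≤e))
  narrow s≤s′ u′≤u (equal e≈t)    = equal e≈t
  narrow s≤s′ u′≤u (above e≰u) = above (λ e≤u′ → e≰u (≤-trans e≤u′ u′≤u))

  1≰0 : ¬ 1# ≤ 0#
  1≰0 1≤0 = 0≉1 (antisym 0≤1 1≤0)

  -- The window shrinks for one endpoint at a time, its new edge being a midpoint; moving edges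
  -- inwards keeps the endpoints already treated separated.
  isolate : ∀ t E → ∃₂ λ s u → ¬ t ≤ s × ¬ u ≤ t × All (Separated s t u) E
  isolate t []      = t - 1# , t + 1# ,
    (λ t≤t-1 → 1≰0 (+-cancelˡ-≤ t (≤-respʳ-≈ (sym (+-identityʳ t))
      (≤-respʳ-≈ ([x-y]+y≈x t 1#) (+-monoˡ-≤ 1# t≤t-1))))) ,
    (λ t+1≤t → 1≰0 (+-cancelˡ-≤ t (≤-respʳ-≈ (sym (+-identityʳ t)) t+1≤t))) , []
  isolate t (e ∷ E) with isolate t E | <-compare e t
  ... | s , u , t≰s , u≰t , separated | tri≈ _ e≈t _ = s , u , t≰s , u≰t , equal e≈t ∷ separated
  ... | s , u , t≰s , u≰t , separated | tri< e<t _ _ with total s e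
  ...   | inj₁ s≤e = let m , m≰e , t≰m = between (<⇒≱ e<t) in m , u , t≰m , u≰t ,
    below m≰e ∷ All.map (narrow (≤-trans s≤e (≰⇒≥ m≰e)) ≤-refl) separated
  -- Even here the edge moves: `e` may equal `s` and must end up strictly outside the window.
  ...   | inj₂ e≤s = let m , m≰s , t≰m = between t≰s in m , u , t≰m , u≰t ,
    below (λ m≤e → m≰s (≤-trans m≤e e≤s)) ∷ All.map (narrow (≰⇒≥ m≰s) ≤-refl) separated
  isolate t (e ∷ E) | s , u , t≰s , u≰t , separated | tri> _ _ t<e with total u e
  ...   | inj₁ u≤e = let m , m≰t , u≰m = between u≰t in s , m , t≰s , m≰t ,
    above (λ e≤m → u≰m (≤-trans u≤e e≤m)) ∷ All.map (narrow ≤-refl (≰⇒≥ u≰m)) separated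
  ...   | inj₂ e≤u = let m , m≰t , e≰m = between (<⇒≱ t<e) in s , m , t≰s , m≰t ,
    above e≰m ∷ All.map (narrow ≤-refl (≤-trans (≰⇒≥ e≰m) e≤u)) separated

  _∈[_,_]? : ∀ t x y → Dec (x ≤ t × t ≤ y)
  t ∈[ x , y ]? = (x ≤? t) ×-dec (t ≤? y)

  -- The value of 𝟙[x,y] just above t minus the one just below t is 𝟙(x = t) − 𝟙(y = t),
  -- stated without subtraction.
  jump : ∀ {s t u x y} → ¬ t ≤ s → ¬ u ≤ t → x ≤ y → Separated s t u x → Separated s t u y →
    𝟙 (u ∈[ x , y ]?) ℂ.+ 𝟙 (y ≟ t) ℂ.≈ 𝟙 (s ∈[ x , y ]?) ℂ.+ 𝟙 (x ≟ t)
  jump {s} {t} {u} {x} {y} t≰s u≰t x≤y = cases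
    where
    s≤t : s ≤ t
    s≤t = ≰⇒≥ t≰s
    t≤u : t ≤ u
    t≤u = ≰⇒≥ u≰t

    values : {P Q R S : Set} (P? : Dec P) (Q? : Dec Q) (R? : Dec R) (S? : Dec S) {v w v′ w′ : ℂ.Carrier} →
      𝟙 P? ℂ.≈ v → 𝟙 Q? ℂ.≈ w → 𝟙 R? ℂ.≈ v′ → 𝟙 S? ℂ.≈ w′ → v ℂ.+ w ℂ.≈ v′ ℂ.+ w′ →
      𝟙 P? ℂ.+ 𝟙 Q? ℂ.≈ 𝟙 R? ℂ.+ 𝟙 S?
    values _ _ _ _ p q r s eq = ℂ.trans (ℂ.+-cong p q) (ℂ.trans eq (ℂ.sym (ℂ.+-cong r s)))

    by : {v w v′ w′ : ℂ.Carrier} →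
      𝟙 (u ∈[ x , y ]?) ℂ.≈ v → 𝟙 (y ≟ t) ℂ.≈ w → 𝟙 (s ∈[ x , y ]?) ℂ.≈ v′ → 𝟙 (x ≟ t) ℂ.≈ w′ →
      v ℂ.+ w ℂ.≈ v′ ℂ.+ w′ → 𝟙 (u ∈[ x , y ]?) ℂ.+ 𝟙 (y ≟ t) ℂ.≈ 𝟙 (s ∈[ x , y ]?) ℂ.+ 𝟙 (x ≟ t)
    by = values (u ∈[ x , y ]?) (y ≟ t) (s ∈[ x , y ]?) (x ≟ t)

    below≉ : ∀ {e} → ¬ s ≤ e → ¬ e ≈ t
    below≉ s≰e e≈t = s≰e (≤-respʳ-≈ (sym e≈t) s≤t)
    above≉ : ∀ {e} → ¬ e ≤ u → ¬ e ≈ t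
    above≉ e≰u e≈t = e≰u (≤-respˡ-≈ (sym e≈t) t≤u)

    cases : Separated s t u x → Separated s t u y →
      𝟙 (u ∈[ x , y ]?) ℂ.+ 𝟙 (y ≟ t) ℂ.≈ 𝟙 (s ∈[ x , y ]?) ℂ.+ 𝟙 (x ≟ t)
    cases (below s≰x) (below s≰y) = by
      (𝟙-false (λ (_ , u≤y) → s≰y (≤-trans s≤t (≤-trans t≤u u≤y))) (u ∈[ x , y ]?))
      (𝟙-false (below≉ s≰y) (y ≟ t)) (𝟙-false (s≰y ∘ proj₂) (s ∈[ x , y ]?)) (𝟙-false (below≉ s≰x) (x ≟ t)) ℂ.refl
    cases (below s≰x) (equal y≈t) = by
      (𝟙-false (λ (_ , u≤y) → u≰t (≤-respʳ-≈ y≈t u≤y)) (u ∈[ x , y ]?))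
      (𝟙-true y≈t (y ≟ t)) (𝟙-true (≰⇒≥ s≰x , ≤-respʳ-≈ (sym y≈t) s≤t) (s ∈[ x , y ]?))
      (𝟙-false (below≉ s≰x) (x ≟ t)) (ℂ.+-comm ℂ.0# ℂ.1#)
    cases (below s≰x) (above y≰u) = by
      (𝟙-true (≤-trans (≰⇒≥ s≰x) (≤-trans s≤t t≤u) , ≰⇒≥ y≰u) (u ∈[ x , y ]?))
      (𝟙-false (above≉ y≰u) (y ≟ t))
      (𝟙-true (≰⇒≥ s≰x , ≤-trans s≤t (≤-trans t≤u (≰⇒≥ y≰u))) (s ∈[ x , y ]?))
      (𝟙-false (below≉ s≰x) (x ≟ t)) ℂ.refl
    cases (equal x≈t) (below s≰y) = contradiction (≤-trans s≤t (≤-respˡ-≈ x≈t x≤y)) s≰y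
    cases (equal x≈t) (equal y≈t) = by
      (𝟙-false (λ (_ , u≤y) → u≰t (≤-respʳ-≈ y≈t u≤y)) (u ∈[ x , y ]?))
      (𝟙-true y≈t (y ≟ t)) (𝟙-false (λ (x≤s , _) → t≰s (≤-respˡ-≈ x≈t x≤s)) (s ∈[ x , y ]?))
      (𝟙-true x≈t (x ≟ t)) ℂ.refl
    cases (equal x≈t) (above y≰u) = by
      (𝟙-true (≤-respˡ-≈ (sym x≈t) t≤u , ≰⇒≥ y≰u) (u ∈[ x , y ]?))
      (𝟙-false (above≉ y≰u) (y ≟ t)) (𝟙-false (λ (x≤s , _) → t≰s (≤-respˡ-≈ x≈t x≤s)) (s ∈[ x , y ]?))
      (𝟙-true x≈t (x ≟ t)) (ℂ.+-comm ℂ.1# ℂ.0#)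
    cases (above x≰u) (below s≰y) =
      contradiction (≤-trans s≤t (≤-trans t≤u (≤-trans (≰⇒≥ x≰u) x≤y))) s≰y
    cases (above x≰u) (equal y≈t) = contradiction (≤-trans (≤-respʳ-≈ y≈t x≤y) t≤u) x≰u
    cases (above x≰u) (above y≰u) = by
      (𝟙-false (x≰u ∘ proj₁) (u ∈[ x , y ]?)) (𝟙-false (above≉ y≰u) (y ≟ t))
      (𝟙-false (λ (x≤s , _) → x≰u (≤-trans x≤s (≤-trans s≤t t≤u))) (s ∈[ x , y ]?))
      (𝟙-false (above≉ x≰u) (x ≟ t)) ℂ.refl

  module _ {X : Set} where

    -- Sum `jump` over all intervals. The combination vanishes at `u` and at `s`, on the two sides
    -- of `t`, so only the endpoints at `t` remain. Degenerate intervals count on both sides.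
    endpoints-balance : (lo hi : X → Carrier) → (∀ x → lo x ≤ hi x) → ∀ p →
      (∀ t → sumℂ (λ x → 𝟙 (t ∈[ lo x , hi x ]?)) p ℂ.≈ ℂ.0#) →
      ∀ t → sumℂ (λ x → 𝟙 (hi x ≟ t)) p ℂ.≈ sumℂ (λ x → 𝟙 (lo x ≟ t)) p
    endpoints-balance lo hi lo≤hi p vanishes t
      with isolate t (List.map (lo ∘ proj₂) p ++ List.map (hi ∘ proj₂) p)
    ... | s , u , t≰s , u≰t , separated = begin
      sumℂ (λ x → 𝟙 (hi x ≟ t)) p
        ≈⟨ ℂ.+-identityˡ _ ⟨
      ℂ.0# ℂ.+ sumℂ (λ x → 𝟙 (hi x ≟ t)) p
        ≈⟨ ℂ.+-congʳ (vanishes u) ⟨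
      sumℂ (λ x → 𝟙 (u ∈[ lo x , hi x ]?)) p ℂ.+ sumℂ (λ x → 𝟙 (hi x ≟ t)) p
        ≈⟨ combine-+ _ _ p ⟨
      sumℂ (λ x → 𝟙 (u ∈[ lo x , hi x ]?) ℂ.+ 𝟙 (hi x ≟ t)) p
        ≈⟨ combine-cong-All (All.zipWith (λ {(_ , x)} (sep-lo , sep-hi) →
             jump t≰s u≰t (lo≤hi x) sep-lo sep-hi)
             (All.map⁻ (All.++⁻ˡ (List.map (lo ∘ proj₂) p) separated) ,
              All.map⁻ (All.++⁻ʳ (List.map (lo ∘ proj₂) p) separated))) ⟩
      sumℂ (λ x → 𝟙 (s ∈[ lo x , hi x ]?) ℂ.+ 𝟙 (lo x ≟ t)) p
        ≈⟨ combine-+ _ _ p ⟩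
      sumℂ (λ x → 𝟙 (s ∈[ lo x , hi x ]?)) p ℂ.+ sumℂ (λ x → 𝟙 (lo x ≟ t)) p
        ≈⟨ ℂ.+-congʳ (vanishes s) ⟩
      ℂ.0# ℂ.+ sumℂ (λ x → 𝟙 (lo x ≟ t)) p
        ≈⟨ ℂ.+-identityˡ _ ⟩
      sumℂ (λ x → 𝟙 (lo x ≟ t)) p ∎
      where open SetoidReasoning ℂ.setoid

    -- Passing from t to t + L loses a point of the finite support.
    periodic-vanishes : (f : X → Carrier) (L : Carrier) → ¬ L ≤ 0# → ∀ p →
      (∀ t → sumℂ (λ x → 𝟙 (f x ≟ t)) p ℂ.≈ sumℂ (λ x → 𝟙 (f x ≟ t + L)) p) →
      ∀ t → sumℂ (λ x → 𝟙 (f x ≟ t)) p ℂ.≈ ℂ.0#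
    periodic-vanishes f L L≰0 p period t = go p (<-wellFounded _) t (All.tabulate λ x∈p _ → x∈p)
      where
      value : ℂ.Carrier × X → Carrier
      value = f ∘ proj₂

      go : ∀ E → Acc ℕ._<_ (length E) → ∀ t → All (λ x → t ≤ value x → x ∈ E) p →
        sumℂ (λ x → 𝟙 (f x ≟ t)) p ℂ.≈ ℂ.0#
      go E (acc rec) t listed with Any.any? (λ x → value x ≟ t) E
      ... | yes hit = ℂ.trans (period t) (go E′ (rec shorter) (t + L) (All.map relist listed))
        where
        E′ : List (ℂ.Carrier × X)
        E′ = filter (λ x → t + L ≤? value x) E

        shorter : length E′ ℕ.< length E
        shorter = filter-notAll (λ x → t + L ≤? value x) E (Any.map (λ fx≈t t+L≤fx →
          L≰0 (+-cancelˡ-≤ t (≤-respʳ-≈ (trans fx≈t (sym (+-identityʳ t))) t+L≤fx))) hit)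

        t≤t+L : t ≤ t + L
        t≤t+L = ≤-respˡ-≈ (+-identityʳ t) (+-monoʳ-≤ t (≰⇒≥ L≰0))

        relist : ∀ {x} → (t ≤ value x → x ∈ E) → t + L ≤ value x → x ∈ E′
        relist x∈E t+L≤fx =
          ∈-filter⁺ (λ x → t + L ≤? value x) (x∈E (≤-trans t≤t+L t+L≤fx)) t+L≤fx
      ... | no miss = ℂ.trans
        (combine-cong-All (All.map (λ {(_ , x)} x∈E →
          𝟙-false (λ fx≈t → miss (Any.map (λ { ≡.refl → fx≈t }) (x∈E (≤-reflexive (sym fx≈t))))) (f x ≟ t)) listed))
        (combine-zero p)

-- Points and intervals in the ring of polyhedral functions.

module IntervalIndicators (ℝ : CompleteOrderedField) where

  open import Data.List.Base using ([]; _∷_)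
  open CompleteOrderedField ℝ hiding (zero)
  open Reals ℝ
  open Polyhedra ℝ
  open Indicator ℂ
  open IntervalSums ℝ using (sumℂ; _∈[_,_]?)
  open DecTotalOrderProperties decTotalOrder using (≰⇒≥)
  module ℂ = CommutativeRing ℂ
  module M = CommutativeAlgebra M[𝓟]
  open Exp M.semiring using (_^_)
  open PolyhedralFunctions using (pointwise; at; evaluate; [_])
  open LinearCombinations M[𝓟] using (combine)
  private module Extend = Combinations ℂ polyhedra

  infix 4 _≐ₚ_
  _≐ₚ_ : Polyhedron → Polyhedron → Set
  P ≐ₚ Q = Polyhedron.points P ≐ Polyhedron.points Q

  []-cong : ∀ {P Q} → P ≐ₚ Q → [ P ] M.≈ [ Q ]
  []-cong {P} {Q} (P⊆Q , Q⊆P) = pointwise λ t →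
    ℂ.+-congʳ (ℂ.*-congˡ {ℂ.1#} (𝟙-cong (mk⇔ P⊆Q Q⊆P) (t ∈? P) (t ∈? Q)))

  []-* : ∀ P Q → [ P ] M.* [ Q ] M.≈ [ P ⊕ Q ]
  []-* P Q = pointwise λ t → ℂ.+-congʳ (ℂ.*-congʳ {indicator (P ⊕ Q) t} (ℂ.*-identityˡ ℂ.1#))

  interval-cong : ∀ {x y x′ y′} {x≤y : x ≤ y} {x′≤y′ : x′ ≤ y′} → x ≈ x′ → y ≈ y′ →
    interval x y x≤y ≐ₚ interval x′ y′ x′≤y′
  interval-cong x≈x′ y≈y′ =
    (λ (x≤t , t≤y) → ≤-respˡ-≈ x≈x′ x≤t , ≤-respʳ-≈ y≈y′ t≤y) ,
    (λ (x≤t , t≤y) → ≤-respˡ-≈ (sym x≈x′) x≤t , ≤-respʳ-≈ (sym y≈y′) t≤y)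

  singleton≐interval : ∀ x → singleton x ≐ₚ interval x x ≤-refl
  singleton≐interval x =
    (λ t≈x → ≤-reflexive (sym t≈x) , ≤-reflexive t≈x) , (λ (x≤t , t≤x) → antisym t≤x x≤t)

  interval-⊕ : ∀ {x y x′ y′} (x≤y : x ≤ y) (x′≤y′ : x′ ≤ y′) →
    interval x y x≤y ⊕ interval x′ y′ x′≤y′ ≐ₚ interval (x + x′) (y + y′) (+-mono-≤ x≤y x′≤y′)
  interval-⊕ {x} {y} {x′} {y′} x≤y x′≤y′ =
    (λ t∈ → let l , u = sum⇒bounds (interval x y x≤y) (interval x′ y′ x′≤y′) t∈ in
      MaybeAll.drop-just l , MaybeAll.drop-just u) ,
    (λ (l , u) → bounds⇒sum (interval x y x≤y) (interval x′ y′ x′≤y′) (just l) (just u))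

  -- Points are degenerate intervals here, so that `interval-*` is the one product rule for points
  -- and intervals alike.
  point : Carrier → M.Carrier
  point x = [ interval x x ≤-refl ]

  interval-* : ∀ {x y x′ y′ x″ y″} (x≤y : x ≤ y) (x′≤y′ : x′ ≤ y′) (x″≤y″ : x″ ≤ y″) →
    x + x′ ≈ x″ → y + y′ ≈ y″ →
    [ interval x y x≤y ] M.* [ interval x′ y′ x′≤y′ ] M.≈ [ interval x″ y″ x″≤y″ ]
  interval-* {x} {y} {x′} {y′} {x″} {y″} x≤y x′≤y′ x″≤y″ eq eq′ = M.trans
    {[ I ] M.* [ I′ ]} {[ I ⊕ I′ ]} {[ interval x″ y″ x″≤y″ ]} ([]-* I I′)
    ([]-cong {I ⊕ I′} {interval x″ y″ x″≤y″}
      ((λ t∈ → proj₁ change (proj₁ (interval-⊕ x≤y x′≤y′) t∈)) ,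
       (λ t∈ → proj₂ (interval-⊕ x≤y x′≤y′) (proj₂ change t∈))))
    where
    I I′ : Polyhedron
    I = interval x y x≤y
    I′ = interval x′ y′ x′≤y′
    change : interval (x + x′) (y + y′) (+-mono-≤ x≤y x′≤y′) ≐ₚ interval x″ y″ x″≤y″
    change = interval-cong {x≤y = +-mono-≤ x≤y x′≤y′} {x″≤y″} eq eq′

  point-cong : ∀ {x y} → x ≈ y → point x M.≈ point y
  point-cong {x} {y} x≈y = []-cong {interval x x ≤-refl} {interval y y ≤-refl}
    (interval-cong {x≤y = ≤-refl} {≤-refl} x≈y x≈y)

  singleton≈point : ∀ x → [ singleton x ] M.≈ point x
  singleton≈point x = []-cong {singleton x} {interval x x ≤-refl} (singleton≐interval x)

  point-* : ∀ x y → point x M.* point y M.≈ point (x + y)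
  point-* x y = interval-* ≤-refl ≤-refl ≤-refl refl refl

  1≈point : M.1# M.≈ point 0#
  1≈point = singleton≈point 0#

  point-^ : ∀ x n → point x ^ n M.≈ point (n · x)
  point-^ x zero    = 1≈point
  point-^ x (suc n) = M.trans {point x ^ suc n} {point x M.* point (n · x)} {point (suc n · x)}
    (M.*-congˡ {point x} {point x ^ n} {point (n · x)} (point-^ x n)) (point-* x (n · x))

  -- Multiplying by `scalar k` replaces each `P` by `singleton 0# ⊕ P`, so the value is k times a
  -- sum that depends on `p` and `t` only. The case k = 1, where the unit law holds, identifies that
  -- sum.
  evaluate-scalar : ∀ k p t → evaluate (M.scalar k M.* p) t ℂ.≈ k ℂ.* evaluate p t
  evaluate-scalar k p t = ℂ.trans (unfold k) (ℂ.*-congˡ {k} (ℂ.trans (ℂ.sym (ℂ.trans (unfold ℂ.1#)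
    (ℂ.*-identityˡ _))) (at (M.*-identityˡ p) t)))
    where
    translated : ℂ.Carrier
    translated = Extend.extend (λ P → indicator (singleton 0# ⊕ P) t) p
    unfold : ∀ k → evaluate (M.scalar k M.* p) t ℂ.≈ k ℂ.* translated
    unfold k = ℂ.trans (Extend.extend-multiplied _ (M.scalar k) p) (ℂ.+-identityʳ _)

  evaluate-combine : {X : Set} (f : X → M.Carrier) → ∀ p t →
    evaluate (combine f p) t ℂ.≈ sumℂ (λ x → evaluate (f x) t) p
  evaluate-combine f []            t = ℂ.refl
  evaluate-combine f ((k , x) ∷ p) t = ℂ.trans (Extend.extend-++ _ (M.scalar k M.* f x) (combine f p))
    (ℂ.+-cong (evaluate-scalar k (f x) t) (evaluate-combine f p t))

  evaluate-interval : ∀ {x y} (x≤y : x ≤ y) t → evaluate [ interval x y x≤y ] t ℂ.≈ 𝟙 (t ∈[ x , y ]?)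
  evaluate-interval {x} {y} x≤y t = ℂ.trans (ℂ.+-identityʳ _) (ℂ.trans (ℂ.*-identityˡ _)
    (𝟙-cong (mk⇔ id id) (t ∈? interval x y x≤y) (t ∈[ x , y ]?)))

  -- [x,z] ∪ [y,w] = [x,w] and [x,z] ∩ [y,w] = [y,z].
  interval-modular : ∀ {x y z w} (x≤y : x ≤ y) (y≤z : y ≤ z) (z≤w : z ≤ w) →
    [ interval x w (≤-trans x≤y (≤-trans y≤z z≤w)) ] M.+ [ interval y z y≤z ] M.≈
    [ interval x z (≤-trans x≤y y≤z) ] M.+ [ interval y w (≤-trans y≤z z≤w) ]
  interval-modular {x} {y} {z} {w} x≤y y≤z z≤w = pointwise λ t → ℂ.trans (value (≤-trans x≤y (≤-trans y≤z z≤w)) y≤z t)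
    (ℂ.trans (modular t (x ≤? t) (y ≤? t) (t ≤? z) (t ≤? w)) (ℂ.sym (value (≤-trans x≤y y≤z) (≤-trans y≤z z≤w) t)))
    where
    value : ∀ {x y x′ y′} (x≤y : x ≤ y) (x′≤y′ : x′ ≤ y′) t →
      evaluate ([ interval x y x≤y ] M.+ [ interval x′ y′ x′≤y′ ]) t ℂ.≈ 𝟙 (t ∈[ x , y ]?) ℂ.+ 𝟙 (t ∈[ x′ , y′ ]?)
    value x≤y x′≤y′ t = ℂ.+-cong (ℂ.trans (ℂ.sym (ℂ.+-identityʳ _)) (evaluate-interval x≤y t)) (evaluate-interval x′≤y′ t)

    modular : ∀ t (x≤t? : Dec (x ≤ t)) (y≤t? : Dec (y ≤ t)) (t≤z? : Dec (t ≤ z)) (t≤w? : Dec (t ≤ w)) →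
      𝟙 (x≤t? ×-dec t≤w?) ℂ.+ 𝟙 (y≤t? ×-dec t≤z?) ℂ.≈ 𝟙 (x≤t? ×-dec t≤z?) ℂ.+ 𝟙 (y≤t? ×-dec t≤w?)
    modular t (yes _)   (yes _)   (yes _)   (yes _)   = ℂ.refl
    modular t (yes _)   (yes _)   (no _)    (yes _)   = ℂ.+-comm ℂ.1# ℂ.0#
    modular t (yes _)   (yes _)   (no _)    (no _)    = ℂ.refl
    modular t (yes _)   (no _)    (yes _)   (yes _)   = ℂ.refl
    modular t (yes _)   (no y≰t)  (no t≰z)  _         = contradiction (≤-trans y≤z (≰⇒≥ t≰z)) y≰t
    modular t (no x≰t)  (yes y≤t) _         _         = contradiction (≤-trans x≤y y≤t) x≰t
    modular t (no _)    (no _)    (yes _)   (yes _)   = ℂ.refl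
    modular t (no _)    (no _)    (no _)    (yes _)   = ℂ.refl
    modular t (no _)    (no _)    (no _)    (no _)    = ℂ.refl
    modular t _         _         (yes t≤z) (no t≰w)  = contradiction (≤-trans t≤z z≤w) t≰w

-- Injectivity of the map from a presented algebra.

module IntervalKernel (ℝ : CompleteOrderedField)
  (α β : CompleteOrderedField.Carrier ℝ) (α<β : CompleteOrderedField._<_ ℝ α β) where

  open import Data.List.Base using ([]; _∷_)
  open import Data.Vec.Base using ([]; _∷_)
  open CompleteOrderedField ℝ hiding (zero)
  open Reals ℝ
  open Indicator ℂ
  open IntervalSums ℝ
  open DecTotalOrderProperties decTotalOrder using (<⇒≱)
  private
    module ℂ = CommutativeRing ℂ
    module Cℂ = LinearCombinations (baseAlgebra {ℂ})
    α≤β : α ≤ β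
    α≤β = proj₁ α<β

  position : Vec ℕ 2 → Carrier
  position (k ∷ l ∷ []) = k · α + l · β

  module _ (B : CommutativeAlgebra ℂ c₁ ℓ₁) (Q : CommutativeAlgebra ℂ c₂ ℓ₂) where

    private
      module B = CommutativeAlgebra B
      module Q = CommutativeAlgebra Q
      module EB = Evaluation B
      module EQ = Evaluation Q
      module CB = LinearCombinations B
      module CQ = LinearCombinations Q

    -- The argument sees `B` only through evaluations at real numbers: their linearity, and the
    -- indicators that the products of generators evaluate to.
    module _ (b : Fin 3 → B.Carrier) (evaluate : B.Carrier → Carrier → ℂ.Carrier)
      (evaluate-cong : ∀ {p q} → p B.≈ q → ∀ t → evaluate p t ℂ.≈ evaluate q t)
      (evaluate-combine : {X : Set} (f : X → B.Carrier) → ∀ p t →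
        evaluate (CB.combine f p) t ℂ.≈ sumℂ (λ x → evaluate (f x) t) p)
      (evaluate-point : ∀ m t →
        evaluate (EB.powerProduct (b ∘ inject₁) m) t ℂ.≈ 𝟙 (t ∈[ position m , position m ]?))
      (evaluate-interval : ∀ m t → evaluate (EB.powerProduct (b ∘ inject₁) m B.* b 2F) t ℂ.≈
        𝟙 (t ∈[ position m + α , position m + β ]?))
      (g : Fin 3 → Q.Carrier) (relation : (g 2F Q.- g 0F) Q.* (g 2F Q.- g 1F) Q.≈ Q.0#)
      (collisions : ∀ m m′ → position m ≈ position m′ →
        EQ.powerProduct (g ∘ inject₁) m Q.≈ EQ.powerProduct (g ∘ inject₁) m′)
      (generates : ∀ q → Generated.InSubalgebra Q g q)
      {ψ : Q.Carrier → B.Carrier} (ψ-hom : IsAlgebraHomomorphism Q B ψ)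
      (ψ-generator : ∀ j → ψ (g j) B.≈ b j) where

      private module ψ = IsAlgebraHomomorphism ψ-hom
      open LinearNormalForm Q g using (normalForm)

      F : List (ℂ.Carrier × Vec ℕ 2) → Q.Carrier
      F = CQ.combine (EQ.powerProduct (g ∘ inject₁))

      evaluate-ψ : {X : Set} (f : X → Q.Carrier) (lo hi : X → Carrier) →
        (∀ x t → evaluate (ψ (f x)) t ℂ.≈ 𝟙 (t ∈[ lo x , hi x ]?)) → ∀ p → ψ (CQ.combine f p) B.≈ B.0# →
        ∀ t → sumℂ (λ x → 𝟙 (t ∈[ lo x , hi x ]?)) p ℂ.≈ ℂ.0#
      evaluate-ψ f lo hi ψf p eq t = ℂ.trans (ℂ.sym (ℂ.trans (evaluate-combine (ψ ∘ f) p t)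
        (Cℂ.combine-cong (λ x → ψf x t) p))) (ℂ.trans
        (evaluate-cong (B.trans (B.sym (image-combine Q B ψ-hom f p)) eq) t)
        -- The empty combination yields the value of `B.0#`; the index type `ℕ` is arbitrary.
        (evaluate-combine {X = ℕ} (λ _ → B.0#) [] t))

      open Fibres {K = ℂ} (λ m m′ → position m ≈ position m′) (λ m m′ → position m ≟ position m′) refl sym trans

      ψ-point : ∀ m t → evaluate (ψ (EQ.powerProduct (g ∘ inject₁) m)) t ℂ.≈ 𝟙 (t ∈[ position m , position m ]?)
      ψ-point m t = ℂ.trans (evaluate-cong (image-powerProduct Q B ψ-hom (ψ-generator ∘ inject₁) m) t)
        (evaluate-point m t)

      -- Monomials are grouped by position rather than by exponents. By `collisions` their values in
      -- `Q` are constant on each group, so it is enough that the group totals vanish.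
      F-vanishes : ∀ p → (∀ t → sumℂ (λ m → 𝟙 (position m ≟ t)) p ℂ.≈ ℂ.0#) → F p Q.≈ Q.0#
      F-vanishes p vanishes = combine-vanishes Q (EQ.powerProduct (g ∘ inject₁))
        (λ {m} {m′} → collisions m m′) p (vanishes ∘ position)

      -- A degenerate interval is the indicator of a single point, so the value of `ψ (F p)` at `t`
      -- is itself the total coefficient of the monomials positioned at `t`.
      point-part : ∀ p → ψ (F p) B.≈ B.0# → F p Q.≈ Q.0#
      point-part p eq = F-vanishes p λ t → ℂ.trans
        (Cℂ.combine-cong (λ m → 𝟙-cong
          (mk⇔ (λ e → ≤-reflexive e , ≤-reflexive (sym e)) (λ (l , u) → antisym l u))
          (position m ≟ t) (t ∈[ position m , position m ]?)) p)
        (evaluate-ψ (EQ.powerProduct (g ∘ inject₁)) position position ψ-point p eq t)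

      -- Both kinds of monomial share one index type, a point having both ends at its position, so
      -- that a single balance of endpoints treats p₀ + p₁ z.
      monomial : Vec ℕ 2 ⊎ Vec ℕ 2 → Q.Carrier
      monomial (inj₁ m) = EQ.powerProduct (g ∘ inject₁) m
      monomial (inj₂ m) = EQ.powerProduct (g ∘ inject₁) m Q.* g 2F

      lo hi : Vec ℕ 2 ⊎ Vec ℕ 2 → Carrier
      lo (inj₁ m) = position m
      lo (inj₂ m) = position m + α
      hi (inj₁ m) = position m
      hi (inj₂ m) = position m + β

      lo≤hi : ∀ x → lo x ≤ hi x
      lo≤hi (inj₁ m) = ≤-refl
      lo≤hi (inj₂ m) = +-monoʳ-≤ (position m) α≤β

      ψ-monomial : ∀ x t → evaluate (ψ (monomial x)) t ℂ.≈ 𝟙 (t ∈[ lo x , hi x ]?)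
      ψ-monomial (inj₁ m)   = ψ-point m
      ψ-monomial (inj₂ m) t = ℂ.trans (evaluate-cong (B.trans (ψ.*-homo _ _)
        (B.*-cong (image-powerProduct Q B ψ-hom (ψ-generator ∘ inject₁) m) (ψ-generator 2F))) t)
        (evaluate-interval m t)

      module _ (p₀ p₁ : List (ℂ.Carrier × Vec ℕ 2)) where

        tagged : List (ℂ.Carrier × (Vec ℕ 2 ⊎ Vec ℕ 2))
        tagged = List.map (λ (k , m) → k , inj₁ m) p₀ ++ List.map (λ (k , m) → k , inj₂ m) p₁

        monomials-combine : CQ.combine monomial tagged Q.≈ F p₀ Q.+ F p₁ Q.* g 2F
        monomials-combine = Q.trans (CQ.combine-⊎ monomial p₀ p₁)
          (Q.+-congˡ (CQ.combine-*ʳ (EQ.powerProduct (g ∘ inject₁)) (g 2F) p₁))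

        -- Point monomials add the same to the totals of right ends and of left ends, so they cancel
        -- in `balance`; taken at t + β, what remains is the periodicity of the totals of p₁.
        interval-part : ψ (F p₀ Q.+ F p₁ Q.* g 2F) B.≈ B.0# → F p₁ Q.≈ Q.0#
        interval-part eq = F-vanishes p₁
          (periodic-vanishes position (β - α) β-α≰0 p₁ period)
          where
          β-α≰0 : ¬ β - α ≤ 0#
          β-α≰0 β-α≤0 = <⇒≱ α<β (≤-respˡ-≈ ([x-y]+y≈x β α) (≤-respʳ-≈ (+-identityˡ α) (+-monoˡ-≤ α β-α≤0)))

          balance : ∀ t → sumℂ (λ m → 𝟙 (position m + β ≟ t)) p₁ ℂ.≈ sumℂ (λ m → 𝟙 (position m + α ≟ t)) p₁
          balance t = ∙-cancelˡ (sumℂ (λ m → 𝟙 (position m ≟ t)) p₀) _ _ (ℂ.trans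
            (ℂ.sym (Cℂ.combine-⊎ (λ x → 𝟙 (hi x ≟ t)) p₀ p₁)) (ℂ.trans
            (endpoints-balance lo hi lo≤hi tagged
              (evaluate-ψ monomial lo hi ψ-monomial tagged
                (B.trans (ψ.cong monomials-combine) eq)) t)
            (Cℂ.combine-⊎ (λ x → 𝟙 (lo x ≟ t)) p₀ p₁)))
            where open AbelianGroupProperties ℂ.+-abelianGroup using (∙-cancelˡ)

          period : ∀ t → sumℂ (λ m → 𝟙 (position m ≟ t)) p₁ ℂ.≈ sumℂ (λ m → 𝟙 (position m ≟ t + (β - α))) p₁
          period t = ℂ.trans
            (Cℂ.combine-cong (λ m → 𝟙-cong (mk⇔ +-congʳ (+-cancelʳ β (position m) t))
              (position m ≟ t) (position m + β ≟ t + β)) p₁) (ℂ.trans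
            (balance (t + β))
            (Cℂ.combine-cong (λ m → 𝟙-cong
              (mk⇔ (λ e → +-cancelʳ α (position m) _ (trans e (sym shifted))) (λ e → trans (+-congʳ e) shifted))
              (position m + α ≟ t + β) (position m ≟ t + (β - α))) p₁))
            where
            open AbelianGroupProperties +-abelianGroup using () renaming (∙-cancelʳ to +-cancelʳ)
            shifted : (t + (β - α)) + α ≈ t + β
            shifted = trans (+-assoc t (β - α) α) (+-congˡ ([x-y]+y≈x β α))

      -- The interval part has to go first: only when p₁ z is known to be zero is ψ(q) a combination
      -- of points, to which `point-part` applies.
      kernel : ∀ q → ψ q B.≈ B.0# → q Q.≈ Q.0#
      kernel q ψq≈0 with normalForm relation (generates q)
      ... | p₀ , p₁ , q≈ = Q.trans q≈F (point-part p₀ (B.trans (ψ.cong (Q.sym q≈F)) ψq≈0))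
        where
        q≈F : q Q.≈ F p₀
        q≈F = Q.trans q≈ (Q.trans (Q.+-congˡ (Q.trans
          (Q.*-congʳ (interval-part p₀ p₁ (B.trans (ψ.cong (Q.sym q≈)) ψq≈0))) (Q.zeroˡ (g 2F))))
          (Q.+-identityʳ _))

      injective : ∀ {p q} → ψ p B.≈ ψ q → p Q.≈ q
      injective {p} {q} ψp≈ψq = Qₚ.x∙y⁻¹≈ε⇒x≈y p q (kernel (p Q.- q)
        (B.trans (ψ.minus-homo p q) (Bₚ.x≈y⇒x∙y⁻¹≈ε ψp≈ψq)))
        where
        module Qₚ = AbelianGroupProperties Q.+-abelianGroup
        module Bₚ = AbelianGroupProperties B.+-abelianGroup

-- The criterion for an algebra to present the Minkowski ring.

module IntervalPresentation (ℝ : CompleteOrderedField)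
  (α β : CompleteOrderedField.Carrier ℝ) (α<β : CompleteOrderedField._<_ ℝ α β) where

  open import Data.Vec.Base using ([]; _∷_)
  open CompleteOrderedField ℝ hiding (zero)
  open Reals ℝ
  open Polyhedra ℝ
  open Indicator ℂ
  open IntervalSums ℝ
  open IntervalIndicators ℝ
  open IntervalRing ℝ using (R; generators)
  open IntervalKernel ℝ α β α<β using (position)
  open Exp M.semiring using (_^_; ^-congˡ)
  open PolyhedralFunctions using (evaluate; [_]; at)
  private
    module EM = Evaluation M[𝓟]
    α≤β : α ≤ β
    α≤β = proj₁ α<β

  generator : Fin 3 → M.Carrier
  generator j = [ generators α β α<β j ]

  -- In subtraction-free form the relation reads [2α, 2β] + {α + β} = [2α, α + β] + [α + β, 2β]: two
  -- intervals that share one point add up to their union and that point. This is `interval-modular`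
  -- with both middle endpoints equal to α + β.
  generator-relation : (generator 2F M.- generator 0F) M.* (generator 2F M.- generator 1F) M.≈ M.0#
  generator-relation = quadratic-vanishes⇐ M[𝓟] (generator 0F) (generator 1F) (generator 2F) (begin
    generator 2F M.* generator 2F M.+ generator 0F M.* generator 1F
      ≈⟨ M.+-cong {generator 2F M.* generator 2F} {[ interval (α + α) (β + β) _ ]}
           {generator 0F M.* generator 1F} {[ interval (α + β) (α + β) ≤-refl ]}
           (interval-* α≤β α≤β (≤-trans αα≤αβ (≤-trans ≤-refl αβ≤ββ)) refl refl)
           (M.trans {generator 0F M.* generator 1F} {point α M.* point β} {point (α + β)}
             (M.*-cong {generator 0F} {point α} {generator 1F} {point β} (singleton≈point α) (singleton≈point β))
             (point-* α β)) ⟩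
    [ interval (α + α) (β + β) _ ] M.+ [ interval (α + β) (α + β) ≤-refl ]
      ≈⟨ interval-modular αα≤αβ ≤-refl αβ≤ββ ⟩
    [ interval (α + α) (α + β) _ ] M.+ [ interval (α + β) (β + β) _ ]
      ≈⟨ M.+-cong {generator 0F M.* generator 2F} {[ interval (α + α) (α + β) _ ]}
           {generator 1F M.* generator 2F} {[ interval (α + β) (β + β) _ ]}
           (translate α (≤-trans αα≤αβ ≤-refl) refl refl)
           (translate β (≤-trans ≤-refl αβ≤ββ) (+-comm β α) refl) ⟨
    generator 0F M.* generator 2F M.+ generator 1F M.* generator 2F ∎)
    where
    open SetoidReasoning M.setoid
    αα≤αβ : α + α ≤ α + β
    αα≤αβ = +-monoʳ-≤ α α≤β
    αβ≤ββ : α + β ≤ β + β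
    αβ≤ββ = +-monoˡ-≤ β α≤β
    translate : ∀ x {y z} (y≤z : y ≤ z) → x + α ≈ y → x + β ≈ z →
      [ singleton x ] M.* generator 2F M.≈ [ interval y z y≤z ]
    translate x {y} {z} y≤z eq eq′ = M.trans
      {[ singleton x ] M.* generator 2F} {point x M.* generator 2F} {[ interval y z y≤z ]}
      (M.*-congʳ {generator 2F} {[ singleton x ]} {point x} (singleton≈point x))
      (interval-* ≤-refl α≤β y≤z eq eq′)

  powerProduct-position : ∀ m → EM.powerProduct (generator ∘ inject₁) m M.≈ point (position m)
  powerProduct-position (k ∷ l ∷ []) = begin
    generator 0F ^ k M.* (generator 1F ^ l M.* M.1#)
      ≈⟨ M.*-cong (power α k) (M.trans (M.*-identityʳ (generator 1F ^ l)) (power β l)) ⟩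
    point (k · α) M.* point (l · β)
      ≈⟨ point-* (k · α) (l · β) ⟩
    point (k · α + l · β) ∎
    where
    open SetoidReasoning M.setoid
    power : ∀ x n → [ singleton x ] ^ n M.≈ point (n · x)
    power x n = M.trans (^-congˡ n (singleton≈point x)) (point-^ x n)

  evaluate-point : ∀ m t → evaluate (EM.powerProduct (generator ∘ inject₁) m) t ℂ.≈ 𝟙 (t ∈[ position m , position m ]?)
  evaluate-point m t = ℂ.trans {evaluate (EM.powerProduct (generator ∘ inject₁) m) t} {evaluate (point (position m)) t}
     {𝟙 (t ∈[ position m , position m ]?)} (at (powerProduct-position m) t) (evaluate-interval ≤-refl t)

  translate : ∀ m → EM.powerProduct (generator ∘ inject₁) m M.* generator 2F M.≈
    [ interval (position m + α) (position m + β) (+-monoʳ-≤ (position m) α≤β) ]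
  translate m = M.trans
    {EM.powerProduct (generator ∘ inject₁) m M.* generator 2F} {point (position m) M.* generator 2F}
    {[ interval (position m + α) (position m + β) (+-monoʳ-≤ (position m) α≤β) ]}
    (M.*-congʳ {generator 2F} {EM.powerProduct (generator ∘ inject₁) m} {point (position m)}
      (powerProduct-position m))
    (interval-* ≤-refl α≤β (+-monoʳ-≤ (position m) α≤β) refl refl)

  evaluate-translate : ∀ m t → evaluate (EM.powerProduct (generator ∘ inject₁) m M.* generator 2F) t ℂ.≈
      𝟙 (t ∈[ position m + α , position m + β ]?)
  evaluate-translate m t = ℂ.trans {evaluate (EM.powerProduct (generator ∘ inject₁) m M.* generator 2F) t}
    {evaluate [ interval (position m + α) (position m + β) (+-monoʳ-≤ (position m) α≤β) ] t} {𝟙 (t ∈[ position m + α , position m + β ]?)}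
    (at (translate m) t) (evaluate-interval (+-monoʳ-≤ (position m) α≤β) t)

  module _ (Q : CommutativeAlgebra ℂ c ℓ) (g : Fin 3 → CommutativeAlgebra.Carrier Q) where

    private
      module Q = CommutativeAlgebra Q
      module EQ = Evaluation Q

    -- `R α β α<β` embeds by `proj₁` and `Q` by ψ. Both images are the subalgebra generated by the
    -- three `generator j`, that of ψ because the `g j` generate `Q`.
    presentation : (g 2F Q.- g 0F) Q.* (g 2F Q.- g 1F) Q.≈ Q.0# →
      (∀ m m′ → position m ≈ position m′ →
        EQ.powerProduct (g ∘ inject₁) m Q.≈ EQ.powerProduct (g ∘ inject₁) m′) →
      (∀ q → Generated.InSubalgebra Q g q) →
      {ψ : Q.Carrier → M.Carrier} → IsAlgebraHomomorphism Q M[𝓟] ψ →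
      (∀ j → ψ (g j) M.≈ generator j) → R α β α<β ≅ Q
    presentation relation collisions generates {ψ} ψ-hom ψ-generator =
      sameImage⇒≅ (R α β α<β) Q M[𝓟] {proj₁} {ψ} proj₁-hom (λ eq → eq) ψ-hom
        (λ {p} {q} → IntervalKernel.injective ℝ α β α<β M[𝓟] Q generator evaluate (λ {p} {q} → at {p} {q}) evaluate-combine
          evaluate-point evaluate-translate
          g relation collisions generates ψ-hom ψ-generator {p} {q})
        (λ (q , q∈) → InSubalgebra-preimage Q M[𝓟] {g = g} {generator} {ψ} ψ-hom ψ-generator q∈)
        (λ p → (ψ p , image-InSubalgebra Q M[𝓟] {g = g} {generator} {ψ} ψ-hom ψ-generator (generates p)) , M.refl {ψ p})
      where
      proj₁-hom : IsAlgebraHomomorphism (R α β α<β) M[𝓟] proj₁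
      proj₁-hom = record
        { cong = λ eq → eq
        ; +-homo = λ (p , _) (q , _) → M.refl {p M.+ q}
        ; *-homo = λ (p , _) (q , _) → M.refl {p M.* q}
        ; scalar-homo = λ k → M.refl {M.scalar k}
        }

-- Coprimality in the natural numbers.

private
  -- A rational number is stored as a coprime pair, so a ratio j/k must be reduced first; the common
  -- factor is returned in order to be cancelled later.
  lowestTerms : ∀ j k → k ≢ 0 → ∃₂ λ m n → Coprime m n × n ≢ 0 × (∃[ g ] g ≢ 0 × j ≡ g ℕ.* m × k ≡ g ℕ.* n)
  lowestTerms j k k≢0 = j / g , k / g , coprime-/gcd j k , n/gcd[m,n]≢0 j k ,
    g , g≢0 , cofactor (gcd[m,n]∣m j k) , cofactor (gcd[m,n]∣n j k)
    where
    g : ℕ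
    g = gcd j k
    g≢0 : g ≢ 0
    g≢0 = gcd[m,n]≢0 j k (inj₂ k≢0)
    instance
      g-nonZero : NonZero g
      g-nonZero = ℕ.≢-nonZero g≢0
      k-nonZero : NonZero k
      k-nonZero = ℕ.≢-nonZero k≢0
    cofactor : ∀ {i} → g ∣ i → i ≡ g ℕ.* (i / g)
    cofactor g∣i = ≡.trans (≡.sym (m/n*n≡m g∣i)) (ℕ.*-comm _ g)

  -- The equation shows that `n` divides k m, hence `k` by coprimality; substituting k = j n and
  -- cancelling `n` gives `b′`.
  coprime-multiples : ∀ {m n} .{{_ : NonZero n}} → Coprime m n →
    ∀ k b b′ → n ℕ.* b′ ≡ k ℕ.* m ℕ.+ n ℕ.* b → ∃[ j ] k ≡ j ℕ.* n × b′ ≡ j ℕ.* m ℕ.+ b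
  coprime-multiples {m} {n} m⊥n k b b′ eq = go n∣k
    where
    n∣k : n ∣ k
    n∣k = coprime-divisor {n = m} (Coprime.sym m⊥n) (≡.subst (n ∣_) (ℕ.*-comm k m)
      (∣m+n∣m⇒∣n (≡.subst (n ∣_) (≡.trans eq (ℕ.+-comm (k ℕ.* m) _)) (m∣m*n b′)) (m∣m*n b)))

    go : n ∣ k → ∃[ j ] k ≡ j ℕ.* n × b′ ≡ j ℕ.* m ℕ.+ b
    go (divides j ≡.refl) = j , ≡.refl , ℕ.*-cancelˡ-≡ b′ (j ℕ.* m ℕ.+ b) n (≡.trans eq
      (≡.trans (≡.cong (ℕ._+ n ℕ.* b) (≡.trans (≡.cong (ℕ._* m) (ℕ.*-comm j n)) (ℕ.*-assoc n j m)))
        (≡.sym (ℕ.*-distribˡ-+ n (j ℕ.* m) b))))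

-- Ratios of real numbers and coincidences between multiples of α and β.

module Ratios (ℝ : CompleteOrderedField) where

  open CompleteOrderedField ℝ hiding (zero)
  open Reals ℝ
  open Mult semiring using (×-congʳ; ×-homo-+; ×-assocˡ; ×-assoc-*)
  open CommutativeMonoidMult +-commutativeMonoid using (×-distrib-+)
  open RingProperties ring using (-‿distribˡ-*)
  open AbelianGroupProperties +-abelianGroup using (inverseˡ-unique; ∙-cancelˡ)
  open SetoidReasoning setoid

  *-cancelʳ : ∀ {x y z} → z ≉ 0# → x * z ≈ y * z → x ≈ y
  *-cancelʳ {x} {y} {z} z≉0 eq = begin
    x                ≈⟨ undo x ⟨
    (x * z) * z⁻¹    ≈⟨ *-congʳ eq ⟩
    (y * z) * z⁻¹    ≈⟨ undo y ⟩
    y ∎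
    where
    z⁻¹ : Carrier
    z⁻¹ = proj₁ (inverse z≉0)
    undo : ∀ x → (x * z) * z⁻¹ ≈ x
    undo x = trans (*-assoc x z z⁻¹) (trans (*-congˡ (proj₂ (inverse z≉0))) (*-identityʳ x))

  ·-as-* : ∀ n x → (n · 1#) * x ≈ n · x
  ·-as-* n x = trans (×-assoc-* n 1# x) (×-congʳ n (*-identityˡ x))

  ·-zeroʳ : ∀ n {x} → x ≈ 0# → n · x ≈ 0#
  ·-zeroʳ n x≈0 = trans (×-congʳ n x≈0) (trans (sym (·-as-* n 0#)) (zeroʳ _))

  n·1≉0 : ∀ {n} → n ≢ 0 → n · 1# ≉ 0#
  n·1≉0 {zero}  n≢0 = contradiction ≡.refl n≢0
  n·1≉0 {suc n} n≢0 = [1+n]·1≉0 n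

  ·-cancelˡ : ∀ {n x y} → n ≢ 0 → n · x ≈ n · y → x ≈ y
  ·-cancelˡ {n} {x} {y} n≢0 eq = *-cancelʳ (n·1≉0 n≢0) (begin
    x * (n · 1#)  ≈⟨ *-comm x _ ⟩
    (n · 1#) * x  ≈⟨ ·-as-* n x ⟩
    n · x         ≈⟨ eq ⟩
    n · y         ≈⟨ ·-as-* n y ⟨
    (n · 1#) * y  ≈⟨ *-comm _ y ⟩
    y * (n · 1#)  ∎)

  ·-injective : ∀ {x} → x ≉ 0# → ∀ m n → m · x ≈ n · x → m ≡ n
  ·-injective {x} x≉0 m n eq = go m n (*-cancelʳ x≉0 (begin
    (m · 1#) * x ≈⟨ ·-as-* m x ⟩
    m · x        ≈⟨ eq ⟩
    n · x        ≈⟨ ·-as-* n x ⟨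
    (n · 1#) * x ∎))
    where
    go : ∀ m n → m · 1# ≈ n · 1# → m ≡ n
    go zero    zero    _  = ≡.refl
    go zero    (suc n) eq = contradiction (sym eq) ([1+n]·1≉0 n)
    go (suc m) zero    eq = contradiction eq ([1+n]·1≉0 m)
    go (suc m) (suc n) eq = ≡.cong suc (go m n (∙-cancelˡ 1# _ _ eq))

  quotient⇔ : ∀ {x y z w} (y≉0 : y ≉ 0#) (w≉0 : w ≉ 0#) → (x / y [ y≉0 ] ≈ z / w [ w≉0 ]) ⇔ (w * x ≈ z * y)
  quotient⇔ {x} {y} {z} {w} y≉0 w≉0 = mk⇔
    (λ eq → begin
      w * x                     ≈⟨ *-comm w x ⟩
      x * w                     ≈⟨ *-congʳ (*-identityʳ x) ⟨
      (x * 1#) * w              ≈⟨ *-congʳ (*-congˡ (proj₂ (inverse y≉0))) ⟨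
      (x * (y * y⁻¹)) * w       ≈⟨ *-congʳ (rotate x y y⁻¹) ⟩
      ((x * y⁻¹) * y) * w       ≈⟨ *-congʳ (*-congʳ eq) ⟩
      ((z * w⁻¹) * y) * w       ≈⟨ *-assoc _ y w ⟩
      (z * w⁻¹) * (y * w)       ≈⟨ *-congˡ (*-comm y w) ⟩
      (z * w⁻¹) * (w * y)       ≈⟨ *-assoc _ w y ⟨
      ((z * w⁻¹) * w) * y       ≈⟨ *-congʳ (rotate z w w⁻¹) ⟨
      (z * (w * w⁻¹)) * y       ≈⟨ *-congʳ (*-congˡ (proj₂ (inverse w≉0))) ⟩
      (z * 1#) * y              ≈⟨ *-congʳ (*-identityʳ z) ⟩
      z * y ∎)
    (λ eq → *-cancelʳ w≉0 (*-cancelʳ y≉0 (begin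
      ((x * y⁻¹) * w) * y       ≈⟨ *-assoc _ w y ⟩
      (x * y⁻¹) * (w * y)       ≈⟨ *-congˡ (*-comm w y) ⟩
      (x * y⁻¹) * (y * w)       ≈⟨ *-assoc _ y w ⟨
      ((x * y⁻¹) * y) * w       ≈⟨ *-congʳ (rotate x y y⁻¹) ⟨
      (x * (y * y⁻¹)) * w       ≈⟨ *-congʳ (*-congˡ (proj₂ (inverse y≉0))) ⟩
      (x * 1#) * w              ≈⟨ *-congʳ (*-identityʳ x) ⟩
      x * w                     ≈⟨ *-comm x w ⟩
      w * x                     ≈⟨ eq ⟩
      z * y                     ≈⟨ *-congʳ (*-identityʳ z) ⟨
      (z * 1#) * y              ≈⟨ *-congʳ (*-congˡ (proj₂ (inverse w≉0))) ⟨
      (z * (w * w⁻¹)) * y       ≈⟨ *-congʳ (rotate z w w⁻¹) ⟩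
      ((z * w⁻¹) * w) * y ∎)))
    where
    y⁻¹ w⁻¹ : Carrier
    y⁻¹ = proj₁ (inverse y≉0)
    w⁻¹ = proj₁ (inverse w≉0)
    rotate : ∀ x y z → x * (y * z) ≈ (x * z) * y
    rotate x y z = trans (*-congˡ (*-comm y z)) (sym (*-assoc x z y))

  module _ {α β : Carrier} (β≉0 : β ≉ 0#) where

    fromℚ⇔ : ∀ q → (α / β [ β≉0 ] ≈ fromℚ q) ⇔ (↧ₙ q · α ≈ fromℤ (↥ q) * β)
    fromℚ⇔ q = mk⇔
      (λ eq → trans (sym (·-as-* (↧ₙ q) α)) (Equivalence.to cross eq))
      (λ eq → Equivalence.from cross (trans (·-as-* (↧ₙ q) α) eq))
      where
      cross : (α / β [ β≉0 ] ≈ fromℚ q) ⇔ ((↧ₙ q · 1#) * α ≈ fromℤ (↥ q) * β)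
      cross = quotient⇔ β≉0 ([1+n]·1≉0 (ℚ.ℚ.denominator-1 q))

    positive-ratio⇔ : ∀ m n .{{_ : NonZero n}} .(m⊥n : Coprime m n) →
      (α / β [ β≉0 ] ≈ fromℚ (mkℚ+ m n m⊥n)) ⇔ (n · α ≈ m · β)
    positive-ratio⇔ m n@(suc _) m⊥n = mk⇔
      (λ eq → trans (Equivalence.to (fromℚ⇔ q) eq) (·-as-* m β))
      (λ eq → Equivalence.from (fromℚ⇔ q) (trans eq (sym (·-as-* m β))))
      where
      q : ℚ
      q = mkℚ+ m n m⊥n

    -- The right-hand side has the shape of x^n y^m = 1. The numerator 0 is a separate case: its
    -- negation is again non-negative and is read by the other clause of `fromℤ`.
    negative-ratio⇔ : ∀ m n .{{_ : NonZero n}} .(m⊥n : Coprime m n) →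
      (α / β [ β≉0 ] ≈ fromℚ (ℚ.- mkℚ+ m n m⊥n)) ⇔ (n · α + m · β ≈ 0#)
    negative-ratio⇔ zero n@(suc _) m⊥n = mk⇔
      (λ eq → trans (+-identityʳ _) (trans (Equivalence.to (fromℚ⇔ q) eq) (zeroˡ β)))
      (λ eq → Equivalence.from (fromℚ⇔ q) (trans (sym (+-identityʳ _)) (trans eq (sym (zeroˡ β)))))
      where
      q : ℚ
      q = ℚ.- mkℚ+ 0 n m⊥n
    negative-ratio⇔ m@(suc _) n@(suc _) m⊥n = mk⇔
      (λ eq → trans (+-congʳ (trans (Equivalence.to (fromℚ⇔ q) eq) (sym negate))) (-‿inverseˡ _))
      (λ eq → Equivalence.from (fromℚ⇔ q) (trans (inverseˡ-unique _ _ eq) negate))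
      where
      q : ℚ
      q = ℚ.- mkℚ+ m n m⊥n
      negate : - (m · β) ≈ - (m · 1#) * β
      negate = trans (-‿cong (sym (·-as-* m β))) (-‿distribˡ-* _ β)

    -- A coincidence with k > 0 would give k α = ± j β with j = |b - b′|, which in lowest terms
    -- exhibits α/β as a rational number. The two signs are the two orders of `b` and `b′`.
    irrational-independent : ¬ (∃[ q ] α / β [ β≉0 ] ≈ fromℚ q) →
      ∀ k b b′ → k · α + b · β ≈ b′ · β → k ≡ 0 × b ≡ b′
    irrational-independent irrational zero    b b′ eq =
      ≡.refl , ·-injective β≉0 b b′ (trans (sym (+-identityˡ _)) eq)
    irrational-independent irrational k@(suc _) b b′ eq with ℕ.≤-total b b′
    ... | inj₁ b≤b′ with ℕ.m≤n⇒∃[o]m+o≡n b≤b′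
    ...   | j , ≡.refl with lowestTerms j k (λ ())
    ...     | m , n , m⊥n , n≢0 , g , g≢0 , j≡gm , k≡gn = contradiction
      (mkℚ+ m n m⊥n , Equivalence.from (positive-ratio⇔ m n m⊥n) (·-cancelˡ g≢0 (begin
        g · (n · α)     ≈⟨ ×-assocˡ α g n ⟩
        (g ℕ.* n) · α   ≡⟨ ≡.cong (_· α) k≡gn ⟨
        k · α           ≈⟨ ∙-cancelˡ (b · β) _ _ (trans (+-comm _ _) (trans eq (×-homo-+ β b j))) ⟩
        j · β           ≡⟨ ≡.cong (_· β) j≡gm ⟩
        (g ℕ.* m) · β   ≈⟨ ×-assocˡ β g m ⟨
        g · (m · β)     ∎))) irrational
      where instance n-nonZero = ℕ.≢-nonZero n≢0
    irrational-independent irrational k@(suc _) b b′ eq | inj₂ b′≤b with ℕ.m≤n⇒∃[o]m+o≡n b′≤b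
    ...   | j , ≡.refl with lowestTerms j k (λ ())
    ...     | m , n , m⊥n , n≢0 , g , g≢0 , j≡gm , k≡gn = contradiction
      (ℚ.- mkℚ+ m n m⊥n , Equivalence.from (negative-ratio⇔ m n m⊥n) (·-cancelˡ g≢0 (begin
        g · (n · α + m · β)            ≈⟨ ×-distrib-+ (n · α) (m · β) g ⟩
        g · (n · α) + g · (m · β)      ≈⟨ +-cong (×-assocˡ α g n) (×-assocˡ β g m) ⟩
        (g ℕ.* n) · α + (g ℕ.* m) · β  ≡⟨ ≡.cong₂ (λ i j → i · α + j · β) k≡gn j≡gm ⟨
        k · α + j · β                  ≈⟨ ∙-cancelˡ (b′ · β) _ _ (begin
          b′ · β + (k · α + j · β)       ≈⟨ x∙yz≈y∙xz′ _ _ _ ⟩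
          k · α + (b′ · β + j · β)       ≈⟨ +-congˡ (×-homo-+ β b′ j) ⟨
          k · α + (b′ ℕ.+ j) · β         ≈⟨ eq ⟩
          b′ · β                         ≈⟨ +-identityʳ _ ⟨
          b′ · β + 0#                    ∎) ⟩
        0#                             ≈⟨ zeroʳ _ ⟨
        (g · 1#) * 0#                  ≈⟨ ·-as-* g 0# ⟩
        g · 0#                         ∎))) irrational
      where
      instance n-nonZero = ℕ.≢-nonZero n≢0
      open CommutativeSemigroupProperties +-commutativeSemigroup using () renaming (x∙yz≈y∙xz to x∙yz≈y∙xz′)

    -- Multiplying by `n` and replacing n α by m β turns the coincidence into one between multiples
    -- of β alone, hence into an equation of natural numbers.
    positive-collision : ∀ m n .{{_ : NonZero n}} → Coprime m n → n · α ≈ m · β →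
      ∀ k b b′ → k · α + b · β ≈ b′ · β → ∃[ j ] k ≡ j ℕ.* n × b′ ≡ j ℕ.* m ℕ.+ b
    positive-collision m n m⊥n nα≈mβ k b b′ eq = coprime-multiples m⊥n k _ _ scaled
      where
      scaled : n ℕ.* b′ ≡ k ℕ.* m ℕ.+ n ℕ.* b
      scaled = ·-injective β≉0 _ _ (begin
        (n ℕ.* b′) · β                     ≈⟨ ×-assocˡ β n b′ ⟨
        n · (b′ · β)                       ≈⟨ ×-congʳ n eq ⟨
        n · (k · α + b · β)                ≈⟨ ×-distrib-+ _ _ n ⟩
        n · (k · α) + n · (b · β)          ≈⟨ +-cong (×-assocˡ α n k) (×-assocˡ β n b) ⟩
        (n ℕ.* k) · α + (n ℕ.* b) · β      ≡⟨ ≡.cong (λ i → i · α + (n ℕ.* b) · β) (ℕ.*-comm n k) ⟩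
        (k ℕ.* n) · α + (n ℕ.* b) · β      ≈⟨ +-congʳ (×-assocˡ α k n) ⟨
        k · (n · α) + (n ℕ.* b) · β        ≈⟨ +-congʳ (×-congʳ k nα≈mβ) ⟩
        k · (m · β) + (n ℕ.* b) · β        ≈⟨ +-congʳ (×-assocˡ β k m) ⟩
        (k ℕ.* m) · β + (n ℕ.* b) · β      ≈⟨ ×-homo-+ β (k ℕ.* m) (n ℕ.* b) ⟨
        (k ℕ.* m ℕ.+ n ℕ.* b) · β          ∎)

    -- Add k (n α + m β) = 0 to n b β and collect n (k α + b β) = n b′ β: this leaves n b = k m + n
    -- b′, with `b` and `b′` in exchanged roles compared with a positive ratio.
    negative-collision : ∀ m n .{{_ : NonZero n}} → Coprime m n → n · α + m · β ≈ 0# →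
      ∀ k b b′ → k · α + b · β ≈ b′ · β → ∃[ j ] k ≡ j ℕ.* n × b ≡ j ℕ.* m ℕ.+ b′
    negative-collision m n m⊥n nα+mβ≈0 k b b′ eq = coprime-multiples m⊥n k _ _ scaled
      where
      scaled : n ℕ.* b ≡ k ℕ.* m ℕ.+ n ℕ.* b′
      scaled = ·-injective β≉0 _ _ (begin
        (n ℕ.* b) · β                                   ≈⟨ +-identityˡ _ ⟨
        0# + (n ℕ.* b) · β                              ≈⟨ +-congʳ (·-zeroʳ k nα+mβ≈0) ⟨
        k · (n · α + m · β) + (n ℕ.* b) · β             ≈⟨ +-congʳ (×-distrib-+ _ _ k) ⟩
        (k · (n · α) + k · (m · β)) + (n ℕ.* b) · β     ≈⟨ +-congʳ (+-comm _ _) ⟩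
        (k · (m · β) + k · (n · α)) + (n ℕ.* b) · β     ≈⟨ +-assoc _ _ _ ⟩
        k · (m · β) + (k · (n · α) + (n ℕ.* b) · β)     ≈⟨ +-cong (×-assocˡ β k m) (+-cong
                                                             (trans (×-assocˡ α k n) (reflexive (≡.cong (_· α) (ℕ.*-comm k n))))
                                                             (sym (×-assocˡ β n b))) ⟩
        (k ℕ.* m) · β + ((n ℕ.* k) · α + n · (b · β))   ≈⟨ +-congˡ (+-congʳ (×-assocˡ α n k)) ⟨
        (k ℕ.* m) · β + (n · (k · α) + n · (b · β))     ≈⟨ +-congˡ (×-distrib-+ _ _ n) ⟨
        (k ℕ.* m) · β + n · (k · α + b · β)             ≈⟨ +-congˡ (×-congʳ n eq) ⟩
        (k ℕ.* m) · β + n · (b′ · β)                    ≈⟨ +-congˡ (×-assocˡ β n b′) ⟩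
        (k ℕ.* m) · β + (n ℕ.* b′) · β                  ≈⟨ ×-homo-+ β (k ℕ.* m) (n ℕ.* b′) ⟨
        (k ℕ.* m ℕ.+ n ℕ.* b′) · β                      ∎)

-- From coincidences to equal monomials.

module _ {K : CommutativeRing 0ℓ 0ℓ} (A : CommutativeAlgebra K c ℓ) where

  open CommutativeAlgebra A hiding (zero)
  open Exp semiring using (_^_; ^-congˡ; ^-homo-*; ^-assocʳ)
  open CommutativeSemiringExp commutativeSemiring using (^-distrib-*)
  open SetoidReasoning setoid

  1^n≈1 : ∀ n → 1# ^ n ≈ 1#
  1^n≈1 zero    = refl
  1^n≈1 (suc n) = trans (*-identityˡ _) (1^n≈1 n)

  -- Here x^(jn) = (x^n)^j = (y^m)^j = y^(jm).
  positive-powers : ∀ {x y m n} → y ^ m ≈ x ^ n → ∀ {k b b′} →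
    ∃[ j ] k ≡ j ℕ.* n × b′ ≡ j ℕ.* m ℕ.+ b → x ^ k * y ^ b ≈ y ^ b′
  positive-powers {x} {y} {m} {n} y^m≈x^n {b = b} (j , ≡.refl , ≡.refl) = begin
    x ^ (j ℕ.* n) * y ^ b      ≡⟨ ≡.cong (λ i → x ^ i * y ^ b) (ℕ.*-comm j n) ⟩
    x ^ (n ℕ.* j) * y ^ b      ≈⟨ *-congʳ (^-assocʳ x n j) ⟨
    (x ^ n) ^ j * y ^ b        ≈⟨ *-congʳ (^-congˡ j y^m≈x^n) ⟨
    (y ^ m) ^ j * y ^ b        ≈⟨ *-congʳ (^-assocʳ y m j) ⟩
    y ^ (m ℕ.* j) * y ^ b      ≈⟨ ^-homo-* y (m ℕ.* j) b ⟨
    y ^ (m ℕ.* j ℕ.+ b)        ≡⟨ ≡.cong (λ i → y ^ (i ℕ.+ b)) (ℕ.*-comm m j) ⟩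
    y ^ (j ℕ.* m ℕ.+ b) ∎

  -- The factor x^(jn) y^(jm) = (x^n y^m)^j is 1.
  negative-powers : ∀ {x y m n} → x ^ n * y ^ m ≈ 1# → ∀ {k b b′} →
    ∃[ j ] k ≡ j ℕ.* n × b ≡ j ℕ.* m ℕ.+ b′ → x ^ k * y ^ b ≈ y ^ b′
  negative-powers {x} {y} {m} {n} x^ny^m≈1 {b′ = b′} (j , ≡.refl , ≡.refl) = begin
    x ^ (j ℕ.* n) * y ^ (j ℕ.* m ℕ.+ b′)
      ≈⟨ *-congˡ (^-homo-* y (j ℕ.* m) b′) ⟩
    x ^ (j ℕ.* n) * (y ^ (j ℕ.* m) * y ^ b′)
      ≡⟨ ≡.cong₂ (λ i l → x ^ i * (y ^ l * y ^ b′)) (ℕ.*-comm j n) (ℕ.*-comm j m) ⟩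
    x ^ (n ℕ.* j) * (y ^ (m ℕ.* j) * y ^ b′)
      ≈⟨ *-assoc _ _ _ ⟨
    (x ^ (n ℕ.* j) * y ^ (m ℕ.* j)) * y ^ b′
      ≈⟨ *-congʳ (*-cong (^-assocʳ x n j) (^-assocʳ y m j)) ⟨
    ((x ^ n) ^ j * (y ^ m) ^ j) * y ^ b′
      ≈⟨ *-congʳ (^-distrib-* (x ^ n) (y ^ m) j) ⟨
    (x ^ n * y ^ m) ^ j * y ^ b′
      ≈⟨ *-congʳ (trans (^-congˡ j x^ny^m≈1) (1^n≈1 j)) ⟩
    1# * y ^ b′
      ≈⟨ *-identityˡ _ ⟩
    y ^ b′ ∎

module Collisions (ℝ : CompleteOrderedField)
  (α β : CompleteOrderedField.Carrier ℝ) (α<β : CompleteOrderedField._<_ ℝ α β) where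

  open import Data.Vec.Base using ([]; _∷_)
  open Reals ℝ
  open IntervalKernel ℝ α β α<β using (position)
  private module ℝ = CompleteOrderedField ℝ

  module _ (Q : CommutativeAlgebra ℂ c ℓ) (g : Fin 3 → CommutativeAlgebra.Carrier Q) where

    open CommutativeAlgebra Q hiding (zero)
    open Exp semiring using (_^_; ^-homo-*)
    open Evaluation Q using (powerProduct)
    open SetoidReasoning setoid

    -- The smaller power of x is factored out of both monomials, which leaves a coincidence with α
    -- on one side only. Cancellation takes place among the real numbers; in `Q` the equation is
    -- merely multiplied by that power.
    collisions : (∀ k b b′ → k · α ℝ.+ b · β ℝ.≈ b′ · β → g 0F ^ k * g 1F ^ b ≈ g 1F ^ b′) →
      ∀ m m′ → position m ℝ.≈ position m′ → powerProduct (g ∘ inject₁) m ≈ powerProduct (g ∘ inject₁) m′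
    collisions collide (a ∷ b ∷ []) (a′ ∷ b′ ∷ []) eq = case (ℕ.≤-total a a′)
      where
      open Mult ℝ.semiring using (×-homo-+)
      open AbelianGroupProperties ℝ.+-abelianGroup using (∙-cancelˡ)

      ordered : ∀ a b a′ b′ → a′ ℕ.≤ a → a · α ℝ.+ b · β ℝ.≈ a′ · α ℝ.+ b′ · β →
        g 0F ^ a * (g 1F ^ b * 1#) ≈ g 0F ^ a′ * (g 1F ^ b′ * 1#)
      ordered a b a′ b′ a′≤a eq with ℕ.m≤n⇒∃[o]m+o≡n a′≤a
      ... | k , ≡.refl = begin
        g 0F ^ (a′ ℕ.+ k) * (g 1F ^ b * 1#)        ≈⟨ *-cong (^-homo-* (g 0F) a′ k) (*-identityʳ _) ⟩
        (g 0F ^ a′ * g 0F ^ k) * g 1F ^ b          ≈⟨ *-assoc _ _ _ ⟩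
        g 0F ^ a′ * (g 0F ^ k * g 1F ^ b)          ≈⟨ *-congˡ (collide k b b′ (∙-cancelˡ (a′ · α) _ _
                                                        (ℝ.trans (ℝ.sym (ℝ.trans (ℝ.+-congʳ (×-homo-+ α a′ k)) (ℝ.+-assoc _ _ _))) eq))) ⟩
        g 0F ^ a′ * g 1F ^ b′                      ≈⟨ *-congˡ (*-identityʳ _) ⟨
        g 0F ^ a′ * (g 1F ^ b′ * 1#)               ∎

      case : a ℕ.≤ a′ ⊎ a′ ℕ.≤ a → g 0F ^ a * (g 1F ^ b * 1#) ≈ g 0F ^ a′ * (g 1F ^ b′ * 1#)
      case (inj₁ a≤a′) = sym (ordered a′ b′ a b a≤a′ (ℝ.sym eq))
      case (inj₂ a′≤a) = ordered a b a′ b′ a′≤a eq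

-- Images of the relations under a homomorphism.

module _ {K : CommutativeRing 0ℓ 0ℓ} (B : CommutativeAlgebra K c ℓ) where

  private
    module B = CommutativeAlgebra B
    open Exp B.semiring using (_^_; ^-congˡ)
    open AbelianGroupProperties B.+-abelianGroup using (x≈y⇒x∙y⁻¹≈ε)

  module _ {A : CommutativeAlgebra K c₁ ℓ₁} {f : CommutativeAlgebra.Carrier A → B.Carrier}
    (f-hom : IsAlgebraHomomorphism A B f) where

    private
      module A = CommutativeAlgebra A
      module f = IsAlgebraHomomorphism f-hom
      open Exp A.semiring using () renaming (_^_ to _^A_)

    image-quadratic : ∀ {x y z} {x′ y′ z′} → f x B.≈ x′ → f y B.≈ y′ → f z B.≈ z′ →
      (z′ B.- x′) B.* (z′ B.- y′) B.≈ B.0# → f ((z A.- x) A.* (z A.- y)) B.≈ B.0#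
    image-quadratic fx fy fz vanishes = B.trans (f.*-homo _ _) (B.trans (B.*-cong
      (B.trans (f.minus-homo _ _) (B.+-cong fz (B.-‿cong fx)))
      (B.trans (f.minus-homo _ _) (B.+-cong fz (B.-‿cong fy)))) vanishes)

    image-positive : ∀ {x y} {x′ y′} m n → f x B.≈ x′ → f y B.≈ y′ →
      y′ ^ m B.≈ x′ ^ n → f (y ^A m A.- x ^A n) B.≈ B.0#
    image-positive m n fx fy eq = B.trans (f.minus-homo _ _) (x≈y⇒x∙y⁻¹≈ε
      (B.trans (f.^-homo _ m) (B.trans (^-congˡ m fy) (B.trans eq
        (B.sym (B.trans (f.^-homo _ n) (^-congˡ n fx)))))))

    image-negative : ∀ {x y} {x′ y′} m n → f x B.≈ x′ → f y B.≈ y′ →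
      x′ ^ n B.* y′ ^ m B.≈ B.1# → f (x ^A n A.* y ^A m A.- A.1#) B.≈ B.0#
    image-negative m n fx fy eq = B.trans (f.minus-homo _ _) (x≈y⇒x∙y⁻¹≈ε
      (B.trans (f.*-homo _ _) (B.trans (B.*-cong (B.trans (f.^-homo _ n) (^-congˡ n fx))
        (B.trans (f.^-homo _ m) (^-congˡ m fy))) (B.trans eq (B.sym f.1#-homo)))))

open import Data.Rational.Base using (-_)
open import Data.Vec.Functional using (_∷_; [])

-- The presentations in the four cases.

module Presentations (ℝ : CompleteOrderedField)
  (α β : CompleteOrderedField.Carrier ℝ) (α<β : CompleteOrderedField._<_ ℝ α β) where

  open Reals ℝ
  open IntervalRing ℝ using (R)
  open IntervalIndicators ℝ using (point; point-cong; singleton≈point; point-^; point-*; 1≈point)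
  open IntervalPresentation ℝ α β α<β using (generator; generator-relation; presentation)
  open Collisions ℝ α β α<β
  private
    module ℝ = CompleteOrderedField ℝ
    Mℝ = Polyhedra.M[𝓟] ℝ
    module M = CommutativeAlgebra Mℝ
  open Exp M.semiring using (^-congˡ) renaming (_^_ to _^M_)
  open Polyhedra ℝ using (singleton; module PolyhedralFunctions)

  module _ {n k : ℕ} (r : Vector (CommutativeAlgebra.Carrier (Polynomials.algebra ℂ n)) k)
    (v : Fin n → M.Carrier) (v-vanishes : ∀ j → Evaluation.eval Mℝ v (r j) M.≈ M.0#)
    (g : Fin 3 → CommutativeAlgebra.Carrier (Polynomials.algebra ℂ n))
    (g-generator : ∀ j → Evaluation.eval Mℝ v (g j) M.≈ generator j) where

    private
      Q = Polynomials.algebra ℂ n /⟨ r ⟩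
      module Q = CommutativeAlgebra Q
      open Exp Q.semiring using (_^_)

    -- `v` gives the images of the polynomial variables, and `g` the three polynomials in the roles
    -- of x, y and z. With three variables `g` consists of the variables; when 0 is an endpoint, one
    -- entry of `g` is the constant 1.
    quotient-presentation : (∀ j → Generated.InSubalgebra Q g (Polynomials.var ℂ n j)) →
      (g 2F Q.- g 0F) Q.* (g 2F Q.- g 1F) Q.≈ Q.0# →
      (∀ k b b′ → k · α ℝ.+ b · β ℝ.≈ b′ · β → g 0F ^ k Q.* g 1F ^ b Q.≈ g 1F ^ b′) →
      R α β α<β ≅ Q
    quotient-presentation var∈ relation collide =
      presentation Q g relation (collisions Q g collide)
        (PolynomialQuotient.generated-by-variables {K = ℂ} {n} {k} r {I = Fin 3} g var∈)
        {Evaluation.eval Mℝ v}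
        (QuotientProperties.factor {K = ℂ} (Polynomials.algebra ℂ n) {k} r Mℝ {Evaluation.eval Mℝ v}
          (Evaluation.eval-isHomomorphism {K = ℂ} Mℝ v) v-vanishes)
        g-generator

  private
    generator-power : ∀ x l → PolyhedralFunctions.[ singleton x ] ^M l M.≈ point (l · x)
    generator-power x l = M.trans {PolyhedralFunctions.[ singleton x ] ^M l} {point x ^M l} {point (l · x)}
      (^-congˡ l {PolyhedralFunctions.[ singleton x ]} {point x} (singleton≈point x)) (point-^ x l)

    generator-positive : ∀ m n → n · α ℝ.≈ m · β → generator 1F ^M m M.≈ generator 0F ^M n
    generator-positive m n nα≈mβ = M.trans {generator 1F ^M m} {point (m · β)} {generator 0F ^M n}
      (generator-power β m)
      (M.trans {point (m · β)} {point (n · α)} {generator 0F ^M n} (point-cong (ℝ.sym nα≈mβ))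
        (M.sym {generator 0F ^M n} {point (n · α)} (generator-power α n)))

    generator-negative : ∀ m n → n · α ℝ.+ m · β ℝ.≈ ℝ.0# → generator 0F ^M n M.* generator 1F ^M m M.≈ M.1#
    generator-negative m n nα+mβ≈0 = M.trans
      {generator 0F ^M n M.* generator 1F ^M m} {point (n · α) M.* point (m · β)} {M.1#}
      (M.*-cong {generator 0F ^M n} {point (n · α)} {generator 1F ^M m} {point (m · β)}
        (generator-power α n) (generator-power β m))
      (M.trans {point (n · α) M.* point (m · β)} {point (n · α ℝ.+ m · β)} {M.1#} (point-* (n · α) (m · β))
        (M.trans {point (n · α ℝ.+ m · β)} {point ℝ.0#} {M.1#} (point-cong nα+mβ≈0)
          (M.sym {M.1#} {point ℝ.0#} 1≈point)))

  module ThreeVariables where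

    open IntervalRing.ℂ[x,y,z] ℝ

    private
      module e = Evaluation {K = ℂ} Mℝ
      P = Polynomials.algebra ℂ 3
      module P = CommutativeAlgebra P

      quadratic-vanishes : e.eval generator ((z - x) * (z - y)) M.≈ M.0#
      quadratic-vanishes = image-quadratic {K = ℂ} Mℝ {A = P} {e.eval generator} (e.eval-isHomomorphism generator)
        {x} {y} {z} {generator 0F} {generator 1F} {generator 2F}
        (e.eval-var generator 0F) (e.eval-var generator 1F) (e.eval-var generator 2F) generator-relation

    presentation₃ : {k : ℕ} (r : Vector P.Carrier k) → (∀ j → e.eval generator (r j) M.≈ M.0#) → let
      module Q = CommutativeAlgebra (P /⟨ r ⟩)
      open Exp Q.semiring renaming (_^_ to _^Q_) in
      (z - x) * (z - y) Q.≈ Q.0# → (∀ k b b′ → k · α ℝ.+ b · β ℝ.≈ b′ · β → x ^Q k Q.* y ^Q b Q.≈ y ^Q b′) →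
      R α β α<β ≅ P /⟨ r ⟩
    presentation₃ {k} r vanishes = quotient-presentation {3} {k} r generator vanishes (Polynomials.var ℂ 3)
      (e.eval-var generator) (λ j → Generated.generator j)

    irrational-presentation : (β≉0 : β ℝ.≉ ℝ.0#) → ¬ (∃[ q ] α / β [ β≉0 ] ℝ.≈ fromℚ q) →
      R α β α<β ≅ algebra /⟨ (z - x) * (z - y) ∷ [] ⟩
    irrational-presentation β≉0 irrational = presentation₃ r (λ { 0F → quadratic-vanishes })
      (QuotientProperties.relation-vanishes {K = ℂ} P {1} r 0F)
      λ k b b′ eq → collide k b b′ (Ratios.irrational-independent ℝ β≉0 irrational k b b′ eq)
      where
      r : Vector P.Carrier 1
      r = (z - x) * (z - y) ∷ []
      module Q = CommutativeAlgebra (P /⟨ r ⟩)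
      open Exp Q.semiring using () renaming (_^_ to _^Q_)
      collide : ∀ k b b′ → k ≡ 0 × b ≡ b′ → x ^Q k Q.* y ^Q b Q.≈ y ^Q b′
      collide _ b _ (≡.refl , ≡.refl) = Q.*-identityˡ (y ^Q b)

    positive-presentation : (β≉0 : β ℝ.≉ ℝ.0#) → ∀ m n .{{_ : NonZero n}} (m⊥n : Coprime m n) →
      α / β [ β≉0 ] ℝ.≈ fromℚ (mkℚ+ m n m⊥n) →
      R α β α<β ≅ algebra /⟨ (z - x) * (z - y) ∷ y ^ m - x ^ n ∷ [] ⟩
    positive-presentation β≉0 m n m⊥n ratio = presentation₃ r
      (λ { 0F → quadratic-vanishes
         ; 1F → image-positive {K = ℂ} Mℝ {A = P} {e.eval generator} (e.eval-isHomomorphism generator)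
                  {x} {y} {generator 0F} {generator 1F} m n
                  (e.eval-var generator 0F) (e.eval-var generator 1F) (generator-positive m n nα≈mβ) })
      (QuotientProperties.relation-vanishes {K = ℂ} P {2} r 0F)
      λ k b b′ eq → positive-powers {K = ℂ} (P /⟨ r ⟩) {x} {y} {m} {n} relation
        (Ratios.positive-collision ℝ β≉0 m n m⊥n nα≈mβ k b b′ eq)
      where
      r : Vector P.Carrier 2
      r = (z - x) * (z - y) ∷ y ^ m - x ^ n ∷ []
      module Q = CommutativeAlgebra (P /⟨ r ⟩)
      open Exp Q.semiring using () renaming (_^_ to _^Q_)
      open Exp P.semiring using () renaming (_^_ to _^P_)
      nα≈mβ : n · α ℝ.≈ m · β
      nα≈mβ = Equivalence.to (Ratios.positive-ratio⇔ ℝ β≉0 m n m⊥n) ratio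
      relation : y ^Q m Q.≈ x ^Q n
      -- The defining relation is written with powers of the polynomial ring, which `^-agrees` turns
      -- into powers of the quotient.
      relation = ≡.subst₂ Q._≈_
        (QuotientProperties.^-agrees {K = ℂ} P r y m) (QuotientProperties.^-agrees {K = ℂ} P r x n)
        (AbelianGroupProperties.x∙y⁻¹≈ε⇒x≈y Q.+-abelianGroup (y ^P m) (x ^P n)
          (QuotientProperties.relation-vanishes {K = ℂ} P r 1F))

    negative-presentation : (β≉0 : β ℝ.≉ ℝ.0#) → ∀ m n .{{_ : NonZero n}} (m⊥n : Coprime m n) →
      α / β [ β≉0 ] ℝ.≈ fromℚ (- mkℚ+ m n m⊥n) →
      R α β α<β ≅ algebra /⟨ (z - x) * (z - y) ∷ x ^ n * y ^ m - 1# ∷ [] ⟩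
    negative-presentation β≉0 m n m⊥n ratio = presentation₃ r
      (λ { 0F → quadratic-vanishes
         ; 1F → image-negative {K = ℂ} Mℝ {A = P} {e.eval generator} (e.eval-isHomomorphism generator)
                  {x} {y} {generator 0F} {generator 1F} m n
                  (e.eval-var generator 0F) (e.eval-var generator 1F) (generator-negative m n nα+mβ≈0) })
      (QuotientProperties.relation-vanishes {K = ℂ} P {2} r 0F)
      λ k b b′ eq → negative-powers {K = ℂ} (P /⟨ r ⟩) {x} {y} {m} {n} relation
        (Ratios.negative-collision ℝ β≉0 m n m⊥n nα+mβ≈0 k b b′ eq)
      where
      r : Vector P.Carrier 2
      r = (z - x) * (z - y) ∷ x ^ n * y ^ m - 1# ∷ []
      module Q = CommutativeAlgebra (P /⟨ r ⟩)
      open Exp Q.semiring using () renaming (_^_ to _^Q_)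
      open Exp P.semiring using () renaming (_^_ to _^P_)
      nα+mβ≈0 : n · α ℝ.+ m · β ℝ.≈ ℝ.0#
      nα+mβ≈0 = Equivalence.to (Ratios.negative-ratio⇔ ℝ β≉0 m n m⊥n) ratio
      relation : x ^Q n Q.* y ^Q m Q.≈ Q.1#
      relation = ≡.subst₂ (λ u v → u Q.* v Q.≈ Q.1#)
        (QuotientProperties.^-agrees {K = ℂ} P r x n) (QuotientProperties.^-agrees {K = ℂ} P r y m)
        (AbelianGroupProperties.x∙y⁻¹≈ε⇒x≈y Q.+-abelianGroup (x ^P n P.* y ^P m) P.1#
          (QuotientProperties.relation-vanishes {K = ℂ} P r 1F))

  module TwoVariables where

    open IntervalRing.ℂ[x,y] ℝ

    private
      module e = Evaluation {K = ℂ} Mℝ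
      P = Polynomials.algebra ℂ 2
      module P = CommutativeAlgebra P

      r : Vector P.Carrier 1
      r = (y - 1#) * (y - x) ∷ []

      Q = P /⟨ r ⟩
      module Q = CommutativeAlgebra Q
      open Exp Q.semiring using () renaming (_^_ to _^Q_)

      -- The singleton of 0 is the unit for Minkowski addition, so the constant polynomial 1
      -- evaluates to the endpoint that is 0.
      1≈generator : ∀ {w} j → generator j ≡ PolyhedralFunctions.[ singleton w ] → ℝ.0# ℝ.≈ w →
        (v : Fin 2 → M.Carrier) → e.eval v P.1# M.≈ generator j
      1≈generator {w} j eq 0≈w v = ≡.subst (e.eval v P.1# M.≈_) (≡.sym eq)
        (M.trans {e.eval v P.1#} {M.1#} {PolyhedralFunctions.[ singleton w ]}
          (IsAlgebraHomomorphism.1#-homo (e.eval-isHomomorphism v))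
          (M.trans {M.1#} {point ℝ.0#} {PolyhedralFunctions.[ singleton w ]} 1≈point
            (M.trans {point ℝ.0#} {point w} {PolyhedralFunctions.[ singleton w ]} (point-cong 0≈w)
              (M.sym {PolyhedralFunctions.[ singleton w ]} {point w} (singleton≈point w)))))

    -- With 1 for {α}, x for {β} and y for [α, β], the polynomial (y - 1)(y - x) is the general
    -- quadratic relation as it stands. The term k α vanishes, so a coincidence forces b = b′.
    left-zero-presentation : ℝ.0# ℝ.≈ α → R α β α<β ≅ algebra /⟨ (y - 1#) * (y - x) ∷ [] ⟩
    left-zero-presentation 0≈α = quotient-presentation {2} {1} r v
      (λ { 0F → image-quadratic {K = ℂ} Mℝ {A = P} {e.eval v} (e.eval-isHomomorphism v)
        {1#} {x} {y} {generator 0F} {generator 1F} {generator 2F}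
        (g-generator 0F) (g-generator 1F) (g-generator 2F) generator-relation })
      g g-generator
      (λ { 0F → Generated.generator 1F ; 1F → Generated.generator 2F })
      (QuotientProperties.relation-vanishes {K = ℂ} P {1} r 0F)
      λ k b b′ eq → collide k b b′ (Ratios.·-injective ℝ β≉0 b b′ (ℝ.trans (ℝ.sym (drop k b)) eq))
      where
      v : Fin 2 → M.Carrier
      v 0F = generator 1F
      v 1F = generator 2F
      g : Fin 3 → P.Carrier
      g 0F = 1#
      g 1F = x
      g 2F = y
      g-generator : ∀ j → e.eval v (g j) M.≈ generator j
      g-generator 0F = 1≈generator 0F ≡.refl 0≈α v
      g-generator 1F = e.eval-var v 0F
      g-generator 2F = e.eval-var v 1F
      β≉0 : β ℝ.≉ ℝ.0#
      β≉0 β≈0 = proj₂ α<β (ℝ.trans (ℝ.sym 0≈α) (ℝ.sym β≈0))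
      drop : ∀ k b → k · α ℝ.+ b · β ℝ.≈ b · β
      drop k b = ℝ.trans (ℝ.+-congʳ (Ratios.·-zeroʳ ℝ k (ℝ.sym 0≈α))) (ℝ.+-identityˡ _)
      collide : ∀ k b b′ → b ≡ b′ → 1# ^Q k Q.* x ^Q b Q.≈ x ^Q b′
      collide k b b′ ≡.refl = Q.trans {1# ^Q k Q.* x ^Q b} {Q.1# Q.* x ^Q b} {x ^Q b}
        (Q.*-congʳ {x ^Q b} {1# ^Q k} {Q.1#} (1^n≈1 Q k)) (Q.*-identityˡ (x ^Q b))

    -- Now 1 stands for {β} and x for {α}, which swaps the two factors of the relation. The terms b
    -- β and b′ β vanish, so k α = 0 and k = 0, while powers of 1 agree for all exponents.
    right-zero-presentation : β ℝ.≈ ℝ.0# → R α β α<β ≅ algebra /⟨ (y - 1#) * (y - x) ∷ [] ⟩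
    right-zero-presentation β≈0 = quotient-presentation {2} {1} r v
      (λ { 0F → image-quadratic {K = ℂ} Mℝ {A = P} {e.eval v} (e.eval-isHomomorphism v)
        {1#} {x} {y} {generator 1F} {generator 0F} {generator 2F}
        (g-generator 1F) (g-generator 0F) (g-generator 2F)
        (M.trans {(generator 2F M.- generator 1F) M.* (generator 2F M.- generator 0F)}
          {(generator 2F M.- generator 0F) M.* (generator 2F M.- generator 1F)} {M.0#}
          (M.*-comm (generator 2F M.- generator 1F) (generator 2F M.- generator 0F)) generator-relation) })
      g g-generator
      (λ { 0F → Generated.generator 0F ; 1F → Generated.generator 2F })
      (Q.trans {(y - x) * (y - 1#)} {(y - 1#) * (y - x)} {Q.0#} (Q.*-comm (y - x) (y - 1#))
        (QuotientProperties.relation-vanishes {K = ℂ} P {1} r 0F))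
      λ k b b′ eq → collide k b b′ (Ratios.·-injective ℝ α≉0 k 0 (drop k b b′ eq))
      where
      v : Fin 2 → M.Carrier
      v 0F = generator 0F
      v 1F = generator 2F
      g : Fin 3 → P.Carrier
      g 0F = x
      g 1F = 1#
      g 2F = y
      g-generator : ∀ j → e.eval v (g j) M.≈ generator j
      g-generator 0F = e.eval-var v 0F
      g-generator 1F = 1≈generator 1F ≡.refl (ℝ.sym β≈0) v
      g-generator 2F = e.eval-var v 1F
      α≉0 : α ℝ.≉ ℝ.0#
      α≉0 α≈0 = proj₂ α<β (ℝ.trans α≈0 (ℝ.sym β≈0))
      drop : ∀ k b b′ → k · α ℝ.+ b · β ℝ.≈ b′ · β → k · α ℝ.≈ ℝ.0#
      drop k b b′ eq = ℝ.trans (ℝ.sym (ℝ.trans (ℝ.+-congˡ (Ratios.·-zeroʳ ℝ b β≈0)) (ℝ.+-identityʳ _)))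
        (ℝ.trans eq (Ratios.·-zeroʳ ℝ b′ β≈0))
      collide : ∀ k b b′ → k ≡ 0 → x ^Q k Q.* 1# ^Q b Q.≈ 1# ^Q b′
      collide _ b b′ ≡.refl = Q.trans {Q.1# Q.* 1# ^Q b} {1# ^Q b} {1# ^Q b′} (Q.*-identityˡ (1# ^Q b))
        (Q.trans {1# ^Q b} {Q.1#} {1# ^Q b′} (1^n≈1 Q b) (Q.sym {1# ^Q b′} {Q.1#} (1^n≈1 Q b′)))

proposition3p5 : (ℝ : CompleteOrderedField) →
    let open IntervalRing ℝ in
    (α β : Real) (α<β : α < β) →
    ( (0# ≈ α ⊎ β ≈ 0#) →
    let open ℂ[x,y] in
    R α β α<β ≅ algebra /⟨ (y - 1#) * (y - x) ∷ [] ⟩ ) ×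
    ( (α≉0 : α ≉ 0#) (β≉0 : β ≉ 0#) →
    ¬ (∃[ q ] α / β [ β≉0 ] ≈ fromℚ q) →
    let open ℂ[x,y,z] in
    R α β α<β ≅ algebra /⟨ (z - x) * (z - y) ∷ [] ⟩ ) ×
    ( (β≉0 : β ≉ 0#) (m n : ℕ) .{{_ : NonZero m}} .{{_ : NonZero n}} (m⊥n : Coprime m n) →
    α / β [ β≉0 ] ≈ fromℚ (mkℚ+ m n m⊥n) →
    let open ℂ[x,y,z] in
    R α β α<β ≅ algebra /⟨ (z - x) * (z - y) ∷ y ^ m - x ^ n ∷ [] ⟩ ) ×
    ( (β≉0 : β ≉ 0#) (m n : ℕ) .{{_ : NonZero m}} .{{_ : NonZero n}} (m⊥n : Coprime m n) →
    α / β [ β≉0 ] ≈ fromℚ (- mkℚ+ m n m⊥n) →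
    let open ℂ[x,y,z] in
    R α β α<β ≅ algebra /⟨ (z - x) * (z - y) ∷ x ^ n * y ^ m - 1# ∷ [] ⟩ )
proposition3p5 ℝ α β α<β =
  (λ { (inj₁ 0≈α) → left-zero-presentation 0≈α ; (inj₂ β≈0) → right-zero-presentation β≈0 }) ,
  (λ _ → irrational-presentation) ,
  (λ β≉0 m n m⊥n → positive-presentation β≉0 m n m⊥n) ,
  (λ β≉0 m n m⊥n → negative-presentation β≉0 m n m⊥n)
  where
  open Presentations ℝ α β α<β
  open TwoVariables
  open ThreeVariables
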